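{- Let $(A_i)_{i\in I}$ be the collection of all infinite arithmetic progressions $\{mh+b : h=0,1,2,\dots\}$ (with $m,b$ positive integers) consisting of positive odd integers and contained in $\mathcal{U}$. Let $J\subseteq I$ be the set of indices $i$ such that the common difference of $A_i$ is the product of a power of $2$ and a squarefree odd integer, and let $K\subseteq I$ be the set of indices $i$ such that the common difference of $A_i$ is squarefree. Then: (i) $\bigcup_{i\in I}A_i=\bigcup_{i\in J}A_i$; (ii) if there are infinitely many Mersenne primes, then $\bigcup_{i\in I}A_i=\bigcup_{i\in K}A_i$.
   Context: $\mathcal{U}$ denotes the set of positive odd integers $n$ that cannot be written as $n=p+2^k$ with $p$ a prime and $k$ a positive integer. A Mersenne prime is a prime of the form $2^r-1$. -}

module Defs where

open import Data.Nat using (ℕ; zero; suc; _+_; _*_; _∸_; _^_; _≤_; _<_)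
open import Data.Nat.Divisibility using (_∣_)
open import Data.Nat.Primality using (Prime)
open import Data.Product using (Σ; ∃; ∃-syntax; _×_)
open import Relation.Nullary using (¬_)
open import Relation.Binary.PropositionalEquality using (_≡_; _≢_)

Odd : ℕ → Set
Odd n = ¬ (2 ∣ n)

InU : ℕ → Set
InU n = 0 < n × Odd n × (∀ (p k : ℕ) → Prime p → 1 ≤ k → n ≢ p + 2 ^ k)

SquareFree : ℕ → Set
SquareFree n = ∀ (d : ℕ) → d * d ∣ n → d ≡ 1

InAP : ℕ → ℕ → ℕ → Set
InAP m b n = ∃[ h ] n ≡ m * h + b

IndexI : ℕ → ℕ → Set
IndexI m b = 1 ≤ m × 1 ≤ b × (∀ (h : ℕ) → InU (m * h + b))

IndexJ : ℕ → ℕ → Set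
IndexJ m b = IndexI m b × (∃[ a ] ∃[ s ] (m ≡ 2 ^ a * s × Odd s × SquareFree s))

IndexK : ℕ → ℕ → Set
IndexK m b = IndexI m b × SquareFree m

InUnion : (ℕ → ℕ → Set) → ℕ → Set
InUnion P n = ∃[ m ] ∃[ b ] (P m b × InAP m b n)

MersenneExponent : ℕ → Set
MersenneExponent r = Prime (2 ^ r ∸ 1)

-- infinitely many Mersenne primes (r ↦ 2^r - 1 is injective)
InfinitelyManyMersennePrimes : Set
InfinitelyManyMersennePrimes = ∀ (N : ℕ) → ∃[ r ] (N ≤ r × MersenneExponent r)

{-# OPTIONS --safe #-}
-- Dirichlet's theorem shows that for a progression n + mh in U no n - 2^k is
-- prime to m: every k has an odd prime q dividing m and n - 2^k. This only
-- involves the odd radical s of m. For any m′ divisible by s, an equation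
-- m′h + n = p + 2^k therefore forces p to be a prime factor of s, and such
-- equations are excluded by taking m′ = 2^a s with 2^a large, or m′ = 2 s M with
-- a large Mersenne prime M = 2^r - 1: modulo M the powers of 2 are 1, …, 2^(r-1),
-- so n = q + 2^j would follow already in ℕ.
--
-- Dirichlet's theorem is proved with finite sums of rationals. Write w_x for
-- the measure on (ℤ/m)* given by Λ(a)/a, a ≤ x. Shapiro's two identities, for
-- ∑ Λ(d) L_d / d and for ∑ μ(d) log(y/d) L_d / d, combine at two scales y ≪ x to
--     log y · w_x + w_x * w_y = constant + o(log x log y).
-- With u = w_x / log x and v = w_y / log y this reads u + u * v = 2/φ(m), so
-- that u, v ≤ 2/φ(m). If a class α contains no primes then u(α) = 0, and the
-- extremal case of the identity forces 1 - φ(m) u and 1 - φ(m) v to be multiples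
-- of a real character χ mod m with ∑ χ(a) Λ(a)/a ≈ - log y. By Shapiro's first
-- identity L(1, χ) = 0, which Mertens' argument with the nonnegative function
-- 1 * χ excludes.

module Submission where

open import Defs

-- There are no limits: a bound on the primes of a class is refuted at one finite cutoff. Three
-- scales z, y, x are needed for this. The pair (y, x) carries the convolution identity; its error
-- sets y against log x, so x must be exponentially larger than y. The pair (z, y) serves only to
-- bound v from above. No complex characters occur, since the character is found as the sign of a
-- rational function on the classes. The logarithm is replaced by `ℓ`, which adds up rational
-- numbers `h p` over the prime factors. Its exact additivity keeps the divisor-sum identities
-- exact, while its increments stay below 2 / n up to the cutoff. Beyond that, the estimates need
-- only that `h` is nonnegative and that `h 2` lies between 1/2 and 1. In the application the new
-- progression starts at the given n itself, so its term at h = 0 is already known to lie in U and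
-- only the later terms have to be protected.

module DirichletTheorem where

  open import Data.Nat as ℕ using (ℕ; zero; suc; z≤n; s≤s; NonZero; ⌊_/2⌋)
  import Data.Nat.Properties as ℕ
  import Data.Nat.DivMod as ℕ
  import Data.Nat.Induction as ℕ
  open import Data.Nat.Divisibility
  open import Data.Nat.GCD using (module Bézout)
  open import Data.Nat.Coprimality using (Coprime; coprime?; coprime-Bézout; coprime-divisor)
  open import Data.Nat.Primality using (Prime; _Rough_; 2-rough; rough⇒≤; ∤⇒rough-suc; rough∧∣⇒rough; rough∧∣⇒prime; prime⇒nonTrivial; prime⇒nonZero; euclidsLemma; prime[2])
  open import Data.Nat.Tactic.RingSolver using () renaming (solve-∀ to solve-∀ℕ)
  open import Data.Rational using (ℚ; 0ℚ; 1ℚ; _+_; _*_; _-_; -_; _≤_; _<_; ∣_∣; 1/_; _≤?_; positive; nonNegative; >-nonZero; ≢-nonZero)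
  open import Data.Rational.Properties as ℚ using (≤-refl; ≤-trans; ≤-reflexive)
  open import Data.List using (_∷_; [])
  open import Data.Maybe using (Maybe; just; nothing)
  open import Data.Empty using (⊥; ⊥-elim)
  open import Data.Product using (_×_; _,_; proj₁; proj₂; ∃-syntax)
  open import Data.Sum using (_⊎_; inj₁; inj₂)
  open import Level using (0ℓ)
  open import Relation.Nullary using (Dec; yes; no; ¬_; ¬?)
  open import Relation.Binary.PropositionalEquality using (_≡_; _≢_; refl; sym; trans; cong; cong₂; subst; subst₂)
  open import Tactic.RingSolver using (solve; solve-∀)
  open import Tactic.RingSolver.Core.AlmostCommutativeRing using (AlmostCommutativeRing; fromCommutativeRing)

  -- Inequalities and absolute values of rationals

  ℚ-ring : AlmostCommutativeRing 0ℓ 0ℓ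
  ℚ-ring = fromCommutativeRing ℚ.+-*-commutativeRing is0?
    where
    is0? : ∀ x → Maybe (0ℚ ≡ x)
    is0? x with 0ℚ ℚ.≟ x
    ... | yes p = just p
    ... | no  _ = nothing

  -- An inequality a ≤ b is proved by writing b - a as a sum of products of
  -- nonnegative terms; the ring solver checks that identity.
  infixr 6 _⊕_
  infixr 7 _⊗_

  ≥0-by : ∀ {a b} → 0ℚ ≤ a → b ≡ a → 0ℚ ≤ b
  ≥0-by h refl = h

  diff : ∀ {a b} → a ≤ b → 0ℚ ≤ b - a
  diff {a} {b} h = subst (_≤ b - a) (ℚ.+-inverseʳ a) (ℚ.+-monoˡ-≤ (- a) h)

  ≤-by : ∀ {a b e} → 0ℚ ≤ e → b - a ≡ e → a ≤ b
  ≤-by {a} {b} h eq = subst₂ _≤_ (ℚ.+-identityˡ a) (lem a b) (ℚ.+-monoˡ-≤ a (≥0-by h eq))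
    where
    lem : ∀ a b → b - a + a ≡ b
    lem = solve-∀ ℚ-ring

  _⊕_ : ∀ {a b} → 0ℚ ≤ a → 0ℚ ≤ b → 0ℚ ≤ a + b
  _⊕_ = ℚ.+-mono-≤

  *-monoˡ-≤ : ∀ {k a b} → 0ℚ ≤ k → a ≤ b → k * a ≤ k * b
  *-monoˡ-≤ {k} 0≤k = ℚ.*-monoˡ-≤-nonNeg k {{nonNegative 0≤k}}

  *-monoʳ-≤ : ∀ {k a b} → 0ℚ ≤ k → a ≤ b → a * k ≤ b * k
  *-monoʳ-≤ {k} 0≤k = ℚ.*-monoʳ-≤-nonNeg k {{nonNegative 0≤k}}

  _⊗_ : ∀ {a b} → 0ℚ ≤ a → 0ℚ ≤ b → 0ℚ ≤ a * b
  _⊗_ {a} 0≤a 0≤b = ≤-trans (≤-reflexive (sym (ℚ.*-zeroʳ a))) (*-monoˡ-≤ 0≤a 0≤b)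

  0≤1 : 0ℚ ≤ 1ℚ
  0≤1 = ℚ.nonNegative⁻¹ 1ℚ

  0<1 : 0ℚ < 1ℚ
  0<1 = ℚ.positive⁻¹ 1ℚ

  square≥0 : ∀ a → 0ℚ ≤ a * a
  square≥0 a with ℚ.≤-total 0ℚ a
  ... | inj₁ h = h ⊗ h
  ... | inj₂ h = ≥0-by (h' ⊗ h') (solve (a ∷ []) ℚ-ring)
    where
    h' : 0ℚ ≤ - a
    h' = ℚ.neg-antimono-≤ h

  1≰0 : ¬ (1ℚ ≤ 0ℚ)
  1≰0 h = ℚ.<-irrefl refl (ℚ.<-≤-trans 0<1 h)

  *-mono-≤₀ : ∀ {a b c d} → 0ℚ ≤ a → 0ℚ ≤ d → a ≤ b → c ≤ d → a * c ≤ b * d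
  *-mono-≤₀ 0≤a 0≤d a≤b c≤d = ≤-trans (*-monoˡ-≤ 0≤a c≤d) (*-monoʳ-≤ 0≤d a≤b)

  abs-intro : ∀ {a c} → a ≤ c → - a ≤ c → ∣ a ∣ ≤ c
  abs-intro {a} h h' with ℚ.∣p∣≡p∨∣p∣≡-p a
  ... | inj₁ e = subst (_≤ _) (sym e) h
  ... | inj₂ e = subst (_≤ _) (sym e) h'

  ≤-abs : ∀ a → a ≤ ∣ a ∣
  ≤-abs a with ℚ.≤-total 0ℚ a
  ... | inj₁ h = ≤-reflexive (sym (ℚ.0≤p⇒∣p∣≡p h))
  ... | inj₂ h = ≤-trans h (ℚ.0≤∣p∣ a)

  -≤-abs : ∀ a → - a ≤ ∣ a ∣
  -≤-abs a = subst (- a ≤_) (ℚ.∣-p∣≡∣p∣ a) (≤-abs (- a))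

  abs-upper : ∀ {a c} → ∣ a ∣ ≤ c → a ≤ c
  abs-upper {a} = ≤-trans (≤-abs a)

  abs-lower : ∀ {a c} → ∣ a ∣ ≤ c → - a ≤ c
  abs-lower {a} = ≤-trans (-≤-abs a)

  abs-+ : ∀ {a b c d} → ∣ a ∣ ≤ c → ∣ b ∣ ≤ d → ∣ a + b ∣ ≤ c + d
  abs-+ {a} {b} h k = ≤-trans (ℚ.∣p+q∣≤∣p∣+∣q∣ a b) (ℚ.+-mono-≤ h k)

  abs-neg : ∀ {a c} → ∣ a ∣ ≤ c → ∣ - a ∣ ≤ c
  abs-neg {a} = subst (_≤ _) (sym (ℚ.∣-p∣≡∣p∣ a))

  abs-- : ∀ {a b c d} → ∣ a ∣ ≤ c → ∣ b ∣ ≤ d → ∣ a - b ∣ ≤ c + d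
  abs-- h k = abs-+ h (abs-neg k)

  abs-* : ∀ {a b c d} → ∣ a ∣ ≤ c → ∣ b ∣ ≤ d → ∣ a * b ∣ ≤ c * d
  abs-* {a} {b} h k = ≤-trans (≤-reflexive (ℚ.∣p*q∣≡∣p∣*∣q∣ a b))
    (*-mono-≤₀ (ℚ.0≤∣p∣ a) (≤-trans (ℚ.0≤∣p∣ b) k) h k)

  abs-scale : ∀ {k a c} → 0ℚ ≤ k → ∣ a ∣ ≤ c → ∣ k * a ∣ ≤ k * c
  abs-scale 0≤k h = abs-* (≤-reflexive (ℚ.0≤p⇒∣p∣≡p 0≤k)) h

  abs-≡ : ∀ {a b c} → ∣ a ∣ ≤ c → b ≡ a → ∣ b ∣ ≤ c
  abs-≡ h refl = h

  abs-nonneg : ∀ {a c} → 0ℚ ≤ a → a ≤ c → ∣ a ∣ ≤ c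
  abs-nonneg 0≤a = subst (_≤ _) (sym (ℚ.0≤p⇒∣p∣≡p 0≤a))

  abs≥0 : ∀ {a c} → ∣ a ∣ ≤ c → 0ℚ ≤ c
  abs≥0 {a} = ≤-trans (ℚ.0≤∣p∣ a)

  -- Natural numbers and their reciprocals as rationals

  ι : ℕ → ℚ
  ι zero    = 0ℚ
  ι (suc n) = 1ℚ + ι n

  ι≥0 : ∀ n → 0ℚ ≤ ι n
  ι≥0 zero    = ≤-refl
  ι≥0 (suc n) = 0≤1 ⊕ ι≥0 n

  ι-+ : ∀ a b → ι (a ℕ.+ b) ≡ ι a + ι b
  ι-+ zero    b = sym (ℚ.+-identityˡ (ι b))
  ι-+ (suc a) b = trans (cong (1ℚ +_) (ι-+ a b)) (sym (ℚ.+-assoc 1ℚ (ι a) (ι b)))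

  ι-* : ∀ a b → ι (a ℕ.* b) ≡ ι a * ι b
  ι-* zero    b = sym (ℚ.*-zeroˡ (ι b))
  ι-* (suc a) b = trans (ι-+ b (a ℕ.* b)) (trans (cong (ι b +_) (ι-* a b)) (lem (ι a) (ι b)))
    where
    lem : ∀ x y → y + x * y ≡ (1ℚ + x) * y
    lem = solve-∀ ℚ-ring

  ι-mono : ∀ {a b} → a ℕ.≤ b → ι a ≤ ι b
  ι-mono {b = b} ℕ.z≤n = ι≥0 b
  ι-mono (ℕ.s≤s h) = ℚ.+-monoʳ-≤ 1ℚ (ι-mono h)

  ι>0 : ∀ n → 0ℚ < ι (suc n)
  ι>0 n = ℚ.<-≤-trans 0<1 (≤-trans (≤-reflexive (sym (ℚ.+-identityʳ 1ℚ))) (ℚ.+-monoʳ-≤ 1ℚ (ι≥0 n)))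

  ι1 : ι 1 ≡ 1ℚ
  ι1 = refl

  1≤ι : ∀ {n} → 1 ℕ.≤ n → 1ℚ ≤ ι n
  1≤ι h = ≤-trans (≤-reflexive (sym ι1)) (ι-mono h)

  -- rec n is 1 / n, with rec 0 = 0.
  opaque
    rec : ℕ → ℚ
    rec zero    = 0ℚ
    rec (suc n) = 1/_ (ι (suc n)) {{>-nonZero (ι>0 n)}}

    ι*rec′ : ∀ n → ι (suc n) * rec (suc n) ≡ 1ℚ
    ι*rec′ n = ℚ.*-inverseʳ (ι (suc n)) {{>-nonZero (ι>0 n)}}

    rec≥0 : ∀ n → 0ℚ ≤ rec n
    rec≥0 zero    = ≤-refl
    rec≥0 (suc n) = ℚ.<⇒≤ (ℚ.positive⁻¹ _ {{ℚ.1/pos⇒pos (ι (suc n)) {{positive (ι>0 n)}}}})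

  ι*rec : ∀ {n} → 1 ℕ.≤ n → ι n * rec n ≡ 1ℚ
  ι*rec {suc n} _ = ι*rec′ n

  *-cancel-≤ : ∀ {k a b} → 1ℚ ≤ k → k * a ≤ k * b → a ≤ b
  *-cancel-≤ {k} 1≤k = ℚ.*-cancelˡ-≤-pos k {{positive (ℚ.<-≤-trans 0<1 1≤k)}}

  ≤-rec : ∀ {n a b} → 1 ℕ.≤ n → ι n * a ≤ b → a ≤ rec n * b
  ≤-rec {n} {a} {b} 1≤n h = *-cancel-≤ (1≤ι 1≤n)
    (≤-trans h (≤-reflexive (trans (sym (ℚ.*-identityˡ b))
      (trans (cong (_* b) (sym (ι*rec 1≤n))) (ℚ.*-assoc (ι n) (rec n) b)))))

  rec-≤ : ∀ {n a b} → 1 ℕ.≤ n → a ≤ ι n * b → rec n * a ≤ b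
  rec-≤ {n} {a} {b} 1≤n h = ≤-trans (*-monoˡ-≤ (rec≥0 n) h) (≤-reflexive
    (trans (lem (rec n) (ι n) b) (trans (cong (_* b) (ι*rec 1≤n)) (ℚ.*-identityˡ b))))
    where
    lem : ∀ x y z → x * (y * z) ≡ y * x * z
    lem = solve-∀ ℚ-ring

  rec-unique : ∀ {n a} → 1 ℕ.≤ n → ι n * a ≡ 1ℚ → a ≡ rec n
  rec-unique {n} {a} 1≤n h = ℚ.≤-antisym
    (≤-trans (≤-rec 1≤n (≤-reflexive h)) (≤-reflexive (ℚ.*-identityʳ (rec n))))
    (≤-trans (≤-reflexive (sym (ℚ.*-identityʳ (rec n)))) (rec-≤ 1≤n (≤-reflexive (sym h))))

  rec-* : ∀ {a b} → 1 ℕ.≤ a → 1 ℕ.≤ b → rec (a ℕ.* b) ≡ rec a * rec b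
  rec-* {a} {b} 1≤a 1≤b = sym (rec-unique (ℕ.*-mono-≤ 1≤a 1≤b)
    (trans (cong (_* (rec a * rec b)) (ι-* a b))
      (trans (lem (ι a) (ι b) (rec a) (rec b))
        (trans (cong₂ _*_ (ι*rec 1≤a) (ι*rec 1≤b)) refl))))
    where
    lem : ∀ x y u v → x * y * (u * v) ≡ (x * u) * (y * v)
    lem = solve-∀ ℚ-ring

  rec-1 : rec 1 ≡ 1ℚ
  rec-1 = sym (rec-unique {1} (ℕ.s≤s ℕ.z≤n) refl)

  rec-anti : ∀ {a b} → 1 ℕ.≤ a → a ℕ.≤ b → rec b ≤ rec a
  rec-anti {a} {b} 1≤a a≤b = ≤-trans (≤-reflexive (sym (ℚ.*-identityʳ (rec b))))
    (rec-≤ (ℕ.≤-trans 1≤a a≤b)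
      (≤-trans (≤-reflexive (sym (ι*rec 1≤a))) (*-monoʳ-≤ (rec≥0 a) (ι-mono a≤b))))

  rec≤1 : ∀ {n} → 1 ℕ.≤ n → rec n ≤ 1ℚ
  rec≤1 h = ≤-trans (rec-anti ℕ.≤-refl h) (≤-reflexive rec-1)

  ι*rec≤ : ∀ n → ι n * rec n ≤ 1ℚ
  ι*rec≤ zero    = ≤-trans (≤-reflexive (ℚ.*-zeroˡ (rec 0))) 0≤1
  ι*rec≤ (suc n) = ≤-reflexive (ι*rec′ n)

  ≡⇒diff0 : ∀ {a b} → a ≡ b → a - b ≡ 0ℚ
  ≡⇒diff0 {a} refl = ℚ.+-inverseʳ a

  ind : {P : Set} → Dec P → ℚ
  ind (yes _) = 1ℚ
  ind (no  _) = 0ℚ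

  ind-yes : {P : Set} (d : Dec P) → P → ind d ≡ 1ℚ
  ind-yes (yes _) _ = refl
  ind-yes (no ¬p) p = ⊥-elim (¬p p)

  ind-no : {P : Set} (d : Dec P) → ¬ P → ind d ≡ 0ℚ
  ind-no (yes p) ¬p = ⊥-elim (¬p p)
  ind-no (no _)  _  = refl

  ind-cong : {P Q : Set} (d : Dec P) (e : Dec Q) → (P → Q) → (Q → P) → ind d ≡ ind e
  ind-cong (yes p) e f g = sym (ind-yes e (f p))
  ind-cong (no ¬p) e f g = sym (ind-no e (λ q → ¬p (g q)))

  ind≥0 : {P : Set} (d : Dec P) → 0ℚ ≤ ind d
  ind≥0 (yes _) = 0≤1
  ind≥0 (no _)  = ≤-refl

  ind≤1 : {P : Set} (d : Dec P) → ind d ≤ 1ℚ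
  ind≤1 (yes _) = ≤-refl
  ind≤1 (no _)  = 0≤1

  -- Finite sums

  -- ∑ n f = f 1 + … + f n.
  ∑ : ℕ → (ℕ → ℚ) → ℚ
  ∑ zero    f = 0ℚ
  ∑ (suc n) f = ∑ n f + f (suc n)

  private
    interchange : ∀ a b c d → (a + b) + (c + d) ≡ (a + c) + (b + d)
    interchange = solve-∀ ℚ-ring

  module _ {f g : ℕ → ℚ} where

    ∑-cong : ∀ n → (∀ i → 1 ℕ.≤ i → i ℕ.≤ n → f i ≡ g i) → ∑ n f ≡ ∑ n g
    ∑-cong zero    h = refl
    ∑-cong (suc n) h = cong₂ _+_ (∑-cong n (λ i 1≤i i≤n → h i 1≤i (ℕ.m≤n⇒m≤1+n i≤n)))
                                 (h (suc n) (s≤s z≤n) ℕ.≤-refl)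

    ∑-cong′ : ∀ n → (∀ i → f i ≡ g i) → ∑ n f ≡ ∑ n g
    ∑-cong′ n h = ∑-cong n (λ i _ _ → h i)

    ∑-mono : ∀ n → (∀ i → 1 ℕ.≤ i → i ℕ.≤ n → f i ≤ g i) → ∑ n f ≤ ∑ n g
    ∑-mono zero    h = ≤-refl
    ∑-mono (suc n) h = ℚ.+-mono-≤ (∑-mono n (λ i 1≤i i≤n → h i 1≤i (ℕ.m≤n⇒m≤1+n i≤n)))
                                  (h (suc n) (s≤s z≤n) ℕ.≤-refl)

    ∑-abs : ∀ n → (∀ i → 1 ℕ.≤ i → i ℕ.≤ n → ∣ f i ∣ ≤ g i) → ∣ ∑ n f ∣ ≤ ∑ n g
    ∑-abs zero    h = ≤-refl
    ∑-abs (suc n) h = abs-+ (∑-abs n (λ i 1≤i i≤n → h i 1≤i (ℕ.m≤n⇒m≤1+n i≤n)))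
                            (h (suc n) (s≤s z≤n) ℕ.≤-refl)

    ∑-+ : ∀ n → ∑ n (λ i → f i + g i) ≡ ∑ n f + ∑ n g
    ∑-+ zero    = refl
    ∑-+ (suc n) = trans (cong (_+ (f (suc n) + g (suc n))) (∑-+ n))
                        (interchange (∑ n f) (∑ n g) (f (suc n)) (g (suc n)))

    ∑-- : ∀ n → ∑ n (λ i → f i - g i) ≡ ∑ n f - ∑ n g
    ∑-- zero    = refl
    ∑-- (suc n) = trans (cong (_+ (f (suc n) - g (suc n))) (∑-- n))
                        (lem (∑ n f) (∑ n g) (f (suc n)) (g (suc n)))
      where
      lem : ∀ a b c d → (a - b) + (c - d) ≡ (a + c) - (b + d)
      lem = solve-∀ ℚ-ring

  module _ {f : ℕ → ℚ} where

    ∑-*ˡ : ∀ n k → ∑ n (λ i → k * f i) ≡ k * ∑ n f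
    ∑-*ˡ zero    k = sym (ℚ.*-zeroʳ k)
    ∑-*ˡ (suc n) k = trans (cong (_+ k * f (suc n)) (∑-*ˡ n k)) (sym (ℚ.*-distribˡ-+ k (∑ n f) (f (suc n))))

    ∑-*ʳ : ∀ n k → ∑ n (λ i → f i * k) ≡ ∑ n f * k
    ∑-*ʳ zero    k = sym (ℚ.*-zeroˡ k)
    ∑-*ʳ (suc n) k = trans (cong (_+ f (suc n) * k) (∑-*ʳ n k)) (sym (ℚ.*-distribʳ-+ k (∑ n f) (f (suc n))))

    ∑-zero : ∀ n → (∀ i → 1 ℕ.≤ i → i ℕ.≤ n → f i ≡ 0ℚ) → ∑ n f ≡ 0ℚ
    ∑-zero zero    h = refl
    ∑-zero (suc n) h = cong₂ _+_ (∑-zero n (λ i 1≤i i≤n → h i 1≤i (ℕ.m≤n⇒m≤1+n i≤n)))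
                                 (h (suc n) (s≤s z≤n) ℕ.≤-refl)

    ∑-≥0 : ∀ n → (∀ i → 1 ℕ.≤ i → i ℕ.≤ n → 0ℚ ≤ f i) → 0ℚ ≤ ∑ n f
    ∑-≥0 zero    h = ≤-refl
    ∑-≥0 (suc n) h = ∑-≥0 n (λ i 1≤i i≤n → h i 1≤i (ℕ.m≤n⇒m≤1+n i≤n)) ⊕ h (suc n) (s≤s z≤n) ℕ.≤-refl

    ∑-split : ∀ a b → ∑ (b ℕ.+ a) f ≡ ∑ a f + ∑ b (λ i → f (i ℕ.+ a))
    ∑-split a zero    = sym (ℚ.+-identityʳ (∑ a f))
    ∑-split a (suc b) = trans (cong (_+ f (suc b ℕ.+ a)) (∑-split a b)) (ℚ.+-assoc (∑ a f) _ _)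

    ∑-trunc : ∀ {n N} → n ℕ.≤ N → (∀ i → n ℕ.< i → i ℕ.≤ N → f i ≡ 0ℚ) → ∑ N f ≡ ∑ n f
    ∑-trunc {N = zero}  z≤n h = refl
    ∑-trunc {n} {suc N} n≤N h with ℕ.m≤n⇒m<n∨m≡n n≤N
    ... | inj₂ refl      = refl
    ... | inj₁ (s≤s n≤N′) = trans (cong₂ _+_ (∑-trunc n≤N′ (λ i n<i i≤N → h i n<i (ℕ.m≤n⇒m≤1+n i≤N)))
                                            (h (suc N) (s≤s n≤N′) ℕ.≤-refl))
                                 (ℚ.+-identityʳ (∑ n f))

    ∑-range-mono : ∀ {n N} → n ℕ.≤ N → (∀ i → 1 ℕ.≤ i → i ℕ.≤ N → 0ℚ ≤ f i) → ∑ n f ≤ ∑ N f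
    ∑-range-mono {N = zero}  z≤n h = ≤-refl
    ∑-range-mono {n} {suc N} n≤N h with ℕ.m≤n⇒m<n∨m≡n n≤N
    ... | inj₂ refl      = ≤-refl
    ... | inj₁ (s≤s n≤N′) = ≤-trans (≤-reflexive (sym (ℚ.+-identityʳ (∑ n f))))
      (ℚ.+-mono-≤ (∑-range-mono n≤N′ (λ i 1≤i i≤N → h i 1≤i (ℕ.m≤n⇒m≤1+n i≤N))) (h (suc N) (s≤s z≤n) ℕ.≤-refl))

    ∑-term : ∀ {a N} → 1 ℕ.≤ a → a ℕ.≤ N → (∀ i → 1 ℕ.≤ i → i ℕ.≤ N → 0ℚ ≤ f i) → f a ≤ ∑ N f
    ∑-term {suc a} {N} _ a≤N h = ≤-trans (≤-trans (≤-reflexive (sym (ℚ.+-identityˡ (f (suc a)))))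
      (ℚ.+-monoˡ-≤ (f (suc a)) (∑-≥0 a (λ i 1≤i i≤a → h i 1≤i (ℕ.≤-trans i≤a (ℕ.<⇒≤ a≤N))))))
      (∑-range-mono a≤N h)

    ∑-single : ∀ {a N} → 1 ℕ.≤ a → a ℕ.≤ N →
      (∀ i → 1 ℕ.≤ i → i ℕ.≤ N → i ≢ a → f i ≡ 0ℚ) → ∑ N f ≡ f a
    ∑-single {suc a} {N} _ a≤N h = trans
      (∑-trunc a≤N (λ i a<i i≤N → h i (ℕ.≤-trans (s≤s z≤n) a<i) i≤N (λ e → ℕ.<-irrefl (sym e) a<i)))
      (trans (cong (_+ f (suc a)) (∑-zero a (λ i 1≤i i≤a →
         h i 1≤i (ℕ.≤-trans i≤a (ℕ.<⇒≤ a≤N)) (λ e → ℕ.<-irrefl e (s≤s i≤a)))))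
        (ℚ.+-identityˡ (f (suc a))))

  ∑-const : ∀ n c → ∑ n (λ _ → c) ≡ ι n * c
  ∑-const zero    c = sym (ℚ.*-zeroˡ c)
  ∑-const (suc n) c = trans (cong (_+ c) (∑-const n c)) (lem (ι n) c)
    where
    lem : ∀ x c → x * c + c ≡ (1ℚ + x) * c
    lem = solve-∀ ℚ-ring

  ∑-bound : ∀ n {f c} → (∀ i → 1 ℕ.≤ i → i ℕ.≤ n → ∣ f i ∣ ≤ c) → ∣ ∑ n f ∣ ≤ ι n * c
  ∑-bound n {f} {c} h = ≤-trans (∑-abs n h) (≤-reflexive (∑-const n c))

  ∑-swap : ∀ n k (f : ℕ → ℕ → ℚ) → ∑ n (λ i → ∑ k (f i)) ≡ ∑ k (λ j → ∑ n (λ i → f i j))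
  ∑-swap zero    k f = sym (∑-zero k (λ _ _ _ → refl))
  ∑-swap (suc n) k f = trans (cong (_+ ∑ k (f (suc n))) (∑-swap n k f)) (sym (∑-+ k))

  -- Partial summation

  module Abel {h v : ℕ → ℚ} {B : ℚ}
    (h-bound : ∀ n → ∣ ∑ n h ∣ ≤ B)
    (v≥0 : ∀ i → 1 ℕ.≤ i → 0ℚ ≤ v i)
    (v-anti : ∀ i → 1 ℕ.≤ i → v (suc i) ≤ v i) where

    private
      hv : ℕ → ℚ
      hv i = h i * v i

      Q : ℕ → ℕ → ℚ
      Q s k = (∑ (k ℕ.+ s) hv - ∑ s hv) - ∑ (k ℕ.+ s) h * v (suc (k ℕ.+ s)) + ∑ s h * v (suc s)

      -- By partial summation `Q s k` is the sum of `∑ i h * (v i - v (suc i))` over s < i ≤ k + s.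
      -- Each partial sum is at most B in absolute value and the differences of `v` are nonnegative,
      -- so the bound telescopes.
      Q-bound : ∀ s k → ∣ Q s k ∣ ≤ B * (v (suc s) - v (suc (k ℕ.+ s)))
      Q-bound s zero = ≤-reflexive (trans (cong ∣_∣ (lem (∑ s hv) (∑ s h * v (suc s))))
        (sym (lem′ B (v (suc s)))))
        where
        lem : ∀ a b → (a - a) - b + b ≡ 0ℚ
        lem = solve-∀ ℚ-ring
        lem′ : ∀ a b → a * (b - b) ≡ 0ℚ
        lem′ = solve-∀ ℚ-ring
      Q-bound s (suc k) = ≤-trans
        (abs-≡ (abs-+ (Q-bound s k) (abs-* (h-bound (suc t)) (abs-nonneg (diff (v-anti (suc t) (s≤s z≤n))) ≤-refl)))
          (lem (∑ t hv) (∑ s hv) (∑ t h) (v (suc t)) (∑ s h * v (suc s)) (h (suc t)) (v (suc (suc t)))))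
        (≤-reflexive (lem′ B (v (suc s)) (v (suc t)) (v (suc (suc t)))))
        where
        t = k ℕ.+ s
        lem : ∀ a b c d e f g → ((a + f * d) - b) - (c + f) * g + e ≡ ((a - b) - c * d + e) + (c + f) * (d - g)
        lem = solve-∀ ℚ-ring
        lem′ : ∀ a b c d → a * (b - c) + a * (c - d) ≡ a * (b - d)
        lem′ = solve-∀ ℚ-ring

    abel-+ : ∀ s k → ∣ ∑ (k ℕ.+ s) hv - ∑ s hv ∣ ≤ (B + B) * v (suc s)
    abel-+ s k = ≤-trans
      (abs-≡ (abs-- (abs-+ (Q-bound s k) (abs-* (h-bound (k ℕ.+ s)) (abs-nonneg (v≥0 _ (s≤s z≤n)) ≤-refl)))
                    (abs-* (h-bound s) (abs-nonneg (v≥0 _ (s≤s z≤n)) ≤-refl)))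
        (lem (∑ (k ℕ.+ s) hv) (∑ s hv) (∑ (k ℕ.+ s) h * v (suc (k ℕ.+ s))) (∑ s h * v (suc s))))
      (≤-reflexive (lem′ B (v (suc s)) (v (suc (k ℕ.+ s)))))
      where
      lem : ∀ a b c d → a - b ≡ ((a - b) - c + d) + c - d
      lem = solve-∀ ℚ-ring
      lem′ : ∀ a b c → a * (b - c) + a * c + a * b ≡ (a + a) * b
      lem′ = solve-∀ ℚ-ring

    abel : ∀ {s t} → s ℕ.≤ t → ∣ ∑ t (λ i → h i * v i) - ∑ s (λ i → h i * v i) ∣ ≤ (B + B) * v (suc s)
    abel {s} {t} s≤t = subst (λ t → ∣ ∑ t hv - ∑ s hv ∣ ≤ (B + B) * v (suc s))
      (ℕ.m∸n+n≡m s≤t) (abel-+ s (t ℕ.∸ s))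

  H : ℕ → ℚ
  H n = ∑ n rec

  rec-tail : ∀ {h : ℕ → ℚ} {B s t} → (∀ n → ∣ ∑ n h ∣ ≤ B) → s ℕ.≤ t →
    ∣ ∑ t (λ i → h i * rec i) - ∑ s (λ i → h i * rec i) ∣ ≤ (B + B) * rec (suc s)
  rec-tail hb = Abel.abel hb (λ i _ → rec≥0 i) (λ i 1≤i → rec-anti 1≤i (ℕ.n≤1+n i))

  -- Divisor sums

  -- ⌊ n / d ⌋, with the junk value 0 at d = 0.
  quo : ℕ → ℕ → ℕ
  quo n zero    = 0
  quo n (suc d) = n ℕ./ suc d

  quo-≤ : ∀ n d → quo n d ℕ.≤ n
  quo-≤ n zero    = z≤n
  quo-≤ n (suc d) = ℕ.m/n≤m n (suc d)

  quo-lower : ∀ n d → d ℕ.* quo n d ℕ.≤ n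
  quo-lower n zero    = z≤n
  quo-lower n (suc d) = subst (ℕ._≤ n) (ℕ.*-comm (n ℕ./ suc d) (suc d)) (ℕ.m/n*n≤m n (suc d))

  quo-upper : ∀ n {d} → 1 ℕ.≤ d → n ℕ.< d ℕ.* suc (quo n d)
  quo-upper n {suc d} _ = subst (ℕ._< suc d ℕ.* suc (n ℕ./ suc d)) (sym (ℕ.m≡m%n+[m/n]*n n (suc d)))
    (subst (n ℕ.% suc d ℕ.+ (n ℕ./ suc d) ℕ.* suc d ℕ.<_)
      (trans (cong (suc d ℕ.+_) (ℕ.*-comm (n ℕ./ suc d) (suc d))) (sym (ℕ.*-suc (suc d) (n ℕ./ suc d))))
      (ℕ.+-monoˡ-< ((n ℕ./ suc d) ℕ.* suc d) (ℕ.m%n<n n (suc d))))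

  quo-unique : ∀ {n q d} → d ℕ.* q ℕ.≤ n → n ℕ.< d ℕ.* suc q → quo n d ≡ q
  quo-unique {n} {q} {zero} _ ()
  quo-unique {n} {q} {suc d} lo hi = ℕ.≤-antisym
    (ℕ.m<1+n⇒m≤n (ℕ.*-cancelˡ-< (suc d) _ _ (ℕ.≤-<-trans (quo-lower n (suc d)) hi)))
    (ℕ.m<1+n⇒m≤n (ℕ.*-cancelˡ-< (suc d) _ _ (ℕ.≤-<-trans lo (quo-upper n {suc d} (s≤s z≤n)))))

  -- A series cut off at n / d has a tail of order 1 / (n / d + 1); this turns it into d / n, where
  -- the factor d can cancel against a weight 1 / d.
  rec-suc-quo : ∀ {n d} → 1 ℕ.≤ n → 1 ℕ.≤ d → rec (suc (quo n d)) ≤ ι d * rec n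
  rec-suc-quo {n} {d} 1≤n 1≤d = ≤-trans (≤-reflexive (sym (ℚ.*-identityʳ _)))
    (rec-≤ {suc (quo n d)} (s≤s z≤n)
    (≤-trans (≤-reflexive (sym (ι*rec 1≤n))) (≤-trans
      (*-monoʳ-≤ (rec≥0 n) (ι-mono (ℕ.<⇒≤ (quo-upper n 1≤d))))
      (≤-reflexive (trans (cong (_* rec n) (ι-* d (suc (quo n d)))) (lem (ι d) (ι (suc (quo n d))) (rec n)))))))
    where
    lem : ∀ a b c → a * b * c ≡ b * (a * c)
    lem = solve-∀ ℚ-ring

  private
    *0 : ∀ {a b} → a ≡ 0ℚ → a * b ≡ 0ℚ
    *0 {b = b} refl = ℚ.*-zeroˡ b

    *1 : ∀ {a b} → a ≡ 1ℚ → a * b ≡ b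
    *1 {b = b} refl = ℚ.*-identityˡ b

    multiples : ∀ (F : ℕ → ℚ) q d r → r ℕ.< suc d →
      ∑ (r ℕ.+ q ℕ.* suc d) (λ n → ind (suc d ∣? n) * F n) ≡ ∑ q (λ e → F (suc d ℕ.* e))
    multiples F zero    d zero    _ = refl
    multiples F (suc q) d zero    _ = cong₂ _+_ (multiples F q d d ℕ.≤-refl)
      (trans (*1 (ind-yes (suc d ∣? (suc d ℕ.+ q ℕ.* suc d)) (n∣m*n (suc q))))
        (cong F (ℕ.*-comm (suc q) (suc d))))
    multiples F q d (suc r) r<d = trans (cong₂ _+_ (multiples F q d r (ℕ.<-trans (ℕ.n<1+n r) r<d))
      (*0 (ind-no (suc d ∣? suc (r ℕ.+ q ℕ.* suc d)) λ d∣ →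
        >⇒∤ r<d (∣m+n∣m⇒∣n (subst (suc d ∣_) (ℕ.+-comm (suc r) _) d∣) (n∣m*n q)))))
      (ℚ.+-identityʳ _)

  ∑-multiples : ∀ (F : ℕ → ℚ) N {d} → 1 ℕ.≤ d →
    ∑ N (λ n → ind (d ∣? n) * F n) ≡ ∑ (quo N d) (λ e → F (d ℕ.* e))
  ∑-multiples F N {suc d} _ = trans
    (cong (λ N → ∑ N (λ n → ind (suc d ∣? n) * F n)) (ℕ.m≡m%n+[m/n]*n N (suc d)))
    (multiples F (N ℕ./ suc d) d (N ℕ.% suc d) (ℕ.m%n<n N (suc d)))

  -- DS n g is the sum of g over the divisors of n.
  DS : ℕ → (ℕ → ℚ) → ℚ
  DS n g = ∑ n (λ d → ind (d ∣? n) * g d)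

  ∣⇒≤′ : ∀ {d n} → 1 ℕ.≤ n → d ∣ n → d ℕ.≤ n
  ∣⇒≤′ {n = suc n} _ = ∣⇒≤

  DS-extend : ∀ {n N} g → 1 ℕ.≤ n → n ℕ.≤ N → ∑ N (λ d → ind (d ∣? n) * g d) ≡ DS n g
  DS-extend {n} g 1≤n n≤N = ∑-trunc n≤N (λ d n<d _ →
    *0 (ind-no (d ∣? n) (λ d∣n → ℕ.<⇒≱ n<d (∣⇒≤′ 1≤n d∣n))))

  DS-cong : ∀ {n g g′} → (∀ d → 1 ℕ.≤ d → d ∣ n → g d ≡ g′ d) → DS n g ≡ DS n g′
  DS-cong {n} {g} {g′} h = ∑-cong n go
    where
    go : ∀ d → 1 ℕ.≤ d → d ℕ.≤ n → ind (d ∣? n) * g d ≡ ind (d ∣? n) * g′ d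
    go d 1≤d _ with d ∣? n
    ... | yes d∣n = cong (1ℚ *_) (h d 1≤d d∣n)
    ... | no  _   = trans (ℚ.*-zeroˡ (g d)) (sym (ℚ.*-zeroˡ (g′ d)))

  DS-+ : ∀ n g g′ → DS n (λ d → g d + g′ d) ≡ DS n g + DS n g′
  DS-+ n g g′ = trans (∑-cong′ n (λ d → ℚ.*-distribˡ-+ (ind (d ∣? n)) (g d) (g′ d))) (∑-+ n)

  DS-*ˡ : ∀ n k g → DS n (λ d → k * g d) ≡ k * DS n g
  DS-*ˡ n k g = trans (∑-cong′ n (λ d → lem (ind (d ∣? n)) k (g d))) (∑-*ˡ n k)
    where
    lem : ∀ a b c → a * (b * c) ≡ b * (a * c)
    lem = solve-∀ ℚ-ring

  DS-zero : ∀ {n g} → (∀ d → 1 ℕ.≤ d → d ∣ n → g d ≡ 0ℚ) → DS n g ≡ 0ℚ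
  DS-zero {n} h = trans (DS-cong {g′ = λ _ → 0ℚ} h) (∑-zero n (λ d _ _ → ℚ.*-zeroʳ (ind (d ∣? n))))

  DS-term : ∀ {n d g} → 1 ℕ.≤ n → 1 ℕ.≤ d → d ∣ n → (∀ e → 1 ℕ.≤ e → 0ℚ ≤ g e) → g d ≤ DS n g
  DS-term {n} {d} {g} 1≤n 1≤d d∣n g≥0 = ≤-trans (≤-reflexive (sym (*1 (ind-yes (d ∣? n) d∣n))))
    (∑-term {f = λ e → ind (e ∣? n) * g e} 1≤d (∣⇒≤′ 1≤n d∣n) (λ e 1≤e _ → ind≥0 (e ∣? n) ⊗ g≥0 e 1≤e))

  DS-one : ∀ {n} (g : ℕ → ℚ) → 1 ℕ.≤ n → DS n (λ d → ind (d ℕ.≟ 1) * g d) ≡ g 1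
  DS-one {n} g 1≤n = trans (∑-single {f = λ d → ind (d ∣? n) * (ind (d ℕ.≟ 1) * g d)} {a = 1} (s≤s z≤n) 1≤n
    (λ d _ _ d≢1 → trans (cong (ind (d ∣? n) *_) (*0 {b = g d} (ind-no (d ℕ.≟ 1) d≢1))) (ℚ.*-zeroʳ (ind (d ∣? n)))))
    (trans (*1 {b = 1ℚ * g 1} (ind-yes (1 ∣? n) (1∣ n))) (ℚ.*-identityˡ (g 1)))

  hyperbola : ∀ N (F b : ℕ → ℚ) →
    ∑ N (λ n → F n * DS n b) ≡ ∑ N (λ d → b d * ∑ (quo N d) (λ e → F (d ℕ.* e)))
  hyperbola N F b = trans
    (∑-cong N (λ n 1≤n n≤N → trans (cong (F n *_) (sym (DS-extend b 1≤n n≤N))) (sym (∑-*ˡ N (F n)))))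
    (trans (∑-swap N N (λ n d → F n * (ind (d ∣? n) * b d)))
      (∑-cong N (λ d 1≤d _ → trans
        (trans (∑-cong′ N (λ n → lem (F n) (ind (d ∣? n)) (b d))) (∑-*ˡ N (b d)))
        (cong (b d *_) (∑-multiples F N 1≤d)))))
    where
    lem : ∀ x y z → x * (y * z) ≡ z * (y * x)
    lem = solve-∀ ℚ-ring

  prime≥2 : ∀ {p} → Prime p → 2 ℕ.≤ p
  prime≥2 pp = ℕ.nonTrivial⇒n>1 _ {{prime⇒nonTrivial pp}}

  prime≥1 : ∀ {p} → Prime p → 1 ℕ.≤ p
  prime≥1 pp = ℕ.<⇒≤ (prime≥2 pp)

  ∤-cancel : ∀ {p d n} → Prime p → ¬ (p ∣ d) → d ∣ p ℕ.* n → d ∣ n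
  ∤-cancel {p} {d} {n} pp p∤d (divides q eq) with euclidsLemma q d pp (divides n (trans (sym eq) (ℕ.*-comm p n)))
  ... | inj₂ p∣d = ⊥-elim (p∤d p∣d)
  ... | inj₁ (divides q′ refl) = divides q′
    (ℕ.*-cancelˡ-≡ n (q′ ℕ.* d) p {{prime⇒nonZero pp}}
      (trans eq (trans (cong (ℕ._* d) (ℕ.*-comm q′ p)) (ℕ.*-assoc p q′ d))))

  quo-* : ∀ n {p} → 1 ℕ.≤ p → quo (p ℕ.* n) p ≡ n
  quo-* n {suc p} _ = quo-unique {suc p ℕ.* n} ℕ.≤-refl (ℕ.*-monoʳ-< (suc p) (ℕ.n<1+n n))

  -- A divisor of p n prime to p is a divisor of n prime to p, and one divisible by p is p times a
  -- divisor of n. Both kinds are indexed by the divisors of n; with p the least prime factor this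
  -- drives the divisor-sum identities below.
  DS-split : ∀ {p n} g → Prime p → 1 ℕ.≤ n →
    DS (p ℕ.* n) g ≡ DS n (λ d → ind (¬? (p ∣? d)) * g d + g (p ℕ.* d))
  DS-split {p} {n} g pp 1≤n = trans
    (trans (∑-cong′ (p ℕ.* n) (λ d → split d)) (∑-+ (p ℕ.* n)))
    (trans (cong₂ _+_
       (trans (∑-cong′ (p ℕ.* n) (λ d → prime-to d)) (DS-extend _ 1≤n (ℕ.m≤n*m n p {{prime⇒nonZero pp}})))
       (trans (∑-multiples (λ d → ind (d ∣? (p ℕ.* n)) * g d) (p ℕ.* n) (prime≥1 pp))
         (trans (cong (λ k → ∑ k (λ e → ind ((p ℕ.* e) ∣? (p ℕ.* n)) * g (p ℕ.* e))) (quo-* n (prime≥1 pp)))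
           (∑-cong′ n (λ e → cong (_* g (p ℕ.* e)) (ind-cong ((p ℕ.* e) ∣? (p ℕ.* n)) (e ∣? n)
             (*-cancelˡ-∣ p {{prime⇒nonZero pp}}) (*-monoʳ-∣ p)))))))
      (sym (DS-+ n _ _)))
    where
    split : ∀ d → ind (d ∣? (p ℕ.* n)) * g d ≡
      ind (¬? (p ∣? d)) * (ind (d ∣? (p ℕ.* n)) * g d) + ind (p ∣? d) * (ind (d ∣? (p ℕ.* n)) * g d)
    split d with p ∣? d
    ... | yes _ = lem (ind (d ∣? (p ℕ.* n)) * g d)
      where
      lem : ∀ x → x ≡ 0ℚ * x + 1ℚ * x
      lem = solve-∀ ℚ-ring
    ... | no  _ = lem (ind (d ∣? (p ℕ.* n)) * g d)
      where
      lem : ∀ x → x ≡ 1ℚ * x + 0ℚ * x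
      lem = solve-∀ ℚ-ring
    prime-to : ∀ d → ind (¬? (p ∣? d)) * (ind (d ∣? (p ℕ.* n)) * g d) ≡ ind (d ∣? n) * (ind (¬? (p ∣? d)) * g d)
    prime-to d with p ∣? d
    ... | yes _ = lem (ind (d ∣? (p ℕ.* n))) (ind (d ∣? n)) (g d)
      where
      lem : ∀ x y z → 0ℚ * (x * z) ≡ y * (0ℚ * z)
      lem = solve-∀ ℚ-ring
    ... | no p∤d = trans (ℚ.*-identityˡ _) (cong₂ _*_
      (ind-cong (d ∣? (p ℕ.* n)) (d ∣? n) (∤-cancel pp p∤d) (∣n⇒∣m*n p)) (sym (ℚ.*-identityˡ (g d))))

  -- The functions μ, Λ and log

  record LPF (p n : ℕ) : Set where
    constructor lpf-of
    field
      is-prime : Prime p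
      divides-n : p ∣ n
      rough : p Rough n
  open LPF public

  find-lpf : ∀ n → 2 ℕ.≤ n → ∃[ p ] LPF p n
  find-lpf n 2≤n = go (n ℕ.∸ 2) 2 (ℕ.m∸n+n≡m 2≤n) ℕ.≤-refl 2-rough
    where
    go : ∀ f k → f ℕ.+ k ≡ n → 2 ℕ.≤ k → k Rough n → ∃[ p ] LPF p n
    go f k e 2≤k r with k ∣? n
    ... | yes k∣n = k , lpf-of (rough∧∣⇒prime {{ℕ.n>1⇒nonTrivial 2≤k}} r k∣n) k∣n r
    go zero    k e 2≤k r | no k∤n = ⊥-elim (k∤n (subst (k ∣_) e ∣-refl))
    go (suc f) k e 2≤k r | no k∤n = go f (suc k) (trans (ℕ.+-suc f k) e) (ℕ.m≤n⇒m≤1+n 2≤k) (∤⇒rough-suc k∤n r)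

  LPF-unique : ∀ {p q n} → LPF p n → LPF q n → p ≡ q
  LPF-unique a b = ℕ.≤-antisym (le a b) (le b a)
    where
    le : ∀ {p q n} → LPF p n → LPF q n → p ℕ.≤ q
    le a b = rough⇒≤ {{prime⇒nonTrivial (is-prime b)}} (rough∧∣⇒rough (rough a) (divides-n b))

  -- This is why the recursions follow the least prime factor: after `DS-split` they apply, with the
  -- same p, to p d for every divisor d of n at once.
  LPF-* : ∀ {p n d} → LPF p (p ℕ.* n) → d ∣ n → LPF p (p ℕ.* d)
  LPF-* {p} {n} {d} l d∣n = lpf-of (is-prime l) (m∣m*n d) (rough∧∣⇒rough (rough l) (*-monoʳ-∣ p d∣n))

  LPF-factor : ∀ {p n} → LPF p (p ℕ.* n) → p ∣ n → LPF p n
  LPF-factor {p} l p∣n = lpf-of (is-prime l) p∣n (rough∧∣⇒rough (rough l) (n∣m*n p))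

  LPF-prime : ∀ {p} → Prime p → LPF p (p ℕ.* 1)
  LPF-prime {p} pp = lpf-of pp (m∣m*n 1) λ b → Prime.notComposite pp (subst (λ n → n HasNonTrivialDivisorLessThan p) (ℕ.*-identityʳ p) b)

  LPF-2 : ∀ n → LPF 2 (2 ℕ.* n)
  LPF-2 n = lpf-of prime[2] (m∣m*n n) 2-rough

  1≤factor : ∀ {p n} → 1 ℕ.≤ p ℕ.* n → 1 ℕ.≤ n
  1≤factor {p} {zero} h = ⊥-elim (ℕ.<-irrefl refl (subst (1 ℕ.≤_) (ℕ.*-zeroʳ p) h))
  1≤factor {n = suc n} h = s≤s z≤n

  n<p*n : ∀ {p n} → 2 ℕ.≤ p → 1 ℕ.≤ n → n ℕ.< p ℕ.* n
  n<p*n {p} {n} 2≤p 1≤n = ℕ.≤-trans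
    (ℕ.≤-trans (ℕ.≤-reflexive (ℕ.+-comm 1 n)) (ℕ.+-monoʳ-≤ n (ℕ.≤-trans 1≤n (ℕ.≤-reflexive (sym (ℕ.+-identityʳ n))))))
    (ℕ.*-monoˡ-≤ n 2≤p)

  LPF-induction : (P : ℕ → Set) → P 1 →
    (∀ p n → LPF p (p ℕ.* n) → 1 ℕ.≤ n → P n → P (p ℕ.* n)) → ∀ n → 1 ℕ.≤ n → P n
  LPF-induction P base step n 1≤n = go n n ℕ.≤-refl 1≤n
    where
    go : ∀ f n → n ℕ.≤ f → 1 ℕ.≤ n → P n
    go (suc f) (suc zero)    _  _ = base
    go (suc f) (suc (suc n)) n≤f _ with find-lpf (suc (suc n)) (s≤s (s≤s z≤n))
    ... | p , l with divides-n l
    ... | divides q eq = subst P (sym eq′) (step p q (subst (LPF p) eq′ l) 1≤q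
            (go f q (ℕ.≤-pred (ℕ.≤-trans (subst (q ℕ.<_) (sym eq′) (n<p*n (prime≥2 (is-prime l)) 1≤q)) n≤f)) 1≤q))
      where
      eq′ = trans eq (ℕ.*-comm q p)
      1≤q = 1≤factor {p} (subst (1 ℕ.≤_) eq′ (s≤s z≤n))

  -- Recursion on n = p * n′ along the least prime factor p; the first argument
  -- of F is fuel.
  module LpfRec (base : ℚ) (step : ℕ → ℕ → ℚ → ℚ) where

    F : ℕ → ℕ → ℚ
    F zero    n             = base
    F (suc f) zero          = base
    F (suc f) (suc zero)    = base
    F (suc f) (suc (suc n)) = let p = proj₁ (find-lpf (suc (suc n)) (s≤s (s≤s z≤n)))
                                  q = quo (suc (suc n)) p
                              in step p q (F f q)

    opaque
      value : ℕ → ℚ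
      value n = F n n

      value-1 : value 1 ≡ base
      value-1 = refl

      quo-< : ∀ {n p} → 2 ℕ.≤ p → quo (suc n) p ℕ.≤ n
      quo-< {n} {p} 2≤p with quo (suc n) p in eq
      ... | zero  = z≤n
      ... | suc q = ℕ.≤-pred (ℕ.<-≤-trans (n<p*n 2≤p (s≤s z≤n)) (subst (λ q → p ℕ.* q ℕ.≤ suc n) eq (quo-lower (suc n) p)))

      F-fuel : ∀ f g n → n ℕ.≤ f → n ℕ.≤ g → F f n ≡ F g n
      F-fuel zero    zero    n _ _ = refl
      F-fuel zero    (suc g) zero _ _ = refl
      F-fuel (suc f) zero    zero _ _ = refl
      F-fuel (suc f) (suc g) zero _ _ = refl
      F-fuel (suc f) (suc g) (suc zero) _ _ = refl
      F-fuel (suc f) (suc g) (suc (suc n)) (s≤s a) (s≤s b) with find-lpf (suc (suc n)) (s≤s (s≤s z≤n))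
      ... | p , l = cong (step p (quo (suc (suc n)) p))
        (F-fuel f g (quo (suc (suc n)) p) (ℕ.≤-trans q≤ a) (ℕ.≤-trans q≤ b))
        where
        q≤ : quo (suc (suc n)) p ℕ.≤ suc n
        q≤ = quo-< {suc n} (prime≥2 (is-prime l))

      value-* : ∀ {p n} → LPF p (p ℕ.* n) → 1 ℕ.≤ n → value (p ℕ.* n) ≡ step p n (value n)
      value-* {p} {n} l 1≤n with p ℕ.* n in eq
      ... | zero = ⊥-elim (ℕ.n≮0 (subst (n ℕ.<_) eq (n<p*n (prime≥2 (is-prime l)) 1≤n)))
      ... | suc zero = ⊥-elim (ℕ.<-irrefl refl (ℕ.<-≤-trans (s≤s 1≤n) (subst (n ℕ.<_) eq (n<p*n (prime≥2 (is-prime l)) 1≤n))))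
      ... | suc (suc N) with find-lpf (suc (suc N)) (s≤s (s≤s z≤n))
      ... | p′ , l′ with LPF-unique l′ l
      ... | refl = trans (cong (λ q → step p q (F (suc N) q)) (trans (cong (λ N → quo N p) (sym eq)) (quo-* n (prime≥1 (is-prime l)))))
        (cong (step p n) (F-fuel (suc N) n n (ℕ.≤-pred (subst (n ℕ.<_) eq (n<p*n (prime≥2 (is-prime l)) 1≤n))) ℕ.≤-refl))

  module μ-rec = LpfRec 1ℚ (λ p n v → ind (¬? (p ∣? n)) * (- v))

  μ : ℕ → ℚ
  μ = μ-rec.value

  private
    ind-¬ : {P : Set} (d : Dec P) → ind (¬? d) ≡ 1ℚ - ind d
    ind-¬ (yes _) = refl
    ind-¬ (no  _) = refl

    ind-idem : {P : Set} (d : Dec P) → ind d * ind d ≡ ind d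
    ind-idem (yes _) = refl
    ind-idem (no  _) = refl

    ind-∣self : ∀ p d → ind (¬? (p ∣? (p ℕ.* d))) ≡ 0ℚ
    ind-∣self p d = ind-no (¬? (p ∣? (p ℕ.* d))) (λ h → h (m∣m*n d))

  μ-* : ∀ {p n d} → LPF p (p ℕ.* n) → 1 ℕ.≤ d → d ∣ n → μ (p ℕ.* d) ≡ ind (¬? (p ∣? d)) * (- μ d)
  μ-* l 1≤d d∣n = μ-rec.value-* (LPF-* l d∣n) 1≤d

  μ-bound : ∀ n → 1 ℕ.≤ n → ∣ μ n ∣ ≤ 1ℚ
  μ-bound = LPF-induction (λ n → ∣ μ n ∣ ≤ 1ℚ)
    (abs-≡ (abs-nonneg 0≤1 ≤-refl) μ-rec.value-1)
    (λ p n l 1≤n ih → abs-≡ (abs-* (abs-nonneg (ind≥0 (¬? (p ∣? n))) (ind≤1 (¬? (p ∣? n)))) (abs-neg ih))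
      (μ-rec.value-* l 1≤n))

  -- After the splitting at p the terms of d and p d cancel: they are μ d and - μ d if p does not
  -- divide d, and both are absent otherwise.
  DS-μ : ∀ n → 1 ℕ.≤ n → DS n μ ≡ ind (n ℕ.≟ 1)
  DS-μ = LPF-induction (λ n → DS n μ ≡ ind (n ℕ.≟ 1))
    (trans (lem (μ 1)) μ-rec.value-1)
    (λ p n l 1≤n _ → trans (DS-split μ (is-prime l) 1≤n)
      (trans (DS-zero (λ d 1≤d d∣n → trans (cong (ind (¬? (p ∣? d)) * μ d +_) (μ-* l 1≤d d∣n)) (lem′ (ind (¬? (p ∣? d))) (μ d))))
        (sym (ind-no (p ℕ.* n ℕ.≟ 1) (λ e → ℕ.<-irrefl (sym e) (ℕ.≤-<-trans 1≤n (n<p*n (prime≥2 (is-prime l)) 1≤n)))))))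
    where
    lem : ∀ x → 0ℚ + 1ℚ * x ≡ x
    lem = solve-∀ ℚ-ring
    lem′ : ∀ x y → x * y + x * (- y) ≡ 0ℚ
    lem′ = solve-∀ ℚ-ring

  module Mangoldt (h : ℕ → ℚ) where

    -- For `h` the logarithm these are log and the von Mangoldt function. For any other `h` the
    -- function `ℓ` still adds `h` over the prime factors with multiplicity, which is all that
    -- `DS-Λ` and `DS-μℓ` depend on.
    module ℓ-rec = LpfRec 0ℚ (λ p n v → h p + v)
    module Λ-rec = LpfRec 0ℚ (λ p n v → ind (n ℕ.≟ 1) * h p + ind (p ∣? n) * v)

    ℓ Λ : ℕ → ℚ
    ℓ = ℓ-rec.value
    Λ = Λ-rec.value

    ℓ-1 : ℓ 1 ≡ 0ℚ
    ℓ-1 = ℓ-rec.value-1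

    ℓ-* : ∀ {p n} → LPF p (p ℕ.* n) → 1 ℕ.≤ n → ℓ (p ℕ.* n) ≡ h p + ℓ n
    ℓ-* = ℓ-rec.value-*

    -- The terms of d and p d add up to Λ d, plus h p when d = 1. Summed over the divisors of n this
    -- is the recursion of `ℓ`.
    DS-Λ : ∀ n → 1 ℕ.≤ n → DS n Λ ≡ ℓ n
    DS-Λ = LPF-induction (λ n → DS n Λ ≡ ℓ n)
      (trans (cong (λ x → 0ℚ + 1ℚ * x) Λ-rec.value-1) (sym ℓ-1))
      (λ p n l 1≤n ih → trans (DS-split Λ (is-prime l) 1≤n)
        (trans (DS-cong {g′ = λ d → ind (d ℕ.≟ 1) * h p + Λ d} (λ d 1≤d d∣n →
            trans (cong (ind (¬? (p ∣? d)) * Λ d +_) (Λ-rec.value-* (LPF-* l d∣n) 1≤d))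
            (trans (cong (λ x → x * Λ d + (ind (d ℕ.≟ 1) * h p + ind (p ∣? d) * Λ d)) (ind-¬ (p ∣? d)))
              (lem (ind (p ∣? d)) (Λ d) (ind (d ℕ.≟ 1) * h p)))))
          (trans (DS-+ n _ _) (trans (cong₂ _+_ (DS-one (λ _ → h p) 1≤n) ih) (sym (ℓ-* l 1≤n))))))
      where
      lem : ∀ i x y → (1ℚ - i) * x + (y + i * x) ≡ y + x
      lem = solve-∀ ℚ-ring

    private
      -- The sum of μ over the divisors of the part of n prime to p, hence 1 if n is a power of p
      -- and 0 otherwise. It thus detects whether p n is a prime power, which is the content of
      -- `Λ-Q`.
      Q : ℕ → ℕ → ℚ
      Q p n = DS n (λ d → ind (¬? (p ∣? d)) * μ d)

      Q-step : ∀ {p n} → LPF p (p ℕ.* n) → 1 ℕ.≤ n → Q p (p ℕ.* n) ≡ Q p n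
      Q-step {p} {n} l 1≤n = trans (DS-split _ (is-prime l) 1≤n) (DS-cong {n = n} (λ d 1≤d d∣n →
        trans (cong (λ x → ind (¬? (p ∣? d)) * (ind (¬? (p ∣? d)) * μ d) + x * μ (p ℕ.* d)) (ind-∣self p d))
        (trans (lem (ind (¬? (p ∣? d))) (μ d) (μ (p ℕ.* d))) (cong (_* μ d) (ind-idem (¬? (p ∣? d)))))))
        where
        lem : ∀ i x y → i * (i * x) + 0ℚ * y ≡ i * i * x
        lem = solve-∀ ℚ-ring

      Λ-Q : ∀ n → 1 ℕ.≤ n → ∀ p → LPF p (p ℕ.* n) → Λ (p ℕ.* n) ≡ h p * Q p n
      Λ-Q = LPF-induction (λ n → ∀ p → LPF p (p ℕ.* n) → Λ (p ℕ.* n) ≡ h p * Q p n)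
        (λ p l → trans (Λ-rec.value-* l ℕ.≤-refl)
          (trans (cong (λ x → 1ℚ * h p + x * Λ 1) (ind-no (p ∣? 1) (λ p∣1 → p∤1 l p∣1)))
          (trans (lem (h p) (Λ 1)) (trans (cong (h p *_) (sym (trans (cong₂ (λ x y → 0ℚ + 1ℚ * (x * y)) (ind-yes (¬? (p ∣? 1)) (p∤1 l)) μ-rec.value-1) refl))) refl))))
        go
        where
        p∤1 : ∀ {p} → LPF p (p ℕ.* 1) → ¬ (p ∣ 1)
        p∤1 l p∣1 = ℕ.<-irrefl (sym (∣1⇒≡1 p∣1)) (prime≥2 (is-prime l))
        lem : ∀ x y → 1ℚ * x + 0ℚ * y ≡ x * 1ℚ
        lem = solve-∀ ℚ-ring
        go : ∀ p n → LPF p (p ℕ.* n) → 1 ℕ.≤ n → (∀ q → LPF q (q ℕ.* n) → Λ (q ℕ.* n) ≡ h q * Q q n) →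
             ∀ q → LPF q (q ℕ.* (p ℕ.* n)) → Λ (q ℕ.* (p ℕ.* n)) ≡ h q * Q q (p ℕ.* n)
        go p n l 1≤n ih q l′ = trans (Λ-rec.value-* l′ 1≤pn)
          (trans (cong (λ x → x * h q + ind (q ∣? (p ℕ.* n)) * Λ (p ℕ.* n)) (ind-no (p ℕ.* n ℕ.≟ 1) pn≢1)) rest)
          where
          pn≢1 : p ℕ.* n ≢ 1
          pn≢1 e = ℕ.<-irrefl (sym e) (ℕ.≤-<-trans 1≤n (n<p*n (prime≥2 (is-prime l)) 1≤n))
          1≤pn : 1 ℕ.≤ p ℕ.* n
          1≤pn = ℕ.*-mono-≤ (prime≥1 (is-prime l)) 1≤n
          lem₁ : ∀ x y → 0ℚ * x + 1ℚ * y ≡ y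
          lem₁ = solve-∀ ℚ-ring
          lem₂ : ∀ x y → 0ℚ * x + 0ℚ * y ≡ x * 0ℚ
          lem₂ = solve-∀ ℚ-ring
          rest : 0ℚ * h q + ind (q ∣? (p ℕ.* n)) * Λ (p ℕ.* n) ≡ h q * Q q (p ℕ.* n)
          rest with q ∣? (p ℕ.* n)
          ... | yes q∣ with LPF-unique (LPF-factor l′ q∣) l
          ... | refl = trans (lem₁ (h q) (Λ (p ℕ.* n))) (trans (ih p l) (cong (h p *_) (sym (Q-step l 1≤n))))
          rest | no q∤ = trans (lem₂ (h q) (Λ (p ℕ.* n))) (cong (h q *_) (sym (trans
            (DS-cong {g′ = μ} (λ d _ d∣ → trans (cong (_* μ d) (ind-yes (¬? (q ∣? d)) (λ q∣d → q∤ (∣-trans q∣d d∣)))) (ℚ.*-identityˡ (μ d))))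
            (trans (DS-μ (p ℕ.* n) 1≤pn) (ind-no (p ℕ.* n ℕ.≟ 1) pn≢1)))))

    -- For d prime to p the terms of d and p d are μ d ℓ d and - μ d (h p + ℓ d), so `ℓ` cancels and
    -- only - h p times the sum `Q p n` survives.
    DS-μℓ : ∀ n → 1 ℕ.≤ n → DS n (λ d → μ d * ℓ d) ≡ - Λ n
    DS-μℓ = LPF-induction (λ n → DS n (λ d → μ d * ℓ d) ≡ - Λ n)
      (trans (cong (λ x → 0ℚ + 1ℚ * (μ 1 * x)) ℓ-1) (trans (lem (μ 1)) (cong -_ (sym Λ-rec.value-1))))
      (λ p n l 1≤n _ → trans (DS-split _ (is-prime l) 1≤n)
        (trans (DS-cong {g′ = λ d → (- h p) * (ind (¬? (p ∣? d)) * μ d)} (λ d 1≤d d∣n →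
          trans (cong₂ (λ x y → ind (¬? (p ∣? d)) * (μ d * ℓ d) + x * y) (μ-* l 1≤d d∣n) (ℓ-* (LPF-* l d∣n) 1≤d))
            (lem′ (ind (¬? (p ∣? d))) (μ d) (ℓ d) (h p))))
        (trans (DS-*ˡ n (- h p) _) (trans (sym (ℚ.neg-distribˡ-* (h p) (Q p n))) (cong -_ (sym (Λ-Q n 1≤n p l)))))))
      where
      lem : ∀ x → 0ℚ + 1ℚ * (x * 0ℚ) ≡ - 0ℚ
      lem = solve-∀ ℚ-ring
      lem′ : ∀ i m l h → i * (m * l) + i * (- m) * (h + l) ≡ (- h) * (i * m)
      lem′ = solve-∀ ℚ-ring

    PrimePower : ℕ → Set
    PrimePower n = ∃[ p ] ∃[ k ] (LPF p n × n ≡ p ℕ.^ suc k × Λ n ≡ h p)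

    Λ-support : ∀ n → 1 ℕ.≤ n → Λ n ≡ 0ℚ ⊎ PrimePower n
    Λ-support = LPF-induction (λ n → Λ n ≡ 0ℚ ⊎ PrimePower n) (inj₁ Λ-rec.value-1) go
      where
      lem₁ : ∀ x → 0ℚ * x + 0ℚ ≡ 0ℚ
      lem₁ = solve-∀ ℚ-ring
      lem₂ : ∀ x → 1ℚ * x + 0ℚ ≡ x
      lem₂ = solve-∀ ℚ-ring
      lem₃ : ∀ x y → 0ℚ * x + 1ℚ * y ≡ y
      lem₃ = solve-∀ ℚ-ring
      go : ∀ p n → LPF p (p ℕ.* n) → 1 ℕ.≤ n → Λ n ≡ 0ℚ ⊎ PrimePower n → Λ (p ℕ.* n) ≡ 0ℚ ⊎ PrimePower (p ℕ.* n)
      go p n l 1≤n ih with n ℕ.≟ 1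
      ... | yes refl = inj₂ (p , 0 , l , refl , trans (Λ-rec.value-* l 1≤n)
        (trans (cong (1ℚ * h p +_) (trans (cong (ind (p ∣? 1) *_) Λ-rec.value-1) (ℚ.*-zeroʳ (ind (p ∣? 1))))) (lem₂ (h p))))
      ... | no n≢1 with p ∣? n | ih
      ...   | no p∤n | _ = inj₁ (trans (Λ-rec.value-* l 1≤n)
        (trans (cong₂ (λ x y → x * h p + y * Λ n) (ind-no (n ℕ.≟ 1) n≢1) (ind-no (p ∣? n) p∤n)) (lem₄ (h p) (Λ n))))
        where
        lem₄ : ∀ x y → 0ℚ * x + 0ℚ * y ≡ 0ℚ
        lem₄ = solve-∀ ℚ-ring
      ...   | yes p∣n | inj₁ e = inj₁ (trans (Λ-rec.value-* l 1≤n) (trans (cong₂ (λ x y → x * h p + y) (ind-no (n ℕ.≟ 1) n≢1)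
        (trans (cong (ind (p ∣? n) *_) e) (ℚ.*-zeroʳ (ind (p ∣? n))))) (lem₁ (h p))))
      ...   | yes p∣n | inj₂ (q , k , lq , e , e′) with LPF-unique lq (LPF-factor l p∣n)
      ...     | refl = inj₂ (p , suc k , l , cong (p ℕ.*_) e , trans (Λ-rec.value-* l 1≤n)
        (trans (cong₂ (λ x y → x * h p + y * Λ n) (ind-no (n ℕ.≟ 1) n≢1) (ind-yes (p ∣? n) p∣n)) (trans (lem₃ (h p) (Λ n)) e′)))

    module _ (h≥0 : ∀ n → 1 ℕ.≤ n → 0ℚ ≤ h n) where

      ℓ≥0 : ∀ n → 1 ℕ.≤ n → 0ℚ ≤ ℓ n
      ℓ≥0 = LPF-induction (λ n → 0ℚ ≤ ℓ n) (≤-reflexive (sym ℓ-1))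
        (λ p n l 1≤n ih → ≥0-by (h≥0 p (prime≥1 (is-prime l)) ⊕ ih) (ℓ-* l 1≤n))

      Λ≥0 : ∀ n → 1 ℕ.≤ n → 0ℚ ≤ Λ n
      Λ≥0 = LPF-induction (λ n → 0ℚ ≤ Λ n) (≤-reflexive (sym Λ-rec.value-1))
        (λ p n l 1≤n ih → ≥0-by ((ind≥0 (n ℕ.≟ 1) ⊗ h≥0 p (prime≥1 (is-prime l))) ⊕ (ind≥0 (p ∣? n) ⊗ ih)) (Λ-rec.value-* l 1≤n))

      Λ≤ℓ : ∀ n → 1 ℕ.≤ n → Λ n ≤ ℓ n
      Λ≤ℓ n 1≤n = ≤-trans (DS-term 1≤n 1≤n ∣-refl Λ≥0) (≤-reflexive (DS-Λ n 1≤n))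

  -- Harmonic sums and a rational logarithm

  H-mono : ∀ {a b} → a ℕ.≤ b → H a ≤ H b
  H-mono a≤b = ∑-range-mono a≤b (λ i _ _ → rec≥0 i)

  H-block : ∀ a k → H (k ℕ.+ a) - H a ≡ ∑ k (λ i → rec (i ℕ.+ a))
  H-block a k = trans (cong (_- H a) (∑-split a k)) (lem (H a) (∑ k (λ i → rec (i ℕ.+ a))))
    where
    lem : ∀ x y → x + y - x ≡ y
    lem = solve-∀ ℚ-ring

  H-block-≤ : ∀ a k → 1 ℕ.≤ a → H (k ℕ.+ a) - H a ≤ ι k * rec a
  H-block-≤ a k 1≤a = ≤-trans (≤-reflexive (H-block a k))
    (≤-trans (∑-mono k (λ i _ _ → rec-anti 1≤a (ℕ.m≤n+m a i))) (≤-reflexive (∑-const k (rec a))))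

  H-block-≥ : ∀ a k → ι k * rec (k ℕ.+ a) ≤ H (k ℕ.+ a) - H a
  H-block-≥ a k = ≤-trans (≤-reflexive (sym (∑-const k (rec (k ℕ.+ a)))))
    (≤-trans (∑-mono k (λ i 1≤i i≤k → rec-anti (ℕ.≤-trans 1≤i (ℕ.m≤m+n i a)) (ℕ.+-monoˡ-≤ a i≤k))) (≤-reflexive (sym (H-block a k))))

  ι*rec-* : ∀ {a b} → 1 ℕ.≤ a → 1 ℕ.≤ b → ι a * rec (a ℕ.* b) ≡ rec b
  ι*rec-* {a} {b} 1≤a 1≤b = trans (cong (ι a *_) (rec-* 1≤a 1≤b))
    (trans (sym (ℚ.*-assoc (ι a) (rec a) (rec b))) (trans (cong (_* rec b) (ι*rec 1≤a)) (ℚ.*-identityˡ (rec b))))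

  -- An approximate natural logarithm on {1, …, X} with rational values:
  -- log n ≈ 1/(B+1) + … + 1/(nB), additive up to 1/B, with B = 2X².
  module Logarithm (X : ℕ) (1≤X : 1 ℕ.≤ X) where

    -- At n the functions `ℓ` and `h` may differ by n / B, so comparing n with n + 1 costs (2 n + 1)
    -- / B. For n < X this is at most 1 / n because n (2 n + 1) ≤ X (X + X).
    B : ℕ
    B = X ℕ.* (X ℕ.+ X)

    1≤B : 1 ℕ.≤ B
    1≤B = ℕ.*-mono-≤ 1≤X (ℕ.≤-trans 1≤X (ℕ.m≤m+n X X))

    h : ℕ → ℚ
    h n = H (n ℕ.* B) - H B

    h-1 : h 1 ≡ 0ℚ
    h-1 = ≡⇒diff0 (cong H (ℕ.+-identityʳ B))

    h≥0 : ∀ n → 1 ℕ.≤ n → 0ℚ ≤ h n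
    h≥0 n 1≤n = diff (H-mono (ℕ.≤-trans (ℕ.≤-reflexive (sym (ℕ.+-identityʳ B))) (ℕ.*-monoˡ-≤ B 1≤n)))

    private
      lem₁ : ∀ a b c → (a - b) - (c - b) ≡ a - c
      lem₁ = solve-∀ ℚ-ring

    h-suc : ∀ n → 1 ℕ.≤ n → ∣ h (suc n) - h n ∣ ≤ rec n
    h-suc n 1≤n = abs-≡
      (abs-nonneg (diff (H-mono (ℕ.m≤n+m (n ℕ.* B) B)))
        (≤-trans (H-block-≤ (n ℕ.* B) B (ℕ.*-mono-≤ 1≤n 1≤B))
          (≤-reflexive (trans (cong (λ k → ι B * rec k) (ℕ.*-comm n B)) (ι*rec-* 1≤B 1≤n)))))
      (lem₁ (H (B ℕ.+ n ℕ.* B)) (H B) (H (n ℕ.* B)))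

    2B : 2 ℕ.* B ≡ B ℕ.+ B
    2B = cong (B ℕ.+_) (ℕ.+-identityʳ B)

    h-2≤1 : h 2 ≤ 1ℚ
    h-2≤1 = ≤-trans (≤-reflexive (cong (λ n → H n - H B) 2B)) (≤-trans (H-block-≤ B B 1≤B) (ι*rec≤ B))

    1≤h-2+h-2 : 1ℚ ≤ h 2 + h 2
    1≤h-2+h-2 = ≤-trans (≤-reflexive (trans (sym (ι*rec 1≤2B)) (trans (cong₂ (λ x y → x * rec y) (ι-+ B B) refl) (ℚ.*-distribʳ-+ (rec (B ℕ.+ B)) (ι B) (ι B)))))
      (≤-trans (ℚ.+-mono-≤ (H-block-≥ B B) (H-block-≥ B B)) (≤-reflexive (cong (λ n → (H n - H B) + (H n - H B)) (sym 2B))))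
      where
      1≤2B : 1 ℕ.≤ B ℕ.+ B
      1≤2B = ℕ.≤-trans 1≤B (ℕ.m≤m+n B B)

    private
      -- Comparing the harmonic sum over (B, B + i] with the one over (aB, a(B + i)].
      G : ℕ → ℕ → ℚ
      G a i = (H (a ℕ.* (i ℕ.+ B)) - H (a ℕ.* B)) - (H (i ℕ.+ B) - H B)

      a*suc : ∀ a j → a ℕ.* suc j ≡ a ℕ.+ a ℕ.* j
      a*suc = ℕ.*-suc

      G-step : ∀ a i → G a (suc i) ≡ G a i + ((H (a ℕ.+ a ℕ.* (i ℕ.+ B)) - H (a ℕ.* (i ℕ.+ B))) - rec (suc (i ℕ.+ B)))
      G-step a i = trans (cong (λ n → (H n - H (a ℕ.* B)) - (H (suc i ℕ.+ B) - H B)) (a*suc a (i ℕ.+ B)))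
        (lem (H (a ℕ.+ a ℕ.* (i ℕ.+ B))) (H (a ℕ.* B)) (H (i ℕ.+ B)) (rec (suc (i ℕ.+ B))) (H B) (H (a ℕ.* (i ℕ.+ B))))
        where
        lem : ∀ x y z r b w → (x - y) - ((z + r) - b) ≡ ((w - y) - (z - b)) + ((x - w) - r)
        lem = solve-∀ ℚ-ring

      block-lower : ∀ a j → 1 ℕ.≤ a → rec (suc j) ≤ H (a ℕ.+ a ℕ.* j) - H (a ℕ.* j)
      block-lower a j 1≤a = ≤-trans (≤-reflexive (trans (sym (ι*rec-* 1≤a (s≤s z≤n))) (cong (λ n → ι a * rec n) (a*suc a j)))) (H-block-≥ (a ℕ.* j) a)

      block-upper : ∀ a j → 1 ℕ.≤ a → 1 ℕ.≤ j → H (a ℕ.+ a ℕ.* j) - H (a ℕ.* j) ≤ rec j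
      block-upper a j 1≤a 1≤j = ≤-trans (H-block-≤ (a ℕ.* j) a (ℕ.*-mono-≤ 1≤a 1≤j)) (≤-reflexive (ι*rec-* 1≤a 1≤j))

      G≥0 : ∀ a i → 1 ℕ.≤ a → 0ℚ ≤ G a i
      G≥0 a zero    1≤a = ≤-reflexive (sym (lem (H (a ℕ.* B)) (H B)))
        where
        lem : ∀ x y → (x - x) - (y - y) ≡ 0ℚ
        lem = solve-∀ ℚ-ring
      G≥0 a (suc i) 1≤a = ≥0-by (G≥0 a i 1≤a ⊕ diff (block-lower a (i ℕ.+ B) 1≤a)) (G-step a i)

      -- The block of a reciprocals after a j lies between 1 / (j + 1) and 1 / j. Replacing it by 1
      -- / (j + 1) therefore costs at most 1 / j - 1 / (j + 1), and these costs telescope from B on.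
      G≤ : ∀ a i → 1 ℕ.≤ a → G a i ≤ rec B - rec (i ℕ.+ B)
      G≤ a zero    1≤a = ≤-reflexive (lem (H (a ℕ.* B)) (H B) (rec B))
        where
        lem : ∀ x y z → (x - x) - (y - y) ≡ z - z
        lem = solve-∀ ℚ-ring
      G≤ a (suc i) 1≤a = ≤-trans (≤-reflexive (G-step a i))
        (≤-trans (ℚ.+-mono-≤ (G≤ a i 1≤a) (ℚ.+-monoˡ-≤ _ (block-upper a (i ℕ.+ B) 1≤a (ℕ.≤-trans 1≤B (ℕ.m≤n+m B i)))))
          (≤-reflexive (lem (rec B) (rec (i ℕ.+ B)) (rec (suc (i ℕ.+ B))))))
        where
        lem : ∀ x y z → (x - y) + (y - z) ≡ x - z
        lem = solve-∀ ℚ-ring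

    h-* : ∀ {a b} → 1 ℕ.≤ a → 1 ℕ.≤ b → ∣ h a + h b - h (a ℕ.* b) ∣ ≤ rec B
    h-* {a} {b} 1≤a 1≤b = abs-≡ (abs-neg (abs-nonneg (G≥0 a i 1≤a)
        (≤-by (rec≥0 (i ℕ.+ B) ⊕ diff (G≤ a i 1≤a)) (lem′ (rec B) (G a i) (rec (i ℕ.+ B))))))
      (trans (lem (H (a ℕ.* B)) (H B) (H (b ℕ.* B)) (H (a ℕ.* b ℕ.* B)))
        (cong -_ (cong₂ (λ x y → (H x - H (a ℕ.* B)) - (H y - H B))
          (trans (ℕ.*-assoc a b B) (cong (a ℕ.*_) (sym i+B))) (sym i+B))))
      where
      i = b ℕ.* B ℕ.∸ B
      i+B : i ℕ.+ B ≡ b ℕ.* B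
      i+B = ℕ.m∸n+n≡m (ℕ.≤-trans (ℕ.≤-reflexive (sym (ℕ.+-identityʳ B))) (ℕ.*-monoˡ-≤ B 1≤b))
      lem : ∀ x y z w → (x - y) + (z - y) - (w - y) ≡ - ((w - x) - (z - y))
      lem = solve-∀ ℚ-ring
      lem′ : ∀ x y z → x - y ≡ z + (x - z - y)
      lem′ = solve-∀ ℚ-ring

    open Mangoldt h

    -- Each prime factor split off costs 1 / B by `h-*`, and n has fewer than n prime factors.
    ℓ≈h : ∀ n → 1 ℕ.≤ n → ∣ ℓ n - h n ∣ ≤ ι n * rec B
    ℓ≈h = LPF-induction (λ n → ∣ ℓ n - h n ∣ ≤ ι n * rec B)
      (abs-≡ (abs-nonneg ≤-refl (ι≥0 1 ⊗ rec≥0 B)) (trans (cong₂ _-_ ℓ-1 h-1) refl))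
      (λ p n l 1≤n ih → ≤-trans
        (abs-≡ (abs-+ ih (h-* (prime≥1 (is-prime l)) 1≤n))
          (trans (cong (_- h (p ℕ.* n)) (ℓ-* l 1≤n)) (lem (h p) (ℓ n) (h (p ℕ.* n)) (h n))))
        (≤-trans (≤-reflexive (lem′ (ι n) (rec B))) (*-monoʳ-≤ (rec≥0 B) (ι-mono (n<p*n (prime≥2 (is-prime l)) 1≤n)))))
      where
      lem : ∀ a b c d → a + b - c ≡ (b - d) + (a + d - c)
      lem = solve-∀ ℚ-ring
      lem′ : ∀ a b → a * b + b ≡ (1ℚ + a) * b
      lem′ = solve-∀ ℚ-ring

    ℓ-suc : ∀ n → 1 ℕ.≤ n → n ℕ.< X → ∣ ℓ (suc n) - ℓ n ∣ ≤ rec n + rec n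
    ℓ-suc n 1≤n n<X = ≤-trans
      (abs-≡ (abs-- (abs-+ (h-suc n 1≤n) (ℓ≈h (suc n) (s≤s z≤n))) (ℓ≈h n 1≤n))
        (lem (ℓ (suc n)) (ℓ n) (h (suc n)) (h n)))
      (≤-trans (≤-reflexive (trans (lem′ (rec n) (ι (suc n)) (ι n) (rec B)) (cong (λ x → rec n + x * rec B) (sym (ι-+ (suc n) n)))))
        (ℚ.+-monoʳ-≤ (rec n) (≤-trans (≤-reflexive (ℚ.*-comm (ι (suc n ℕ.+ n)) (rec B))) (rec-≤ 1≤B
          (≤-trans (≤-reflexive (sym (ℚ.*-identityʳ (ι (suc n ℕ.+ n)))))
            (≤-trans (≤-reflexive (trans (cong (ι (suc n ℕ.+ n) *_) (sym (ι*rec 1≤n)))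
                (trans (sym (ℚ.*-assoc (ι (suc n ℕ.+ n)) (ι n) (rec n))) (cong (_* rec n) (sym (ι-* (suc n ℕ.+ n) n))))))
              (*-monoʳ-≤ (rec≥0 n) (ι-mono (ℕ.≤-trans (ℕ.≤-reflexive (ℕ.*-comm (suc n ℕ.+ n) n))
                (ℕ.*-mono-≤ (ℕ.<⇒≤ n<X) (ℕ.+-mono-≤ n<X (ℕ.<⇒≤ n<X))))))))))))
      where
      lem : ∀ a b c d → a - b ≡ (c - d) + (a - c) - (b - d)
      lem = solve-∀ ℚ-ring
      lem′ : ∀ r a b c → r + a * c + b * c ≡ r + (a + b) * c
      lem′ = solve-∀ ℚ-ring

  -- Chebyshev's bound

  ι*-≤ : ∀ k {a b} → a ≤ b → ι k * a ≤ ι k * b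
  ι*-≤ k = *-monoˡ-≤ (ι≥0 k)

  -- Boundedness is asked along all multiples of every d, with the same B, because the series
  -- `L f t d` occur for all d and must have uniformly small tails.
  Oscillates : (ℕ → ℚ) → ℚ → Set
  Oscillates f B = ∀ d n → ∣ ∑ n (λ e → f (d ℕ.* e)) ∣ ≤ B

  oscillates-dilate : ∀ {f B} d → Oscillates f B → Oscillates (λ e → f (d ℕ.* e)) B
  oscillates-dilate {f} d osc d′ n = abs-≡ (osc (d ℕ.* d′) n)
    (∑-cong′ n (λ e → cong f (sym (ℕ.*-assoc d d′ e))))

  oscillates-1 : ∀ {f B} → Oscillates f B → ∀ n → ∣ ∑ n f ∣ ≤ B
  oscillates-1 {f} osc n = abs-≡ (osc 1 n) (∑-cong′ n (λ e → cong f (sym (ℕ.*-identityˡ e))))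

  module Estimates (X : ℕ) (h : ℕ → ℚ) (h≥0 : ∀ n → 1 ℕ.≤ n → 0ℚ ≤ h n) (h-2≤1 : h 2 ≤ 1ℚ)
    (ℓ-suc : ∀ n → 1 ℕ.≤ n → n ℕ.< X → ∣ Mangoldt.ℓ h (suc n) - Mangoldt.ℓ h n ∣ ≤ rec n + rec n) where

    open Mangoldt h

    -- This replaces Stirling's formula: `D n` is O(n) because passing from n to n + 1 changes each
    -- of the n terms by at most 2 / n. It also controls the weights ℓ y - ℓ d of Shapiro's second
    -- identity.
    D : ℕ → ℚ
    D n = ∑ n (λ d → ∣ ℓ n - ℓ d ∣)

    private
      2* : ∀ x → x + x ≡ ι 2 * x
      2* = solve-∀ ℚ-ring

    D≤ : ∀ n → n ℕ.≤ X → D n ≤ ι 2 * ι n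
    D≤ zero          _   = ≤-refl
    D≤ (suc zero)    _   = ≤-trans (≤-reflexive (trans (ℚ.+-identityˡ ∣ ℓ 1 - ℓ 1 ∣) (cong ∣_∣ (≡⇒diff0 {ℓ 1} refl)))) (ι≥0 2)
    D≤ (suc n@(suc _)) n<X = ≤-trans
      (ℚ.+-mono-≤
        (≤-trans (∑-mono n (λ d 1≤d d≤n → ≤-trans
          (≤-reflexive (cong ∣_∣ (lem (ℓ (suc n)) (ℓ d) (ℓ n)))) (ℚ.∣p+q∣≤∣p∣+∣q∣ (ℓ (suc n) - ℓ n) (ℓ n - ℓ d))))
          (≤-trans (≤-reflexive (trans (∑-+ n) (cong (_+ D n) (∑-const n ∣ ℓ (suc n) - ℓ n ∣))))
            (ℚ.+-mono-≤ (≤-trans (ι*-≤ n (ℓ-suc n (s≤s z≤n) n<X))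
                (≤-reflexive (trans (ℚ.*-distribˡ-+ (ι n) (rec n) (rec n)) (cong₂ _+_ (ι*rec {n} (s≤s z≤n)) (ι*rec {n} (s≤s z≤n))))))
              (D≤ n (ℕ.<⇒≤ n<X)))))
        (≤-reflexive (cong ∣_∣ (≡⇒diff0 {ℓ (suc n)} refl))))
      (≤-reflexive (lem′ (ι n)))
      where
      lem : ∀ a b c → a - b ≡ (a - c) + (c - b)
      lem = solve-∀ ℚ-ring
      lem′ : ∀ x → ((1ℚ + 1ℚ) + ι 2 * x) + 0ℚ ≡ ι 2 * (1ℚ + x)
      lem′ = solve-∀ ℚ-ring

    ℓ≤ : ∀ n → 1 ℕ.≤ n → n ℕ.≤ X → ℓ n ≤ ι 2 * ι n
    ℓ≤ n 1≤n n≤X = ≤-trans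
      (≤-trans (≤-reflexive (trans (sym (lem (ℓ n))) (cong (λ x → ℓ n - x) (sym ℓ-1)))) (≤-trans (≤-abs (ℓ n - ℓ 1))
        (∑-term {f = λ d → ∣ ℓ n - ℓ d ∣} (s≤s z≤n) 1≤n (λ d _ _ → ℚ.0≤∣p∣ (ℓ n - ℓ d)))))
      (D≤ n n≤X)
      where
      lem : ∀ x → x - 0ℚ ≡ x
      lem = solve-∀ ℚ-ring

    ψ : ℕ → ℚ
    ψ n = ∑ n Λ

    ∑ℓ : ∀ n → ∑ n ℓ ≡ ∑ n (λ d → Λ d * ι (quo n d))
    ∑ℓ n = trans (∑-cong n (λ k 1≤k _ → trans (sym (DS-Λ k 1≤k)) (sym (ℚ.*-identityˡ (DS k Λ)))))
      (trans (hyperbola n (λ _ → 1ℚ) Λ)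
        (∑-cong′ n (λ d → cong (Λ d *_) (trans (∑-const (quo n d) 1ℚ) (ℚ.*-identityʳ (ι (quo n d)))))))

    private
      ∑ℓ≈ : ∀ n → n ℕ.≤ X → ∣ ι n * ℓ n - ∑ n ℓ ∣ ≤ ι 2 * ι n
      ∑ℓ≈ n n≤X = ≤-trans (abs-≡ (∑-abs n (λ d _ _ → ≤-refl))
        (sym (trans (∑-- {f = λ _ → ℓ n} {g = ℓ} n) (cong (_- ∑ n ℓ) (∑-const n (ℓ n)))))) (D≤ n n≤X)

      quo-double : ∀ z d → 1 ℕ.≤ d → quo z d ℕ.+ quo z d ℕ.≤ quo (z ℕ.+ z) d
      quo-double z d 1≤d = ℕ.m<1+n⇒m≤n (ℕ.*-cancelˡ-< d _ _ (ℕ.≤-<-trans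
        (ℕ.≤-trans (ℕ.≤-reflexive (ℕ.*-distribˡ-+ d (quo z d) (quo z d))) (ℕ.+-mono-≤ (quo-lower z d) (quo-lower z d)))
        (quo-upper (z ℕ.+ z) 1≤d)))

      1≤quo : ∀ n d → 1 ℕ.≤ d → d ℕ.≤ n → 1 ℕ.≤ quo n d
      1≤quo n d 1≤d d≤n = ℕ.≤-pred (ℕ.*-cancelˡ-< d 1 _ (ℕ.≤-<-trans (ℕ.≤-trans (ℕ.≤-reflexive (ℕ.*-identityʳ d)) d≤n) (quo-upper n 1≤d)))

      Λ-term : ∀ d q q′ → 1 ℕ.≤ d → q ℕ.+ q ℕ.≤ q′ → 0ℚ ≤ Λ d * ι q′ - ι 2 * (Λ d * ι q)
      Λ-term d q q′ 1≤d le = ≥0-by (Λ≥0 h≥0 d 1≤d ⊗ diff (≤-trans (≤-reflexive (sym (ι-+ q q))) (ι-mono le))) (lem (Λ d) (ι q) (ι q′))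
        where
        lem : ∀ a b c → a * c - ι 2 * (a * b) ≡ a * (c - (b + b))
        lem = solve-∀ ℚ-ring

    -- Chebyshev's argument: in ∑ ℓ over 2 z minus twice ∑ ℓ over z, each Λ d has a nonnegative
    -- coefficient, which is at least 1 for z < d ≤ 2 z. The two approximations of n ℓ n cost 4 z
    -- each and ℓ (2 z) - ℓ z = h 2 ≤ 1 gives another 2 z, hence the 10.
    ψ-double : ∀ z → 1 ℕ.≤ z → z ℕ.+ z ℕ.≤ X → ψ (z ℕ.+ z) ≤ ψ z + ι 10 * ι z
    ψ-double z 1≤z 2z≤X = conclude (ψ (z ℕ.+ z)) (ψ z) (∑ (z ℕ.+ z) ℓ) (∑ z ℓ) (ι z) (ℓ z) (h 2)
      lower (abs-upper (∑ℓ≈ z (ℕ.≤-trans (ℕ.m≤m+n z z) 2z≤X)))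
      (≤-trans (≤-reflexive (cong₂ (λ a b → - (a * b - ∑ (z ℕ.+ z) ℓ)) (sym (ι-+ z z)) (sym ℓ2z)))
        (≤-trans (abs-lower (∑ℓ≈ (z ℕ.+ z) 2z≤X)) (≤-reflexive (cong (ι 2 *_) (ι-+ z z))))) (ι≥0 z) h-2≤1
      where
      conclude : ∀ p q T₂ T₁ z l h₂ → p - q ≤ T₂ - ι 2 * T₁ → z * l - T₁ ≤ ι 2 * z →
        - ((z + z) * (h₂ + l) - T₂) ≤ ι 2 * (z + z) → 0ℚ ≤ z → h₂ ≤ 1ℚ → p ≤ q + ι 10 * z
      conclude p q T₂ T₁ z l h₂ a b c z≥0 d =
        ≤-by (diff a ⊕ diff b ⊕ diff b ⊕ diff c ⊕ (z≥0 ⊗ diff d) ⊕ (z≥0 ⊗ diff d))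
          (solve (p ∷ q ∷ T₂ ∷ T₁ ∷ z ∷ l ∷ h₂ ∷ []) ℚ-ring)
      2z : 2 ℕ.* z ≡ z ℕ.+ z
      2z = cong (z ℕ.+_) (ℕ.+-identityʳ z)
      ℓ2z : ℓ (z ℕ.+ z) ≡ h 2 + ℓ z
      ℓ2z = trans (cong ℓ (sym 2z)) (ℓ-* (LPF-2 z) 1≤z)
      low₁ : 0ℚ ≤ ∑ z (λ d → Λ d * ι (quo (z ℕ.+ z) d)) - ι 2 * ∑ z (λ d → Λ d * ι (quo z d))
      low₁ = ≥0-by
        (∑-≥0 z (λ d 1≤d _ → Λ-term d (quo z d) (quo (z ℕ.+ z) d) 1≤d (quo-double z d 1≤d)))
        (sym (trans (∑-- z) (cong (λ x → ∑ z (λ d → Λ d * ι (quo (z ℕ.+ z) d)) - x) (∑-*ˡ z (ι 2)))))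
      low₂ : ∑ z (λ i → Λ (i ℕ.+ z)) ≤ ∑ z (λ i → Λ (i ℕ.+ z) * ι (quo (z ℕ.+ z) (i ℕ.+ z)))
      low₂ = ∑-mono z (λ i 1≤i i≤z → ≤-trans (≤-reflexive (sym (ℚ.*-identityʳ (Λ (i ℕ.+ z)))))
        (*-monoˡ-≤ (Λ≥0 h≥0 (i ℕ.+ z) (ℕ.≤-trans 1≤i (ℕ.m≤m+n i z)))
          (1≤ι (1≤quo (z ℕ.+ z) (i ℕ.+ z) (ℕ.≤-trans 1≤i (ℕ.m≤m+n i z)) (ℕ.+-monoˡ-≤ z i≤z)))))
      lower : ψ (z ℕ.+ z) - ψ z ≤ ∑ (z ℕ.+ z) ℓ - ι 2 * ∑ z ℓ
      lower = subst₂ (λ a b → ψ (z ℕ.+ z) - ψ z ≤ a - ι 2 * b)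
        (sym (trans (∑ℓ (z ℕ.+ z)) (∑-split z z))) (sym (∑ℓ z))
        (subst (λ p → p - ψ z ≤ (A + A′) - ι 2 * A″) (sym (∑-split z z))
          (combine (∑ z Λ) (∑ z (λ i → Λ (i ℕ.+ z))) A A′ A″ low₁ low₂))
        where
        A A′ A″ : ℚ
        A  = ∑ z (λ d → Λ d * ι (quo (z ℕ.+ z) d))
        A′ = ∑ z (λ i → Λ (i ℕ.+ z) * ι (quo (z ℕ.+ z) (i ℕ.+ z)))
        A″ = ∑ z (λ d → Λ d * ι (quo z d))
        combine : ∀ a b x y w → 0ℚ ≤ x - ι 2 * w → b ≤ y → (a + b) - a ≤ (x + y) - ι 2 * w
        combine a b x y w p q = ≤-by (p ⊕ diff q) (solve (a ∷ b ∷ x ∷ y ∷ w ∷ []) ℚ-ring)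

    ψ≤ : ∀ n → n ℕ.< X → ψ n ≤ ι 30 * ι n
    ψ≤ = ℕ.<-rec (λ n → n ℕ.< X → ψ n ≤ ι 30 * ι n) go
      where
      fin : ∀ p q z n → p ≤ q + ι 10 * z → q ≤ ι 30 * z → ι 2 * z ≤ 1ℚ + n → ι 2 ≤ n → p ≤ ι 30 * n
      fin p q z n a b c d = ≤-by (diff a ⊕ diff b ⊕ (ι≥0 20 ⊗ diff c) ⊕ (ι≥0 10 ⊗ diff d)) (solve (p ∷ q ∷ z ∷ n ∷ []) ℚ-ring)
      go : ∀ n → (∀ {k} → k ℕ.< n → k ℕ.< X → ψ k ≤ ι 30 * ι k) → n ℕ.< X → ψ n ≤ ι 30 * ι n
      go zero          ih _ = ≤-refl
      go (suc zero)    ih _ = ≤-trans (≤-reflexive (trans (ℚ.+-identityˡ (Λ 1)) Λ-rec.value-1)) (ι≥0 30 ⊗ ι≥0 1)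
      go n@(suc (suc k)) ih n<X = ≤-trans
        (∑-range-mono {f = Λ} n≤2z (λ i 1≤i _ → Λ≥0 h≥0 i 1≤i))
        (fin (ψ (z ℕ.+ z)) (ψ z) (ι z) (ι n) (ψ-double z (s≤s z≤n) (ℕ.≤-trans 2z≤ n<X)) (ih z<n (ℕ.<-trans z<n n<X))
          (≤-trans (≤-reflexive (trans (sym (2* (ι z))) (sym (ι-+ z z)))) (ι-mono 2z≤)) (ι-mono {2} {n} (s≤s (s≤s z≤n))))
        where
        -- Half of n, rounded up. The constant 30 reproduces itself: 10 z + 30 z ≤ 20 (n + 1) ≤ 30 n
        -- for n ≥ 2.
        z = suc ⌊ suc k /2⌋
        n≤2z : n ℕ.≤ z ℕ.+ z
        n≤2z = s≤s (ℕ.≤-trans (s≤s (ℕ.≤-trans (ℕ.≤-reflexive (sym (ℕ.⌊n/2⌋+⌈n/2⌉≡n k)))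
          (ℕ.+-monoˡ-≤ ⌊ suc k /2⌋ (ℕ.⌊n/2⌋≤⌈n/2⌉ k)))) (ℕ.≤-reflexive (sym (ℕ.+-suc ⌊ suc k /2⌋ ⌊ suc k /2⌋))))
        2z≤ : z ℕ.+ z ℕ.≤ suc n
        2z≤ = s≤s (ℕ.≤-trans (ℕ.≤-reflexive (ℕ.+-suc ⌊ suc k /2⌋ ⌊ suc k /2⌋))
          (s≤s (ℕ.≤-trans (ℕ.+-monoʳ-≤ ⌊ suc k /2⌋ (ℕ.⌊n/2⌋≤⌈n/2⌉ (suc k))) (ℕ.≤-reflexive (ℕ.⌊n/2⌋+⌈n/2⌉≡n (suc k))))))
        z<n : z ℕ.< n
        z<n = s≤s (ℕ.⌊n/2⌋<n k)

  -- Sums of Λ against oscillating functions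

  -- The truncated Dirichlet series at 1 of e ↦ f (d e).
  L : (ℕ → ℚ) → ℕ → ℕ → ℚ
  L f t d = ∑ t (λ e → f (d ℕ.* e) * rec e)

  L-dilate : ∀ f d t a → L (λ e → f (d ℕ.* e)) t a ≡ L f t (a ℕ.* d)
  L-dilate f d t a = ∑-cong′ t (λ e → cong (λ n → f n * rec e)
    (trans (sym (ℕ.*-assoc d a e)) (cong (ℕ._* e) (ℕ.*-comm d a))))

  ∑-conv : ∀ f y b → ∑ y (λ n → (f n * rec n) * DS n b) ≡ ∑ y (λ d → b d * (rec d * L f (quo y d) d))
  ∑-conv f y b = trans (hyperbola y (λ n → f n * rec n) b)
    (∑-cong y (λ d 1≤d _ → cong (b d *_) (trans
      (∑-cong (quo y d) (λ e 1≤e _ → trans (cong (f (d ℕ.* e) *_) (rec-* 1≤d 1≤e)) (lem (f (d ℕ.* e)) (rec d) (rec e))))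
      (∑-*ˡ (quo y d) (rec d)))))
    where
    lem : ∀ a b c → a * (b * c) ≡ b * (a * c)
    lem = solve-∀ ℚ-ring

  module Oscillating (f : ℕ → ℚ) (B : ℚ) (osc : Oscillates f B) where

    B≥0 : 0ℚ ≤ B
    B≥0 = abs≥0 (osc 1 1)

    2B≥0 : 0ℚ ≤ B + B
    2B≥0 = B≥0 ⊕ B≥0

    L-tail : ∀ {y t d} → 1 ℕ.≤ y → y ℕ.≤ t → 1 ℕ.≤ d →
      ∣ L f t d - L f (quo y d) d ∣ ≤ (B + B) * (ι d * rec y)
    L-tail {y} {t} {d} 1≤y y≤t 1≤d = ≤-trans
      (rec-tail (osc d) (ℕ.≤-trans (quo-≤ y d) y≤t))
      (*-monoˡ-≤ 2B≥0 (rec-suc-quo 1≤y 1≤d))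

    -- In the exact identity `∑-conv` the series at d has length y / d. Extending it to the common
    -- length t costs 2 B d / y, and the weight 1 / d removes the d, leaving 2 B / y for each unit
    -- of |b d|.
    ∑-conv-≈ : ∀ {y t} b → 1 ℕ.≤ y → y ℕ.≤ t →
      ∣ ∑ y (λ d → b d * (rec d * L f t d)) - ∑ y (λ n → (f n * rec n) * DS n b) ∣ ≤
      ((B + B) * rec y) * ∑ y (λ d → ∣ b d ∣)
    ∑-conv-≈ {y} {t} b 1≤y y≤t = ≤-trans
      (abs-≡ (∑-abs y (λ d 1≤d _ → abs-* (≤-refl {∣ b d ∣}) (abs-scale (rec≥0 d) (L-tail 1≤y y≤t 1≤d))))
        (trans (cong (λ x → ∑ y (λ d → b d * (rec d * L f t d)) - x) (∑-conv f y b))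
          (trans (sym (∑-- y)) (∑-cong′ y (λ d → lem (b d) (rec d) (L f t d) (L f (quo y d) d))))))
      (≤-reflexive (trans (∑-cong y (λ d 1≤d _ → trans (lem₂ ∣ b d ∣ (rec d) (B + B) (ι d) (rec y))
          (trans (cong (λ x → x * ((B + B) * rec y) * ∣ b d ∣) (ι*rec 1≤d)) (lem₃ ((B + B) * rec y) ∣ b d ∣))))
        (∑-*ˡ y ((B + B) * rec y))))
      where
      lem : ∀ a b c d → a * (b * c) - a * (b * d) ≡ a * (b * (c - d))
      lem = solve-∀ ℚ-ring
      lem₂ : ∀ a b c d e → a * (b * (c * (d * e))) ≡ (d * b) * (c * e) * a
      lem₂ = solve-∀ ℚ-ring
      lem₃ : ∀ a b → 1ℚ * a * b ≡ a * b
      lem₃ = solve-∀ ℚ-ring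

  module OscillatingΛ (X : ℕ) (h : ℕ → ℚ) (h≥0 : ∀ n → 1 ℕ.≤ n → 0ℚ ≤ h n) (h-2≤1 : h 2 ≤ 1ℚ)
    (ℓ-suc : ∀ n → 1 ℕ.≤ n → n ℕ.< X → ∣ Mangoldt.ℓ h (suc n) - Mangoldt.ℓ h n ∣ ≤ rec n + rec n) where

    open Mangoldt h
    open Estimates X h h≥0 h-2≤1 ℓ-suc

    module Sums (f : ℕ → ℚ) (B : ℚ) (osc : Oscillates f B) where

      open Oscillating f B osc

      private
        F : ℕ → ℚ
        F n = ∑ n (λ i → f i * rec i)

        G : ℕ → ℕ → ℚ
        G y n = ∑ n (λ i → (f i * rec i) * ℓ i) - (F n - F y) * ℓ n

        rec-rec : ∀ n → 1 ℕ.≤ n → rec n * rec (suc n) ≡ rec n - rec (suc n)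
        rec-rec n 1≤n = trans (lem₁ (rec n) (rec (suc n)) (ι n))
          (trans (cong₂ (λ a b → rec n * a - b * rec (suc n)) (ι*rec′ n) (ι*rec 1≤n)) (lem₂ (rec n) (rec (suc n))))
          where
          lem₁ : ∀ r s i → r * s ≡ r * ((1ℚ + i) * s) - (i * r) * s
          lem₁ = solve-∀ ℚ-ring
          lem₂ : ∀ r s → r * 1ℚ - 1ℚ * s ≡ r - s
          lem₂ = solve-∀ ℚ-ring

        -- Partial summation with the tails F n - F y instead of the sums F n: at n = y the
        -- correction vanishes and `G` is the full sum. The tails are O(1 / n) and so are the
        -- increments of `ℓ`, so the steps are bounded by 4 B / (n (n + 1)), which telescopes
        -- without a logarithm.
        G-bound : ∀ y n → n ℕ.< y → y ℕ.≤ X → ∣ G y (suc n) ∣ ≤ ι 4 * B * (1ℚ - rec (suc n))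
        G-bound y zero    _ _ = ≤-reflexive (trans (cong ∣_∣ (trans (cong (λ x → (0ℚ + (f 1 * rec 1) * x) - (F 1 - F y) * x) ℓ-1)
          (lem (f 1 * rec 1) (F 1 - F y)))) (sym (trans (cong (λ x → ι 4 * B * (1ℚ - x)) rec-1) (lem′ (ι 4 * B)))))
          where
          lem : ∀ a b → (0ℚ + a * 0ℚ) - b * 0ℚ ≡ 0ℚ
          lem = solve-∀ ℚ-ring
          lem′ : ∀ a → a * (1ℚ - 1ℚ) ≡ 0ℚ
          lem′ = solve-∀ ℚ-ring
        G-bound y (suc n) n<y y≤X = ≤-trans
          (abs-≡ (abs-+ (G-bound y n (ℕ.<⇒≤ n<y) y≤X)
            (abs-* (rec-tail {h = f} (oscillates-1 {f} osc) (ℕ.<⇒≤ n<y)) (ℓ-suc (suc n) (s≤s z≤n) (ℕ.<-≤-trans n<y y≤X))))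
            (lem (∑ (suc n) (λ i → (f i * rec i) * ℓ i)) (f (suc (suc n)) * rec (suc (suc n))) (ℓ (suc (suc n))) (F (suc n)) (F y) (ℓ (suc n))))
          (≤-reflexive (trans (lem₂ B (rec (suc n)) (rec (suc (suc n))))
            (trans (cong (λ x → ι 4 * B * (1ℚ - rec (suc n)) + ι 4 * B * x) (rec-rec (suc n) (s≤s z≤n))) (lem₃ (ι 4 * B) (rec (suc n)) (rec (suc (suc n)))))))
          where
          lem : ∀ s a l f y l′ → (s + a * l) - ((f + a) - y) * l ≡ (s - (f - y) * l′) + (y - f) * (l - l′)
          lem = solve-∀ ℚ-ring
          lem₂ : ∀ b r s → ι 4 * b * (1ℚ - r) + (b + b) * s * (r + r) ≡ ι 4 * b * (1ℚ - r) + ι 4 * b * (r * s)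
          lem₂ = solve-∀ ℚ-ring
          lem₃ : ∀ b r s → b * (1ℚ - r) + b * (r - s) ≡ b * (1ℚ - s)
          lem₃ = solve-∀ ℚ-ring

      ∑-f-ℓ : ∀ {y} → 1 ℕ.≤ y → y ℕ.≤ X → ∣ ∑ y (λ i → (f i * rec i) * ℓ i) ∣ ≤ ι 4 * B
      ∑-f-ℓ {suc y} _ y≤X = ≤-trans
        (abs-≡ (G-bound (suc y) y ℕ.≤-refl y≤X) (lem (∑ (suc y) (λ i → (f i * rec i) * ℓ i)) (F (suc y)) (ℓ (suc y))))
        (≤-by (ι≥0 4 ⊗ B≥0 ⊗ rec≥0 (suc y)) (lem′ B (rec (suc y))))
        where
        lem : ∀ s a l → s ≡ s - (a - a) * l
        lem = solve-∀ ℚ-ring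
        lem′ : ∀ b r → ι 4 * b - ι 4 * b * (1ℚ - r) ≡ ι 4 * (b * r)
        lem′ = solve-∀ ℚ-ring

      -- Shapiro's first identity. Since Λ has divisor sums `ℓ`, the left side is ∑ f n ℓ n / n up
      -- to truncation; Chebyshev's bound makes the truncation cost 2 B times 30, and `∑-f-ℓ` adds 4
      -- B.
      ∑-Λ-L : ∀ {y t} → 1 ℕ.≤ y → y ℕ.≤ t → y ℕ.< X → ∣ ∑ y (λ d → Λ d * (rec d * L f t d)) ∣ ≤ ι 64 * B
      ∑-Λ-L {y} {t} 1≤y y≤t y<X = ≤-trans
        (abs-≡ (abs-+ (∑-conv-≈ Λ 1≤y y≤t)
            (abs-≡ (∑-f-ℓ 1≤y (ℕ.<⇒≤ y<X)) (∑-cong y (λ n 1≤n _ → cong ((f n * rec n) *_) (DS-Λ n 1≤n)))))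
          (lem (∑ y (λ d → Λ d * (rec d * L f t d))) (∑ y (λ n → (f n * rec n) * DS n Λ))))
        (≤-trans (ℚ.+-monoˡ-≤ (ι 4 * B) (≤-trans (≤-reflexive (trans (cong (((B + B) * rec y) *_) (∑-cong y (λ d 1≤d _ → ℚ.0≤p⇒∣p∣≡p (Λ≥0 h≥0 d 1≤d))))
              (ℚ.*-assoc (B + B) (rec y) (ψ y))))
            (*-monoˡ-≤ 2B≥0 (rec-≤ {y} {ψ y} {ι 30} 1≤y (≤-trans (ψ≤ y y<X) (≤-reflexive (ℚ.*-comm (ι 30) (ι y))))))))
          (≤-reflexive (lem′ B)))
        where
        lem : ∀ a b → a ≡ (a - b) + b
        lem = solve-∀ ℚ-ring
        lem′ : ∀ b → (b + b) * ι 30 + ι 4 * b ≡ ι 64 * b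
        lem′ = solve-∀ ℚ-ring

      -- Shapiro's second identity. The weight μ d (ℓ y - ℓ d) has divisor sum Λ n, plus ℓ y at n =
      -- 1. As |μ| ≤ 1, the truncation costs 2 B / y times `D y`, which is at most 4 B.
      ∑-μ-L : ∀ {y t} → 1 ℕ.≤ y → y ℕ.≤ t → y ℕ.≤ X →
        ∣ (f 1 * ℓ y + ∑ y (λ n → Λ n * (rec n * f n))) - ∑ y (λ d → (μ d * (ℓ y - ℓ d)) * (rec d * L f t d)) ∣ ≤ ι 4 * B
      ∑-μ-L {y} {t} 1≤y y≤t y≤X = ≤-trans
        (abs-≡ (abs-neg (∑-conv-≈ b 1≤y y≤t))
          (trans (cong (_- S) (sym main)) (lem (∑ y (λ n → (f n * rec n) * DS n b)) S)))
        (≤-trans (*-monoˡ-≤ (2B≥0 ⊗ rec≥0 y) (∑-mono y (λ d 1≤d _ → abs-* (μ-bound d 1≤d) (≤-refl {∣ ℓ y - ℓ d ∣}))))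
          (≤-trans (≤-reflexive (trans (cong (((B + B) * rec y) *_) (∑-cong′ y (λ d → ℚ.*-identityˡ ∣ ℓ y - ℓ d ∣))) (ℚ.*-assoc (B + B) (rec y) (D y))))
            (≤-trans (*-monoˡ-≤ 2B≥0 (rec-≤ {y} {D y} {ι 2} 1≤y (≤-trans (D≤ y y≤X) (≤-reflexive (ℚ.*-comm (ι 2) (ι y))))))
              (≤-reflexive (lem′ B)))))
        where
        b : ℕ → ℚ
        b d = μ d * (ℓ y - ℓ d)
        S : ℚ
        S = ∑ y (λ d → b d * (rec d * L f t d))
        lem : ∀ a b → a - b ≡ - (b - a)
        lem = solve-∀ ℚ-ring
        lem′ : ∀ b → (b + b) * ι 2 ≡ ι 4 * b
        lem′ = solve-∀ ℚ-ring
        DS-b : ∀ n → 1 ℕ.≤ n → DS n b ≡ ind (n ℕ.≟ 1) * ℓ y + Λ n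
        DS-b n 1≤n = trans (DS-cong {n = n} {g′ = λ d → ℓ y * μ d + (- 1ℚ) * (μ d * ℓ d)} (λ d _ _ → lem₁ (μ d) (ℓ y) (ℓ d)))
          (trans (DS-+ n (λ d → ℓ y * μ d) (λ d → (- 1ℚ) * (μ d * ℓ d)))
            (trans (cong₂ _+_ (trans (DS-*ˡ n (ℓ y) μ) (cong (ℓ y *_) (DS-μ n 1≤n)))
                              (trans (DS-*ˡ n (- 1ℚ) (λ d → μ d * ℓ d)) (cong ((- 1ℚ) *_) (DS-μℓ n 1≤n))))
              (lem₂ (ℓ y) (ind (n ℕ.≟ 1)) (Λ n))))
          where
          lem₁ : ∀ m l l′ → m * (l - l′) ≡ l * m + (- 1ℚ) * (m * l′)
          lem₁ = solve-∀ ℚ-ring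
          lem₂ : ∀ l i m → l * i + (- 1ℚ) * (- m) ≡ i * l + m
          lem₂ = solve-∀ ℚ-ring
        main : ∑ y (λ n → (f n * rec n) * DS n b) ≡ f 1 * ℓ y + ∑ y (λ n → Λ n * (rec n * f n))
        main = trans (∑-cong y (λ n 1≤n _ → trans (cong ((f n * rec n) *_) (DS-b n 1≤n)) (lem₁ (f n) (rec n) (ind (n ℕ.≟ 1)) (ℓ y) (Λ n))))
          (trans (∑-+ y) (cong (_+ ∑ y (λ n → Λ n * (rec n * f n)))
            (trans (∑-single {f = λ n → ind (n ℕ.≟ 1) * ((f n * rec n) * ℓ y)} (s≤s z≤n) 1≤y
              (λ i _ _ i≢1 → trans (cong (_* ((f i * rec i) * ℓ y)) (ind-no (i ℕ.≟ 1) i≢1)) (ℚ.*-zeroˡ ((f i * rec i) * ℓ y))))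
              (trans (cong (λ x → 1ℚ * ((f 1 * x) * ℓ y)) rec-1) (lem₂ (f 1) (ℓ y))))))
          where
          lem₁ : ∀ a r i l m → (a * r) * (i * l + m) ≡ i * ((a * r) * l) + m * (r * a)
          lem₁ = solve-∀ ℚ-ring
          lem₂ : ∀ a l → 1ℚ * ((a * 1ℚ) * l) ≡ a * l
          lem₂ = solve-∀ ℚ-ring

    module Weighted (κ : ℕ → ℚ) (κ≥0 : ∀ a → 0ℚ ≤ κ a) where

      ω : ℕ → ℚ
      ω a = κ a * (Λ a * rec a)

      ω≥0 : ∀ a → 1 ℕ.≤ a → 0ℚ ≤ ω a
      ω≥0 a 1≤a = κ≥0 a ⊗ (Λ≥0 h≥0 a 1≤a ⊗ rec≥0 a)

      module _ {f : ℕ → ℚ} {B : ℚ} (osc : Oscillates f B) (κ-f : ∀ a e → κ a * f (a ℕ.* e) ≡ f (a ℕ.* e)) where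

        private
          κ-L : ∀ t d a → κ a * L f t (a ℕ.* d) ≡ L f t (a ℕ.* d)
          κ-L t d a = trans (sym (∑-*ˡ t (κ a))) (∑-cong′ t (λ e → trans (sym (ℚ.*-assoc (κ a) (f (a ℕ.* d ℕ.* e)) (rec e)))
            (cong (_* rec e) (trans (cong (λ n → κ a * f n) (ℕ.*-assoc a d e)) (trans (κ-f a (d ℕ.* e)) (cong f (sym (ℕ.*-assoc a d e))))))))

        ∑-ω-L : ∀ {y t} d → 1 ℕ.≤ y → y ℕ.≤ t → y ℕ.< X → ∣ ∑ y (λ a → ω a * L f t (a ℕ.* d)) ∣ ≤ ι 64 * B
        ∑-ω-L {y} {t} d 1≤y y≤t y<X = abs-≡ (Sums.∑-Λ-L (λ e → f (d ℕ.* e)) B (oscillates-dilate {f} d osc) {y} {t} 1≤y y≤t y<X)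
          (∑-cong′ y (λ a → trans (lem (κ a) (Λ a) (rec a) (L f t (a ℕ.* d)))
            (cong (λ x → Λ a * (rec a * x)) (trans (κ-L t d a) (sym (L-dilate f d t a))))))
          where
          lem : ∀ k l r x → (k * (l * r)) * x ≡ l * (r * (k * x))
          lem = solve-∀ ℚ-ring

        -- For y fixed and x → ∞ the right-hand side is small against the two terms
        -- on the left: ∑-μ-L writes f(a) ℓ(y) + ∑ Λ(n) f(an)/n as a combination of
        -- the numbers L(ad), and by ∑-ω-L each of these is almost annihilated by the
        -- sum over a.
        two-scales : ∀ {y x} → 1 ℕ.≤ y → y ℕ.≤ x → x ℕ.< X →
          ∣ ℓ y * ∑ x (λ a → ω a * f a) + ∑ x (λ a → ω a * ∑ y (λ n → ω n * f (a ℕ.* n))) ∣ ≤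
          ι 4 * B * ∑ x ω + ι 128 * B * ι y
        two-scales {y} {x} 1≤y y≤x x<X = ≤-trans
          (abs-≡ (abs-+ first second)
            (trans (cong (ℓ y * ∑ x (λ a → ω a * f a) +_) (∑-cong′ x (λ a → cong (ω a *_) (∑-cong′ y (inner a)))))
              (trans (trans (cong (_+ ∑ x (λ a → ω a * P a)) (sym (∑-*ˡ x (ℓ y)))) (sym (∑-+ x)))
                (trans (∑-cong′ x (λ a → lem₁ (ℓ y) (ω a) (f a) (P a) (S a))) (∑-+ x)))))
          ≤-refl
          where
          c : ℕ → ℚ
          c d = μ d * (ℓ y - ℓ d)
          P S : ℕ → ℚ
          P a = ∑ y (λ n → Λ n * (rec n * f (a ℕ.* n)))
          S a = ∑ y (λ d → c d * (rec d * L f x (d ℕ.* a)))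
          lem₁ : ∀ l w f p s → l * (w * f) + w * p ≡ w * ((f * l + p) - s) + w * s
          lem₁ = solve-∀ ℚ-ring
          inner : ∀ a n → ω n * f (a ℕ.* n) ≡ Λ n * (rec n * f (a ℕ.* n))
          inner a n = trans (lem (κ n) (Λ n) (rec n) (f (a ℕ.* n)))
            (cong (λ z → Λ n * (rec n * z)) (trans (cong (λ z → κ n * f z) (ℕ.*-comm a n)) (trans (κ-f n a) (cong f (ℕ.*-comm n a)))))
            where
            lem : ∀ k l r x → (k * (l * r)) * x ≡ l * (r * (k * x))
            lem = solve-∀ ℚ-ring
          first : ∣ ∑ x (λ a → ω a * ((f a * ℓ y + P a) - S a)) ∣ ≤ ι 4 * B * ∑ x ω
          first = ≤-trans (∑-abs x (λ a 1≤a _ → abs-scale (ω≥0 a 1≤a)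
            (abs-≡ (Sums.∑-μ-L (λ e → f (a ℕ.* e)) B (oscillates-dilate {f} a osc) {y} {x} 1≤y y≤x (ℕ.≤-trans y≤x (ℕ.<⇒≤ x<X)))
              (cong₂ (λ u v → (u * ℓ y + P a) - v) (cong f (sym (ℕ.*-identityʳ a)))
                (∑-cong′ y (λ d → cong (λ z → c d * (rec d * z)) (sym (L-dilate f a x d))))))))
            (≤-reflexive (trans (∑-cong′ x (λ a → ℚ.*-comm (ω a) (ι 4 * B))) (∑-*ˡ x (ι 4 * B))))
          second : ∣ ∑ x (λ a → ω a * S a) ∣ ≤ ι 128 * B * ι y
          second = ≤-trans
            (abs-≡ (∑-abs y (λ d 1≤d _ → abs-* (abs-* (abs-* (μ-bound d 1≤d) (≤-refl {∣ ℓ y - ℓ d ∣}))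
                (abs-nonneg (rec≥0 d) (rec≤1 1≤d))) (∑-ω-L {x} {x} d (ℕ.≤-trans 1≤y y≤x) ℕ.≤-refl x<X)))
              (trans (∑-cong′ x (λ a → sym (∑-*ˡ y (ω a)))) (trans (∑-swap x y (λ a d → ω a * (c d * (rec d * L f x (d ℕ.* a)))))
                (∑-cong′ y (λ d → trans (∑-cong′ x (λ a → trans (cong (λ z → ω a * (c d * (rec d * L f x z))) (ℕ.*-comm d a)) (lem (ω a) (c d) (rec d) (L f x (a ℕ.* d)))))
                  (∑-*ˡ x (c d * rec d)))))))
            (≤-trans (≤-reflexive (trans (∑-cong′ y (λ d → lem₂ ∣ ℓ y - ℓ d ∣ B)) (∑-*ˡ y (ι 64 * B))))
              (≤-trans (*-monoˡ-≤ (ι≥0 64 ⊗ Oscillating.B≥0 f B osc) (D≤ y (ℕ.≤-trans y≤x (ℕ.<⇒≤ x<X)))) (≤-reflexive (lem₃ B (ι y)))))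
            where
            lem : ∀ w c r l → w * (c * (r * l)) ≡ (c * r) * (w * l)
            lem = solve-∀ ℚ-ring
            lem₂ : ∀ a b → ((1ℚ * a) * 1ℚ) * (ι 64 * b) ≡ (ι 64 * b) * a
            lem₂ = solve-∀ ℚ-ring
            lem₃ : ∀ b y → (ι 64 * b) * (ι 2 * y) ≡ ι 128 * b * y
            lem₃ = solve-∀ ℚ-ring

  -- Residue classes

  coprime-*ˡ : ∀ {a b m} → Coprime (a ℕ.* b) m → Coprime a m
  coprime-*ˡ {b = b} c (d∣a , d∣m) = c (∣m⇒∣m*n b d∣a , d∣m)

  coprime-*ʳ : ∀ {a b m} → Coprime (a ℕ.* b) m → Coprime b m
  coprime-*ʳ {a} c (d∣b , d∣m) = c (∣n⇒∣m*n a d∣b , d∣m)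

  coprime-* : ∀ {a b m} → Coprime a m → Coprime b m → Coprime (a ℕ.* b) m
  coprime-* {a} {b} ca cb {d} (d∣ab , d∣m) = cb (coprime-divisor {d} {a} {b} (λ { (e∣d , e∣a) → ca (e∣a , ∣-trans e∣d d∣m) }) d∣ab , d∣m)

  module Residues (m : ℕ) (2≤m : 2 ℕ.≤ m) where

    1≤m : 1 ℕ.≤ m
    1≤m = ℕ.<⇒≤ 2≤m

    instance
      m≢0 : NonZero m
      m≢0 = ℕ.>-nonZero 1≤m

    infix 4 _≈_
    _≈_ : ℕ → ℕ → Set
    a ≈ b = a ℕ.% m ≡ b ℕ.% m

    *-≈ : ∀ {a b c d} → a ≈ b → c ≈ d → a ℕ.* c ≈ b ℕ.* d
    *-≈ {a} {b} {c} {d} p q = trans (ℕ.%-distribˡ-* a c m)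
      (trans (cong₂ (λ x y → (x ℕ.* y) ℕ.% m) p q) (sym (ℕ.%-distribˡ-* b d m)))

    ≈-coprime : ∀ {a b} → a ≈ b → Coprime a m → Coprime b m
    ≈-coprime {a} {b} p c {d} (d∣b , d∣m) = c (∣n∣m%n⇒∣m {m = a} d∣m (subst (d ∣_) (sym p) (%-presˡ-∣ {m = b} d∣b d∣m)) , d∣m)

    inverse : ∀ {d} → Coprime d m → ∃[ d′ ] d′ ℕ.* d ≈ 1
    inverse {d} c with coprime-Bézout c
    ... | Bézout.+- x y eq = x , trans (cong (ℕ._% m) (sym eq)) (ℕ.[m+kn]%n≡m%n 1 y m)
    ... | Bézout.-+ x y eq = x ℕ.* d ℕ.* x , trans (sym (ℕ.[m+kn]%n≡m%n (x ℕ.* d ℕ.* x ℕ.* d) y m))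
      (trans (cong (ℕ._% m) calc) (ℕ.[m+kn]%n≡m%n 1 (y ℕ.* (x ℕ.* d)) m))
      where
      calc : x ℕ.* d ℕ.* x ℕ.* d ℕ.+ y ℕ.* m ≡ 1 ℕ.+ y ℕ.* (x ℕ.* d) ℕ.* m
      calc = trans (cong (x ℕ.* d ℕ.* x ℕ.* d ℕ.+_) (sym eq)) (trans (lem₁ x d)
        (cong (1 ℕ.+_) (trans (cong (ℕ._* (x ℕ.* d)) eq) (lem₂ y m (x ℕ.* d)))))
        where
        lem₁ : ∀ x d → x ℕ.* d ℕ.* x ℕ.* d ℕ.+ (1 ℕ.+ x ℕ.* d) ≡ 1 ℕ.+ (1 ℕ.+ x ℕ.* d) ℕ.* (x ℕ.* d)
        lem₁ = solve-∀ℕ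
        lem₂ : ∀ y m z → y ℕ.* m ℕ.* z ≡ y ℕ.* z ℕ.* m
        lem₂ = solve-∀ℕ

    κ : ℕ → ℚ
    κ n = ind (coprime? n m)

    κ≥0 : ∀ n → 0ℚ ≤ κ n
    κ≥0 n = ind≥0 (coprime? n m)

    κ-yes : ∀ {n} → Coprime n m → κ n ≡ 1ℚ
    κ-yes {n} = ind-yes (coprime? n m)

    κ-no : ∀ {n} → ¬ Coprime n m → κ n ≡ 0ℚ
    κ-no {n} = ind-no (coprime? n m)

    κ-≈ : ∀ {a b} → a ≈ b → κ a ≡ κ b
    κ-≈ {a} {b} p = ind-cong (coprime? a m) (coprime? b m) (≈-coprime p) (≈-coprime (sym p))

    coprime-1 : Coprime 1 m
    coprime-1 (d∣1 , _) = ∣1⇒≡1 d∣1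

    κ-1 : κ 1 ≡ 1ℚ
    κ-1 = κ-yes coprime-1

    κ-* : ∀ a b → κ (a ℕ.* b) ≡ κ a * κ b
    κ-* a b with coprime? a m | coprime? b m
    ... | yes ca | yes cb = κ-yes (coprime-* ca cb)
    ... | yes _  | no ¬cb = κ-no (λ c → ¬cb (coprime-*ʳ {a} c))
    ... | no ¬ca | yes _ = κ-no (λ c → ¬ca (coprime-*ˡ c))
    ... | no ¬ca | no _ = κ-no (λ c → ¬ca (coprime-*ˡ c))

    κ-value : ∀ n → κ n ≡ 0ℚ ⊎ κ n ≡ 1ℚ
    κ-value n with coprime? n m
    ... | yes _ = inj₂ refl
    ... | no  _ = inj₁ refl

    κ-cong : ∀ {n a b} → (Coprime n m → a ≡ b) → κ n * a ≡ κ n * b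
    κ-cong {n} {a} {b} h with coprime? n m
    ... | yes c = cong (1ℚ *_) (h c)
    ... | no  _ = trans (ℚ.*-zeroˡ a) (sym (ℚ.*-zeroˡ b))

    κ-mono : ∀ {n a b} → (Coprime n m → a ≤ b) → κ n * a ≤ κ n * b
    κ-mono {n} {a} {b} h with coprime? n m
    ... | yes c = *-monoˡ-≤ 0≤1 (h c)
    ... | no  _ = ≤-reflexive (trans (ℚ.*-zeroˡ a) (sym (ℚ.*-zeroˡ b)))

    κ-abs : ∀ {n a b} → (Coprime n m → ∣ a ∣ ≤ b) → ∣ κ n * a ∣ ≤ κ n * b
    κ-abs {n} {a} {b} h with coprime? n m
    ... | yes c = abs-scale 0≤1 (h c)
    ... | no  _ = ≤-reflexive (trans (cong ∣_∣ (ℚ.*-zeroˡ a)) (sym (ℚ.*-zeroˡ b)))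

    δ : ℕ → ℕ → ℚ
    δ g n = ind (n ℕ.% m ℕ.≟ g ℕ.% m)

    δ≥0 : ∀ g n → 0ℚ ≤ δ g n
    δ≥0 g n = ind≥0 (n ℕ.% m ℕ.≟ g ℕ.% m)

    δ-yes : ∀ {g n} → n ≈ g → δ g n ≡ 1ℚ
    δ-yes {g} {n} = ind-yes (n ℕ.% m ℕ.≟ g ℕ.% m)

    δ-no : ∀ {g n} → ¬ (n ≈ g) → δ g n ≡ 0ℚ
    δ-no {g} {n} = ind-no (n ℕ.% m ℕ.≟ g ℕ.% m)

    δ-cong : ∀ {g n g′ n′} → (n ≈ g → n′ ≈ g′) → (n′ ≈ g′ → n ≈ g) → δ g n ≡ δ g′ n′
    δ-cong {g} {n} {g′} {n′} = ind-cong (n ℕ.% m ℕ.≟ g ℕ.% m) (n′ ℕ.% m ℕ.≟ g′ ℕ.% m)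

    δ-≈ : ∀ {g n g′ n′} → g ≈ g′ → n ≈ n′ → δ g n ≡ δ g′ n′
    δ-≈ p q = δ-cong (λ r → trans (sym q) (trans r p)) (λ r → trans q (trans r (sym p)))

    δ-sym : ∀ g n → δ g n ≡ δ n g
    δ-sym g n = δ-cong {g} {n} {n} {g} sym sym

    δ-dilate : ∀ {d d′} → d′ ℕ.* d ≈ 1 → ∀ g e → δ g (d ℕ.* e) ≡ δ (d′ ℕ.* g) e
    δ-dilate {d} {d′} inv g e = δ-cong {g} {d ℕ.* e} {d′ ℕ.* g} {e}
      (λ p → trans (sym d′de) (*-≈ {d′} {d′} {d ℕ.* e} {g} refl p))
      (λ p → trans (*-≈ {d} {d} {e} {d′ ℕ.* g} refl p) dd′g)
      where
      d′de : d′ ℕ.* (d ℕ.* e) ≈ e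
      d′de = trans (cong (ℕ._% m) (sym (ℕ.*-assoc d′ d e)))
        (trans (*-≈ {d′ ℕ.* d} {1} {e} {e} inv refl) (cong (ℕ._% m) (ℕ.*-identityˡ e)))
      dd′g : d ℕ.* (d′ ℕ.* g) ≈ g
      dd′g = trans (cong (ℕ._% m) (trans (sym (ℕ.*-assoc d d′ g)) (cong (ℕ._* g) (ℕ.*-comm d d′))))
        (trans (*-≈ {d′ ℕ.* d} {1} {g} {g} inv refl) (cong (ℕ._% m) (ℕ.*-identityˡ g)))

    -- Sums over classes run from 1 to m, so the class of 0 is represented by m.
    representative : ∀ a → ∃[ r ] (1 ℕ.≤ r × r ℕ.≤ m × a ≈ r × (∀ i → 1 ℕ.≤ i → i ℕ.≤ m → a ≈ i → i ≡ r))
    representative a with a ℕ.% m in eq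
    ... | zero = m , 1≤m , ℕ.≤-refl , sym (ℕ.n%n≡0 m) , uniq
      where
      uniq : ∀ i → 1 ℕ.≤ i → i ℕ.≤ m → 0 ≡ i ℕ.% m → i ≡ m
      uniq i 1≤i i≤m e with ℕ.m≤n⇒m<n∨m≡n i≤m
      ... | inj₂ i≡m = i≡m
      ... | inj₁ i<m = ⊥-elim (ℕ.<-irrefl (trans e (ℕ.m<n⇒m%n≡m i<m)) 1≤i)
    ... | suc r = suc r , s≤s z≤n , ℕ.<⇒≤ r<m , sym (ℕ.m<n⇒m%n≡m r<m) , uniq
      where
      r<m : suc r ℕ.< m
      r<m = subst (ℕ._< m) eq (ℕ.m%n<n a m)
      uniq : ∀ i → 1 ℕ.≤ i → i ℕ.≤ m → suc r ≡ i ℕ.% m → i ≡ suc r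
      uniq i 1≤i i≤m e with ℕ.m≤n⇒m<n∨m≡n i≤m
      ... | inj₂ refl = ⊥-elim (ℕ.1+n≢0 (trans e (ℕ.n%n≡0 m)))
      ... | inj₁ i<m = sym (trans e (ℕ.m<n⇒m%n≡m i<m))

    ClassFunction : (ℕ → ℚ) → Set
    ClassFunction F = ∀ {a b} → a ≈ b → F a ≡ F b

    ∑-δ : ∀ {F} → ClassFunction F → ∀ a → ∑ m (λ g → δ g a * F g) ≡ F a
    ∑-δ {F} cF a with representative a
    ... | r , 1≤r , r≤m , a≈r , uniq = trans
      (∑-single {f = λ g → δ g a * F g} 1≤r r≤m (λ i 1≤i i≤m i≢r → trans (cong (_* F i) (δ-no {i} {a} (λ p → i≢r (uniq i 1≤i i≤m p)))) (ℚ.*-zeroˡ (F i))))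
      (trans (cong (_* F r) (δ-yes {r} {a} a≈r)) (trans (ℚ.*-identityˡ (F r)) (cF (sym a≈r))))

    ∑-κδ : ∀ a → ∑ m (λ g → κ g * δ g a) ≡ κ a
    ∑-κδ a = trans (∑-cong′ m (λ g → ℚ.*-comm (κ g) (δ g a))) (∑-δ κ-≈ a)

    ∑-dilate : ∀ {F k} → ClassFunction F → Coprime k m → ∑ m (λ h → κ h * F (k ℕ.* h)) ≡ ∑ m (λ h → κ h * F h)
    ∑-dilate {F} {k} cF ck with inverse ck
    ... | k′ , inv = trans (∑-cong′ m (λ h → trans (cong (κ h *_) (sym (∑-δ cF (k ℕ.* h)))) (sym (∑-*ˡ m (κ h)))))
      (trans (∑-swap m m (λ h g → κ h * (δ g (k ℕ.* h) * F g))) (∑-cong′ m inner))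
      where
      lem : ∀ a b c → a * (b * c) ≡ c * (a * b)
      lem = solve-∀ ℚ-ring
      κk′ : κ k′ ≡ 1ℚ
      κk′ = κ-yes (coprime-*ˡ {k′} {k} (≈-coprime {1} {k′ ℕ.* k} (sym inv) coprime-1))
      inner : ∀ g → ∑ m (λ h → κ h * (δ g (k ℕ.* h) * F g)) ≡ κ g * F g
      inner g = trans (∑-cong′ m (λ h → trans (lem (κ h) (δ g (k ℕ.* h)) (F g))
          (cong (λ z → F g * (κ h * z)) (trans (δ-dilate {k} {k′} inv g h) (δ-sym (k′ ℕ.* g) h)))))
        (trans (∑-*ˡ m (F g)) (trans (cong (F g *_) (trans (∑-κδ (k′ ℕ.* g)) (trans (κ-* k′ g) (trans (cong (_* κ g) κk′) (ℚ.*-identityˡ (κ g)))))) (ℚ.*-comm (F g) (κ g))))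

    private
      ∑-block : ∀ g → ∑ m (δ g) ≡ 1ℚ
      ∑-block g = trans (∑-cong′ m (λ e → trans (δ-sym g e) (sym (ℚ.*-identityʳ (δ e g))))) (∑-δ {λ _ → 1ℚ} (λ _ → refl) g)

      δ-shift : ∀ g q i → δ g (i ℕ.+ q ℕ.* m) ≡ δ g i
      δ-shift g q i = δ-≈ {g} {i ℕ.+ q ℕ.* m} {g} {i} refl (ℕ.[m+kn]%n≡m%n i q m)

      ∑-blocks : ∀ g q → ∑ (q ℕ.* m) (δ g) ≡ ι q
      ∑-blocks g zero    = refl
      ∑-blocks g (suc q) = trans (∑-split (q ℕ.* m) m) (trans (cong₂ _+_ (∑-blocks g q)
        (trans (∑-cong′ m (δ-shift g q)) (∑-block g))) (ℚ.+-comm (ι q) 1ℚ))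

    ∑-δ-≈ : ∀ g n → ∣ ∑ n (δ g) - ι n * rec m ∣ ≤ 1ℚ
    ∑-δ-≈ g n = abs-≡ (abs-intro (≤-by (diff c≤1 ⊕ (ι≥0 s ⊗ rec≥0 m)) (lem₁ c (ι s * rec m)))
        (≤-by (diff s≤1 ⊕ c≥0) (lem₂ c (ι s * rec m))))
      (trans (cong₂ (λ x y → x - ι y * rec m) (trans (cong (λ k → ∑ k (δ g)) n≡) (trans (∑-split (q ℕ.* m) s)
          (cong₂ _+_ (∑-blocks g q) (∑-cong′ s (δ-shift g q))))) n≡)
        (trans (cong (λ x → (ι q + c) - x * rec m) (trans (ι-+ s (q ℕ.* m)) (cong (ι s +_) (ι-* q m))))
          (trans (lem₃ (ι q) c (ι s) (ι m) (rec m)) (trans (cong (λ x → c - ι s * rec m + ι q * (1ℚ - x)) (ι*rec 1≤m)) (lem₄ (c - ι s * rec m) (ι q))))))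
      where
      q = n ℕ./ m
      s = n ℕ.% m
      n≡ : n ≡ s ℕ.+ q ℕ.* m
      n≡ = ℕ.m≡m%n+[m/n]*n n m
      c : ℚ
      c = ∑ s (δ g)
      c≥0 : 0ℚ ≤ c
      c≥0 = ∑-≥0 s (λ i _ _ → δ≥0 g i)
      c≤1 : c ≤ 1ℚ
      c≤1 = ≤-trans (∑-range-mono {f = δ g} (ℕ.<⇒≤ (ℕ.m%n<n n m)) (λ i _ _ → δ≥0 g i)) (≤-reflexive (∑-block g))
      s≤1 : ι s * rec m ≤ 1ℚ
      s≤1 = ≤-trans (*-monoʳ-≤ (rec≥0 m) (ι-mono (ℕ.<⇒≤ (ℕ.m%n<n n m)))) (ι*rec≤ m)
      lem₁ : ∀ c x → 1ℚ - (c - x) ≡ (1ℚ - c) + x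
      lem₁ = solve-∀ ℚ-ring
      lem₂ : ∀ c x → 1ℚ - (- (c - x)) ≡ (1ℚ - x) + c
      lem₂ = solve-∀ ℚ-ring
      lem₃ : ∀ q c s m r → (q + c) - (s + q * m) * r ≡ c - s * r + q * (1ℚ - m * r)
      lem₃ = solve-∀ ℚ-ring
      lem₄ : ∀ a q → a + q * (1ℚ - 1ℚ) ≡ a
      lem₄ = solve-∀ ℚ-ring

    -- A multiple of a non-unit never lies in a unit class. This provides the hypothesis `κ-f` of
    -- the weighted sums.
    κ-δ : ∀ {g} → Coprime g m → ∀ a e → κ a * δ g (a ℕ.* e) ≡ δ g (a ℕ.* e)
    κ-δ {g} cg a e with coprime? a m
    ... | yes _ = ℚ.*-identityˡ (δ g (a ℕ.* e))
    ... | no ¬ca = trans (ℚ.*-zeroˡ (δ g (a ℕ.* e))) (sym (δ-no {g} {a ℕ.* e} (λ p → ¬ca (coprime-*ˡ (≈-coprime (sym p) cg)))))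

    -- If d is a unit, dilation by d permutes the classes, and two classes have the same number of
    -- elements up to n within 1 each of n / m. If d is not a unit, its multiples miss both classes.
    δ-oscillates : ∀ {g g′} → Coprime g m → Coprime g′ m → Oscillates (λ n → δ g n - δ g′ n) (ι 2)
    δ-oscillates {g} {g′} cg cg′ d n with coprime? d m
    ... | no ¬cd = abs-≡ (abs-nonneg ≤-refl (ι≥0 2)) (∑-zero n (λ e _ _ → cong₂ _-_ (zero-at cg e) (zero-at cg′ e)))
      where
      zero-at : ∀ {g} → Coprime g m → ∀ e → δ g (d ℕ.* e) ≡ 0ℚ
      zero-at {g} cg e = δ-no {g} {d ℕ.* e} (λ p → ¬cd (coprime-*ˡ (≈-coprime (sym p) cg)))
    ... | yes cd with inverse cd
    ... | d′ , inv = ≤-trans (abs-≡ (abs-- (∑-δ-≈ (d′ ℕ.* g) n) (∑-δ-≈ (d′ ℕ.* g′) n))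
        (trans (∑-cong′ n (λ e → cong₂ _-_ (δ-dilate {d} {d′} inv g e) (δ-dilate {d} {d′} inv g′ e)))
          (trans (∑-- n) (lem (∑ n (δ (d′ ℕ.* g))) (∑ n (δ (d′ ℕ.* g′))) (ι n * rec m)))))
      ≤-refl
      where
      lem : ∀ a b c → a - b ≡ (a - c) - (b - c)
      lem = solve-∀ ℚ-ring

    φ : ℚ
    φ = ∑ m κ

    φ≤m : φ ≤ ι m
    φ≤m = ≤-trans (∑-mono m (λ i _ _ → ind≤1 (coprime? i m))) (≤-reflexive (trans (∑-const m 1ℚ) (ℚ.*-identityʳ (ι m))))

    1≤φ : 1ℚ ≤ φ
    1≤φ = ≤-trans (≤-reflexive (sym κ-1)) (∑-term {f = κ} (s≤s z≤n) 1≤m (λ i _ _ → κ≥0 i))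

    φ≥0 : 0ℚ ≤ φ
    φ≥0 = ≤-trans 0≤1 1≤φ

    ∑-class : ∀ {F c} → ClassFunction F → (∀ n → ∣ F n ∣ ≤ c) → ∀ n →
      ∣ ∑ n (λ e → κ e * F e) - ι n * rec m * ∑ m (λ g → κ g * F g) ∣ ≤ ι m * c
    ∑-class {F} {c} cF bF n = ≤-trans
      (abs-≡ (∑-bound m {f = λ g → κ g * F g * (∑ n (δ g) - ι n * rec m)} (λ g _ _ →
         abs-* (abs-* (abs-nonneg (κ≥0 g) (ind≤1 (coprime? g m))) (bF g)) (∑-δ-≈ g n)))
        (trans (cong (_- ι n * rec m * ∑ m (λ g → κ g * F g)) expand)
          (trans (cong (∑ m (λ g → κ g * F g * ∑ n (δ g)) +_) (cong -_ (sym (∑-*ˡ m (ι n * rec m)))))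
            (trans (sym (∑-- m)) (∑-cong′ m (λ g → lem (κ g * F g) (∑ n (δ g)) (ι n * rec m)))))))
      (≤-reflexive (cong (ι m *_) (lem′ c)))
      where
      lem : ∀ a b c → a * b - c * a ≡ a * (b - c)
      lem = solve-∀ ℚ-ring
      lem′ : ∀ c → 1ℚ * c * 1ℚ ≡ c
      lem′ = solve-∀ ℚ-ring
      expand : ∑ n (λ e → κ e * F e) ≡ ∑ m (λ g → κ g * F g * ∑ n (δ g))
      expand = trans (∑-cong′ n (λ e → sym (∑-δ {λ g → κ g * F g} (λ p → cong₂ _*_ (κ-≈ p) (cF p)) e)))
        (trans (∑-swap n m (λ e g → δ g e * (κ g * F g)))
          (∑-cong′ m (λ g → trans (∑-*ʳ n (κ g * F g)) (ℚ.*-comm (∑ n (δ g)) (κ g * F g)))))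

  -- Mertens' estimate

  quo-≈ : ∀ y {d} → 1 ℕ.≤ d → ∣ ι (quo y d) - rec d * ι y ∣ ≤ 1ℚ
  quo-≈ y {d} 1≤d = abs-intro
    (≤-by (diff (≤-rec {d} {ι (quo y d)} {ι y} 1≤d (≤-trans (≤-reflexive (sym (ι-* d (quo y d)))) (ι-mono (quo-lower y d)))) ⊕ 0≤1)
      (lem₁ (ι (quo y d)) (rec d * ι y)))
    (≤-by (diff (rec-≤ {d} {ι y} {ι (suc (quo y d))} 1≤d (≤-trans (ι-mono (ℕ.<⇒≤ (quo-upper y 1≤d))) (≤-reflexive (ι-* d (suc (quo y d)))))))
      (lem₂ (ι (quo y d)) (rec d * ι y)))
    where
    lem₁ : ∀ a b → 1ℚ - (a - b) ≡ (b - a) + 1ℚ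
    lem₁ = solve-∀ ℚ-ring
    lem₂ : ∀ a b → 1ℚ - (- (a - b)) ≡ (1ℚ + a) - b
    lem₂ = solve-∀ ℚ-ring

  module PrimesInClasses (m : ℕ) (2≤m : 2 ℕ.≤ m)
    (X : ℕ) (h : ℕ → ℚ) (h≥0 : ∀ n → 1 ℕ.≤ n → 0ℚ ≤ h n) (h-2≤1 : h 2 ≤ 1ℚ)
    (ℓ-suc : ∀ n → 1 ℕ.≤ n → n ℕ.< X → ∣ Mangoldt.ℓ h (suc n) - Mangoldt.ℓ h n ∣ ≤ rec n + rec n) where

    open Mangoldt h
    open Estimates X h h≥0 h-2≤1 ℓ-suc
    open Residues m 2≤m
    open OscillatingΛ X h h≥0 h-2≤1 ℓ-suc
    open Weighted κ κ≥0

    W : ℕ → ℚ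
    W y = ∑ y ω

    private
      κ-count : ∀ n → ∣ ∑ n κ - ι n * rec m * φ ∣ ≤ ι m
      κ-count n = ≤-trans (abs-≡ (∑-class {λ _ → 1ℚ} (λ _ → refl) (λ _ → ≤-refl) n)
        (cong₂ (λ a b → a - ι n * rec m * b) (∑-cong′ n (λ e → sym (ℚ.*-identityʳ (κ e)))) (∑-cong′ m (λ e → sym (ℚ.*-identityʳ (κ e))))))
        (≤-reflexive (ℚ.*-identityʳ (ι m)))

      φ/m≤1 : rec m * φ ≤ 1ℚ
      φ/m≤1 = rec-≤ 1≤m (≤-trans φ≤m (≤-reflexive (sym (ℚ.*-identityʳ (ι m)))))

      φ/m≥0 : 0ℚ ≤ rec m * φ
      φ/m≥0 = rec≥0 m ⊗ φ≥0

      1≤ιm : 1ℚ ≤ ι m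
      1≤ιm = 1≤ι 1≤m

      κ-count-quo : ∀ y d → 1 ℕ.≤ d → ∣ ∑ (quo y d) κ - rec d * ι y * (rec m * φ) ∣ ≤ ι m + 1ℚ
      κ-count-quo y d 1≤d = ≤-trans
        (abs-≡ (abs-+ (κ-count (quo y d)) (abs-* (quo-≈ y 1≤d) (abs-nonneg φ/m≥0 φ/m≤1)))
          (lem (∑ (quo y d) κ) (ι (quo y d)) (rec m) φ (rec d * ι y)))
        (≤-reflexive (lem′ (ι m)))
        where
        lem : ∀ s q r f y → s - y * (r * f) ≡ (s - q * r * f) + (q - y) * (r * f)
        lem = solve-∀ ℚ-ring
        lem′ : ∀ x → x + 1ℚ * 1ℚ ≡ x + 1ℚ
        lem′ = solve-∀ ℚ-ring

      ∑κℓ : ∀ y → ∑ y (λ n → κ n * ℓ n) ≡ ∑ y (λ d → Λ d * (κ d * ∑ (quo y d) κ))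
      ∑κℓ y = trans (∑-cong y (λ n 1≤n _ → cong (κ n *_) (sym (DS-Λ n 1≤n))))
        (trans (hyperbola y κ Λ) (∑-cong′ y (λ d → cong (Λ d *_)
          (trans (∑-cong′ (quo y d) (λ e → κ-* d e)) (∑-*ˡ (quo y d) (κ d))))))

      right : ∀ y → y ℕ.< X → ∣ ∑ y (λ n → κ n * ℓ n) - ι y * (rec m * φ) * W y ∣ ≤ (ι m + 1ℚ) * (ι 30 * ι y)
      right y y<X = ≤-trans
        (abs-≡ (∑-abs y (λ d 1≤d _ → abs-* (abs-nonneg (Λ≥0 h≥0 d 1≤d) ≤-refl) (abs-* (abs-nonneg (κ≥0 d) (ind≤1 (coprime? d m))) (κ-count-quo y d 1≤d))))
          (trans (cong₂ _-_ (∑κℓ y) (sym (∑-*ˡ y (ι y * (rec m * φ)))))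
            (trans (sym (∑-- y)) (∑-cong′ y (λ d → lem (Λ d) (κ d) (∑ (quo y d) κ) (ι y) (rec m * φ) (rec d))))))
        (≤-trans (≤-reflexive (trans (∑-cong′ y (λ d → lem′ (Λ d) (ι m + 1ℚ))) (∑-*ˡ y (ι m + 1ℚ)))) (*-monoˡ-≤ (ι≥0 m ⊕ 0≤1) (ψ≤ y y<X)))
        where
        lem : ∀ l k s y f r → l * (k * s) - y * f * (k * (l * r)) ≡ l * (k * (s - r * y * f))
        lem = solve-∀ ℚ-ring
        lem′ : ∀ l c → l * (1ℚ * c) ≡ c * l
        lem′ = solve-∀ ℚ-ring

      left : ∀ y → 1 ℕ.≤ y → y ℕ.≤ X → ∣ ∑ y (λ n → κ n * ℓ n) - ι y * (rec m * φ) * ℓ y ∣ ≤ ι 2 * ι y + ι m * (ι 2 * ι y)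
      left y 1≤y y≤X = ≤-trans
        (abs-≡ (abs-+ (abs-neg (≤-trans (∑-abs y (λ d _ _ → abs-* (abs-nonneg (κ≥0 d) (ind≤1 (coprime? d m))) (≤-refl {∣ ℓ y - ℓ d ∣})))
              (≤-trans (≤-reflexive (∑-cong′ y (λ d → ℚ.*-identityˡ ∣ ℓ y - ℓ d ∣))) (D≤ y y≤X))))
            (abs-* (κ-count y) (abs-nonneg (ℓ≥0 h≥0 y 1≤y) (ℓ≤ y 1≤y y≤X))))
          (trans (lem (∑ y (λ n → κ n * ℓ n)) (ι y) (rec m) φ (ℓ y) (∑ y κ))
            (cong (λ z → - z + (∑ y κ - ι y * rec m * φ) * ℓ y) (trans (cong (_- ∑ y (λ n → κ n * ℓ n)) (sym (∑-*ʳ y (ℓ y)))) (trans (sym (∑-- y)) (∑-cong′ y (λ d → lem′ (κ d) (ℓ y) (ℓ d))))))))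
        ≤-refl
        where
        lem : ∀ a y r f l s → a - y * (r * f) * l ≡ - (s * l - a) + (s - y * r * f) * l
        lem = solve-∀ ℚ-ring
        lem′ : ∀ k l l′ → k * l - k * l′ ≡ k * (l - l′)
        lem′ = solve-∀ ℚ-ring

    -- The sum of κ n ℓ n up to y is evaluated twice: directly as y (φ / m) ℓ y, and through ℓ = ∑ Λ
    -- as y (φ / m) W y. The errors (2 + 2 m) y and 30 (m + 1) y are at most 64 m y together;
    -- multiplying by m / y and dropping φ ≥ 1 leaves 64 m².
    mertens : ∀ y → 1 ℕ.≤ y → y ℕ.< X → ∣ W y - ℓ y ∣ ≤ ι 64 * (ι m * ι m)
    mertens y 1≤y y<X = ≤-trans (≤-trans (≤-reflexive (sym (ℚ.*-identityˡ ∣ W y - ℓ y ∣))) (*-monoʳ-≤ (ℚ.0≤∣p∣ (W y - ℓ y)) 1≤φ))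
      (≤-trans (≤-reflexive (trans (cong (_* ∣ W y - ℓ y ∣) (sym (ℚ.0≤p⇒∣p∣≡p φ≥0))) (sym (ℚ.∣p*q∣≡∣p∣*∣q∣ φ (W y - ℓ y))))) main)
      where
      bounds : ∣ ι y * (rec m * φ) * W y - ι y * (rec m * φ) * ℓ y ∣ ≤ ι y * (ι 64 * ι m)
      bounds = ≤-trans (abs-≡ (abs-- (left y 1≤y (ℕ.<⇒≤ y<X)) (right y y<X)) (lem (∑ y (λ n → κ n * ℓ n)) (ι y * (rec m * φ) * W y) (ι y * (rec m * φ) * ℓ y)))
        (≤-by (ι≥0 32 ⊗ ι≥0 y ⊗ diff 1≤ιm) (lem′ (ι y) (ι m)))
        where
        lem : ∀ a b c → b - c ≡ (a - c) - (a - b)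
        lem = solve-∀ ℚ-ring
        lem′ : ∀ y m → y * (ι 64 * m) - ((ι 2 * y + m * (ι 2 * y)) + (m + 1ℚ) * (ι 30 * y)) ≡ ι 32 * (y * (m - 1ℚ))
        lem′ = solve-∀ ℚ-ring
      main : ∣ φ * (W y - ℓ y) ∣ ≤ ι 64 * (ι m * ι m)
      main = ≤-trans (abs-≡ (abs-scale (ι≥0 m ⊗ rec≥0 y) bounds)
          (trans (sym (lem₀ φ (W y - ℓ y))) (trans (cong₂ (λ a b → a * b * (φ * (W y - ℓ y))) (sym (ι*rec 1≤y)) (sym (ι*rec 1≤m))) (lem (ι y) (rec y) (ι m) (rec m) φ (W y) (ℓ y)))))
        (≤-reflexive (trans (lem′ (ι y) (rec y) (ι m)) (trans (cong (_* (ι 64 * (ι m * ι m))) (ι*rec 1≤y)) (ℚ.*-identityˡ (ι 64 * (ι m * ι m))))))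
        where
        lem₀ : ∀ a b → 1ℚ * 1ℚ * (a * b) ≡ a * b
        lem₀ = solve-∀ ℚ-ring
        lem : ∀ y s m r f w l → (y * s) * (m * r) * (f * (w - l)) ≡ m * s * (y * (r * f) * w - y * (r * f) * l)
        lem = solve-∀ ℚ-ring
        lem′ : ∀ y s m → m * s * (y * (ι 64 * m)) ≡ (y * s) * (ι 64 * (m * m))
        lem′ = solve-∀ ℚ-ring

    private
      ∑-initial : ∀ x N → ∑ x (λ a → ind (a ℕ.<? N)) ≤ ι N
      ∑-initial zero    N = ι≥0 N
      ∑-initial (suc x) N with suc x ℕ.<? N
      ... | yes x<N = ≤-trans (ℚ.+-monoˡ-≤ 1ℚ (≤-trans (∑-mono x (λ a _ _ → ind≤1 (a ℕ.<? N))) (≤-reflexive (trans (∑-const x 1ℚ) (ℚ.*-identityʳ (ι x))))))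
        (≤-trans (≤-reflexive (ℚ.+-comm (ι x) 1ℚ)) (ι-mono (ℕ.<⇒≤ x<N)))
      ... | no _ = ≤-trans (≤-reflexive (ℚ.+-identityʳ _)) (∑-initial x N)

      rec-pred : ∀ i n → 1 ℕ.≤ i → 1 ℕ.≤ n → rec (suc i ℕ.* n) ≡ rec i * rec n - rec i * rec (suc i ℕ.* n)
      rec-pred i n 1≤i 1≤n = trans (rec-* {suc i} {n} (s≤s z≤n) 1≤n)
        (trans (lem₀ (rec (suc i)) (rec n)) (trans (cong (_* (rec (suc i) * rec n)) (sym (ι*rec 1≤i)))
          (trans (lem (ι i) (rec i) (rec (suc i)) (rec n))
            (cong₂ (λ a b → rec i * (a * rec n) - rec i * b) (ι*rec′ i) (sym (rec-* {suc i} {n} (s≤s z≤n) 1≤n)) ⟫ cong (λ z → rec i * z - rec i * rec (suc i ℕ.* n)) (ℚ.*-identityˡ (rec n))))))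
        where
        infixr 5 _⟫_
        _⟫_ : ∀ {a b c : ℚ} → a ≡ b → b ≡ c → a ≡ c
        _⟫_ = trans
        lem₀ : ∀ a b → a * b ≡ 1ℚ * (a * b)
        lem₀ = solve-∀ ℚ-ring
        lem : ∀ i r s n → (i * r) * (s * n) ≡ r * (((1ℚ + i) * s) * n) - r * (s * n)
        lem = solve-∀ ℚ-ring

      1≤^ : ∀ i k → 1 ℕ.≤ suc i ℕ.^ k
      1≤^ i zero    = ℕ.≤-refl
      1≤^ i (suc k) = ℕ.*-mono-≤ {1} {suc i} (s≤s z≤n) (1≤^ i k)

      k<^ : ∀ i k → 1 ℕ.≤ i → k ℕ.< suc i ℕ.^ k
      k<^ i zero    _   = s≤s z≤n
      k<^ i (suc k) 1≤i = ℕ.≤-<-trans (k<^ i k 1≤i) (n<p*n (s≤s 1≤i) (1≤^ i k))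

      geometric : ∀ i K → 1 ℕ.≤ i → ∑ K (λ k → rec (suc i ℕ.^ suc k)) ≡ rec i * rec (suc i) - rec i * rec (suc i ℕ.^ suc K)
      geometric i zero    1≤i = sym (trans (cong (λ n → rec i * rec (suc i) - rec i * rec n) (ℕ.*-identityʳ (suc i))) (≡⇒diff0 {rec i * rec (suc i)} refl))
      geometric i (suc K) 1≤i = trans (cong₂ _+_ (geometric i K 1≤i) (rec-pred i (suc i ℕ.^ suc K) 1≤i (1≤^ i (suc K))))
        (lem (rec i * rec (suc i)) (rec i * rec (suc i ℕ.^ suc K)) (rec i * rec (suc i ℕ.^ suc (suc K))))
        where
        lem : ∀ a b c → (a - b) + (b - c) ≡ a - c
        lem = solve-∀ ℚ-ring

      -- The bound telescopes: ℓ(n)/(n(n-1)) ≤ (ℓ(n-1)+4)/(n-1) - (ℓ(n)+4)/n.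
      ∑-ℓ-rec² : ∀ x → x ℕ.< X → ∑ x (λ i → ℓ (suc i) * (rec i * rec (suc i))) ≤ ι 4 - (ℓ (suc x) + ι 4) * rec (suc x)
      ∑-ℓ-rec² zero    _ = ≤-reflexive (sym (trans (cong₂ (λ a b → ι 4 - (a + ι 4) * b) ℓ-1 rec-1) refl))
      ∑-ℓ-rec² (suc n) n<X = ≤-trans (ℚ.+-mono-≤ (∑-ℓ-rec² n (ℕ.<⇒≤ n<X)) step)
        (≤-reflexive (lem (ι 4) ((ℓ (suc n) + ι 4) * rec (suc n)) ((ℓ (suc (suc n)) + ι 4) * rec (suc (suc n)))))
        where
        lem : ∀ a b c → (a - b) + (b - c) ≡ a - c
        lem = solve-∀ ℚ-ring
        i = suc n
        a b r s l l′ : ℚ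
        a = ι i
        r = rec i
        s = rec (suc i)
        l = ℓ i
        l′ = ℓ (suc i)
        a*r : a * r ≡ 1ℚ
        a*r = ι*rec′ n
        b = 1ℚ + a
        b*s : b * s ≡ 1ℚ
        b*s = ι*rec′ i
        key : b * (l′ - l) ≤ ι 4
        key = ≤-trans (*-monoˡ-≤ (0≤1 ⊕ ι≥0 i) (≤-trans (≤-abs (l′ - l)) (ℓ-suc i (s≤s z≤n) n<X)))
          (≤-trans (≤-reflexive (trans (lem₁ a r) (cong (λ z → (1ℚ + 1ℚ) * r + z + z) a*r))) (≤-by ((ι≥0 2) ⊗ diff (rec≤1 {i} (s≤s z≤n))) (lem₂ r)))
          where
          lem₁ : ∀ a r → (1ℚ + a) * (r + r) ≡ (1ℚ + 1ℚ) * r + a * r + a * r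
          lem₁ = solve-∀ ℚ-ring
          lem₂ : ∀ r → ι 4 - ((1ℚ + 1ℚ) * r + 1ℚ + 1ℚ) ≡ ι 2 * (1ℚ - r)
          lem₂ = solve-∀ ℚ-ring
        step : l′ * (r * s) ≤ (l + ι 4) * r - (l′ + ι 4) * s
        step = ≤-by ((rec≥0 i ⊗ rec≥0 (suc i)) ⊗ diff key)
          (trans (trans (sym (lem₃ ((l + ι 4) * r) ((l′ + ι 4) * s) (l′ * (r * s))))
              (cong₂ (λ u v → (l + ι 4) * r * u - (l′ + ι 4) * s * v - l′ * (r * s)) (sym b*s) (sym a*r))) (lem₄ l l′ a r s))
          where
          lem₃ : ∀ u v w → u * 1ℚ - v * 1ℚ - w ≡ u - v - w
          lem₃ = solve-∀ ℚ-ring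
          lem₄ : ∀ l l′ a r s → (l + ι 4) * r * ((1ℚ + a) * s) - (l′ + ι 4) * s * (a * r) - l′ * (r * s) ≡ (r * s) * (ι 4 - (1ℚ + a) * (l′ - l))
          lem₄ = solve-∀ ℚ-ring

      -- The total of ℓ(p) over the representations a = p ^ j, where p = i + 1 and
      -- j = k + 1 ≥ 2.
      powers : ℕ → ℕ → ℚ
      powers x a = ∑ x (λ i → ∑ x (λ k → ind (a ℕ.≟ suc i ℕ.^ suc k) * ℓ (suc i)))

      powers-inner≥0 : ∀ x a i → 0ℚ ≤ ∑ x (λ k → ind (a ℕ.≟ suc i ℕ.^ suc k) * ℓ (suc i))
      powers-inner≥0 x a i = ∑-≥0 x (λ k _ _ → ind≥0 (a ℕ.≟ suc i ℕ.^ suc k) ⊗ ℓ≥0 h≥0 (suc i) (s≤s z≤n))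

      ∑-powers : ∀ x → x ℕ.< X → ∑ x (λ a → powers x a * rec a) ≤ ι 4
      ∑-powers x x<X = ≤-trans
        (≤-reflexive (trans (∑-cong′ x (λ a → trans (sym (∑-*ʳ x (rec a))) (∑-cong′ x (λ i → sym (∑-*ʳ x (rec a))))))
          (trans (∑-swap x x (λ a i → ∑ x (λ k → ind (a ℕ.≟ suc i ℕ.^ suc k) * ℓ (suc i) * rec a)))
            (∑-cong′ x (λ i → ∑-swap x x (λ a k → ind (a ℕ.≟ suc i ℕ.^ suc k) * ℓ (suc i) * rec a))))))
        (≤-trans (∑-mono x (λ i 1≤i _ → ≤-trans (∑-mono x (λ k _ _ → one-power i k))
            (≤-trans (≤-reflexive (trans (∑-*ˡ x (ℓ (suc i))) (cong (ℓ (suc i) *_) (geometric i x 1≤i))))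
              (*-monoˡ-≤ (ℓ≥0 h≥0 (suc i) (s≤s z≤n)) (≤-by (rec≥0 i ⊗ rec≥0 (suc i ℕ.^ suc x)) (lem (rec i * rec (suc i)) (rec i * rec (suc i ℕ.^ suc x))))))))
          (≤-trans (∑-ℓ-rec² x x<X) (≤-by ((ℓ≥0 h≥0 (suc x) (s≤s z≤n) ⊕ ι≥0 4) ⊗ rec≥0 (suc x)) (lem (ι 4) ((ℓ (suc x) + ι 4) * rec (suc x))))))
        where
        lem : ∀ a b → a - (a - b) ≡ b
        lem = solve-∀ ℚ-ring
        one-power : ∀ i k → ∑ x (λ a → ind (a ℕ.≟ suc i ℕ.^ suc k) * ℓ (suc i) * rec a) ≤ ℓ (suc i) * rec (suc i ℕ.^ suc k)
        one-power i k with suc i ℕ.^ suc k ℕ.≤? x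
        ... | yes le = ≤-reflexive (trans (∑-single {f = λ a → ind (a ℕ.≟ suc i ℕ.^ suc k) * ℓ (suc i) * rec a} (1≤^ i (suc k)) le
            (λ a _ _ ne → trans (cong (λ z → z * ℓ (suc i) * rec a) (ind-no (a ℕ.≟ suc i ℕ.^ suc k) ne)) (lem₀ (ℓ (suc i)) (rec a))))
            (trans (cong (λ z → z * ℓ (suc i) * rec (suc i ℕ.^ suc k)) (ind-yes (suc i ℕ.^ suc k ℕ.≟ suc i ℕ.^ suc k) refl)) (cong (_* rec (suc i ℕ.^ suc k)) (ℚ.*-identityˡ (ℓ (suc i))))))
          where
          lem₀ : ∀ a b → 0ℚ * a * b ≡ 0ℚ
          lem₀ = solve-∀ ℚ-ring
        ... | no ¬le = ≤-trans (≤-reflexive (∑-zero x (λ a _ a≤x → trans (cong (λ z → z * ℓ (suc i) * rec a) (ind-no (a ℕ.≟ suc i ℕ.^ suc k) (λ { refl → ¬le a≤x }))) (lem₀ (ℓ (suc i)) (rec a)))))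
          (ℓ≥0 h≥0 (suc i) (s≤s z≤n) ⊗ rec≥0 (suc i ℕ.^ suc k))
          where
          lem₀ : ∀ a b → 0ℚ * a * b ≡ 0ℚ
          lem₀ = solve-∀ ℚ-ring

    -- Primes of the class lie below N and contribute at most 2 each, as ℓ a ≤ 2 a. The proper prime
    -- powers contribute at most 4 altogether, whatever their class.
    class-bounded : ∀ {α N x} → x ℕ.< X → (∀ p → Prime p → p ≈ α → p ℕ.< N) → ∑ x (λ a → ω a * δ α a) ≤ ι 2 * ι N + ι 4
    class-bounded {α} {N} {x} x<X few = ≤-trans (∑-mono x term)
      (≤-trans (≤-reflexive (∑-+ x)) (ℚ.+-mono-≤
        (≤-trans (≤-reflexive (∑-*ˡ x (ι 2))) (*-monoˡ-≤ (ι≥0 2) (∑-initial x N))) (∑-powers x x<X)))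
      where
      powers≥0 : ∀ a → 0ℚ ≤ powers x a
      powers≥0 a = ∑-≥0 x (λ i _ _ → powers-inner≥0 x a i)
      bound : ∀ a → 1 ℕ.≤ a → a ℕ.≤ x → a ≈ α → Λ a * rec a ≤ ι 2 * ind (a ℕ.<? N) + powers x a * rec a
      bound a 1≤a a≤x a≈α with Λ-support a 1≤a
      ... | inj₁ e = ≤-trans (≤-reflexive (trans (cong (_* rec a) e) (ℚ.*-zeroˡ (rec a))))
        ((ι≥0 2 ⊗ ind≥0 (a ℕ.<? N)) ⊕ (powers≥0 a ⊗ rec≥0 a))
      ... | inj₂ (p , zero , l , refl , e′) = ≤-trans
        (≤-trans (*-monoʳ-≤ (rec≥0 a) (≤-trans (Λ≤ℓ h≥0 a 1≤a) (ℓ≤ a 1≤a (ℕ.<⇒≤ (ℕ.≤-<-trans a≤x x<X)))))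
          (≤-reflexive (trans (ℚ.*-assoc (ι 2) (ι a) (rec a)) (trans (cong (ι 2 *_) (ι*rec 1≤a)) (cong (ι 2 *_) (sym (ind-yes (a ℕ.<? N) a<N)))))))
        (≤-trans (≤-reflexive (sym (ℚ.+-identityʳ (ι 2 * ind (a ℕ.<? N))))) (ℚ.+-monoʳ-≤ (ι 2 * ind (a ℕ.<? N)) (powers≥0 a ⊗ rec≥0 a)))
        where
        p*1 : p ℕ.* 1 ≡ p
        p*1 = ℕ.*-identityʳ p
        a<N : a ℕ.< N
        a<N = subst (ℕ._< N) (sym p*1) (few p (is-prime l) (subst (_≈ α) p*1 a≈α))
      ... | inj₂ (zero , suc k , l , _) = ⊥-elim (ℕ.n≮0 (prime≥2 (is-prime l)))
      ... | inj₂ (suc i , suc k , l , e , e′) = ≤-trans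
        (*-monoʳ-≤ (rec≥0 a) (≤-trans (≤-reflexive Λa) (≤-trans (∑-term {f = λ k → ind (a ℕ.≟ suc i ℕ.^ suc k) * ℓ (suc i)} (s≤s z≤n) k≤x (λ k _ _ → ind≥0 (a ℕ.≟ suc i ℕ.^ suc k) ⊗ ℓ≥0 h≥0 (suc i) (s≤s z≤n)))
          (∑-term {f = λ i → ∑ x (λ k → ind (a ℕ.≟ suc i ℕ.^ suc k) * ℓ (suc i))} 1≤i i≤x (λ i _ _ → powers-inner≥0 x a i)))))
        (≤-trans (≤-reflexive (sym (ℚ.+-identityˡ (powers x a * rec a)))) (ℚ.+-monoˡ-≤ (powers x a * rec a) (ι≥0 2 ⊗ ind≥0 (a ℕ.<? N))))
        where
        1≤i : 1 ℕ.≤ i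
        1≤i = ℕ.≤-pred (prime≥2 (is-prime l))
        k≤x : suc k ℕ.≤ x
        k≤x = ℕ.≤-trans (ℕ.≤-trans (ℕ.<⇒≤ (k<^ i (suc k) 1≤i)) (ℕ.≤-trans (ℕ.<⇒≤ (n<p*n (s≤s 1≤i) (1≤^ i (suc k)))) (ℕ.≤-reflexive (sym e)))) a≤x
        i≤x : i ℕ.≤ x
        i≤x = ℕ.≤-trans (ℕ.≤-trans (ℕ.n≤1+n i) (∣⇒≤′ 1≤a (divides-n l))) a≤x
        ℓp : ℓ (suc i) ≡ h (suc i)
        ℓp = trans (cong ℓ (sym (ℕ.*-identityʳ (suc i)))) (trans (ℓ-* (LPF-prime (is-prime l)) ℕ.≤-refl) (trans (cong (h (suc i) +_) ℓ-1) (ℚ.+-identityʳ (h (suc i)))))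
        Λa : Λ a ≡ ind (a ℕ.≟ suc i ℕ.^ suc (suc k)) * ℓ (suc i)
        Λa = trans e′ (trans (sym ℓp) (trans (sym (ℚ.*-identityˡ (ℓ (suc i)))) (cong (_* ℓ (suc i)) (sym (ind-yes (a ℕ.≟ suc i ℕ.^ suc (suc k)) e)))))
      term : ∀ a → 1 ℕ.≤ a → a ℕ.≤ x → ω a * δ α a ≤ ι 2 * ind (a ℕ.<? N) + powers x a * rec a
      term a 1≤a a≤x with a ℕ.% m ℕ.≟ α ℕ.% m
      ... | yes a≈α = ≤-trans (≤-trans (≤-reflexive (ℚ.*-identityʳ (ω a)))
          (≤-trans (*-monoʳ-≤ (Λ≥0 h≥0 a 1≤a ⊗ rec≥0 a) (ind≤1 (coprime? a m))) (≤-reflexive (ℚ.*-identityˡ (Λ a * rec a))))) (bound a 1≤a a≤x a≈α)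
      ... | no _ = ≤-trans (≤-reflexive (ℚ.*-zeroʳ (ω a))) ((ι≥0 2 ⊗ ind≥0 (a ℕ.<? N)) ⊕ (powers≥0 a ⊗ rec≥0 a))

  -- Real characters

  ∑-squares-≤ : ∀ {F : ℕ → ℚ} M → (∀ n → 1 ℕ.≤ n → 0ℚ ≤ F n) → ∑ M (λ k → F (k ℕ.* k)) ≤ ∑ (M ℕ.* M) F
  ∑-squares-≤ zero    F≥0 = ≤-refl
  ∑-squares-≤ {F} (suc M) F≥0 = ℚ.+-monoˡ-≤ (F (suc M ℕ.* suc M)) (≤-trans (∑-squares-≤ M F≥0)
    (∑-range-mono {f = F} (ℕ.≤-trans (ℕ.*-monoʳ-≤ M (ℕ.n≤1+n M)) (ℕ.m≤n+m (M ℕ.* suc M) M)) (λ i 1≤i _ → F≥0 i 1≤i)))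

  ∑-id : ∀ n → ι 2 * ∑ n ι ≡ ι n * (1ℚ + ι n)
  ∑-id zero    = refl
  ∑-id (suc n) = trans (lem₁ (∑ n ι) (ι n)) (trans (cong (_+ ι 2 * (1ℚ + ι n)) (∑-id n)) (lem₂ (ι n)))
    where
    lem₁ : ∀ s x → ι 2 * (s + (1ℚ + x)) ≡ ι 2 * s + ι 2 * (1ℚ + x)
    lem₁ = solve-∀ ℚ-ring
    lem₂ : ∀ x → x * (1ℚ + x) + ι 2 * (1ℚ + x) ≡ (1ℚ + x) * (1ℚ + (1ℚ + x))
    lem₂ = solve-∀ ℚ-ring

  ∑-squares : ∀ n → ι 6 * ∑ n (λ k → ι k * ι k) ≡ ι n * (1ℚ + ι n) * (1ℚ + ι 2 * ι n)
  ∑-squares zero    = refl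
  ∑-squares (suc n) = trans (lem₁ (∑ n (λ k → ι k * ι k)) (ι n)) (trans (cong (_+ ι 6 * ((1ℚ + ι n) * (1ℚ + ι n))) (∑-squares n)) (lem₂ (ι n)))
    where
    lem₁ : ∀ s x → ι 6 * (s + (1ℚ + x) * (1ℚ + x)) ≡ ι 6 * s + ι 6 * ((1ℚ + x) * (1ℚ + x))
    lem₁ = solve-∀ ℚ-ring
    lem₂ : ∀ x → x * (1ℚ + x) * (1ℚ + ι 2 * x) + ι 6 * ((1ℚ + x) * (1ℚ + x)) ≡ (1ℚ + x) * (1ℚ + (1ℚ + x)) * (1ℚ + ι 2 * (1ℚ + x))
    lem₂ = solve-∀ ℚ-ring

  ι-∸ : ∀ {a b} → b ℕ.≤ a → ι (a ℕ.∸ b) ≡ ι a - ι b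
  ι-∸ {a} {b} b≤a = trans (lem (ι (a ℕ.∸ b)) (ι b)) (cong (_- ι b) (trans (sym (ι-+ (a ℕ.∸ b) b)) (cong ι (ℕ.m∸n+n≡m b≤a))))
    where
    lem : ∀ x y → x ≡ (x + y) - y
    lem = solve-∀ ℚ-ring

  -- Chosen for the cutoff N = M² and the splitting point A = d M, where the squares give 2 E ≥ M³.
  -- As M = 4 (b + d²), the terms N b + A² of `E-upper` make up M³ / 4. As d = 16 b, the term 2 b N²
  -- / A is M³ / 8, and passing from S A to S y costs as much again. This leaves M⁴ |S y| ≥ M³ / 2.
  scale-d scale-M scale-A : ℕ → ℕ
  scale-d b = 16 ℕ.* b
  scale-M b = 4 ℕ.* (b ℕ.+ scale-d b ℕ.* scale-d b)
  scale-A b = scale-d b ℕ.* scale-M b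

  -- Partial sums of χ(n)/n stay away from 0 for a real nonprincipal character χ:
  -- r = 1 * χ is nonnegative and at least 1 on squares, which makes
  -- ∑ r(n)(N - n) at least of order N^(3/2), while ∑ χ = O(1) makes it
  -- ½ N² ∑ χ(n)/n + o(N^(3/2)).
  module RealCharacter (χ : ℕ → ℚ) (χ-1 : χ 1 ≡ 1ℚ) (χ-* : ∀ a b → χ (a ℕ.* b) ≡ χ a * χ b)
    (χ-value : ∀ n → χ n ≡ 0ℚ ⊎ χ n ≡ 1ℚ ⊎ χ n ≡ - 1ℚ)
    (b : ℕ) (1≤b : 1 ℕ.≤ b) (∑χ-bound : ∀ n → ∣ ∑ n χ ∣ ≤ ι b) where

    r : ℕ → ℚ
    r n = DS n χ

    r′ : ℕ → ℕ → ℚ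
    r′ p n = DS n (λ d → ind (¬? (p ∣? d)) * χ d)

    private
      nz : ∀ p d → ind (¬? (p ∣? (p ℕ.* d))) ≡ 0ℚ
      nz p d = ind-no (¬? (p ∣? (p ℕ.* d))) (λ k → k (m∣m*n d))

      idem : {P : Set} (d : Dec P) → ind d * ind d ≡ ind d
      idem (yes _) = refl
      idem (no  _) = refl

      r-split : ∀ {p n} → Prime p → 1 ℕ.≤ n → r (p ℕ.* n) ≡ r′ p n + χ p * r n
      r-split {p} {n} pp 1≤n = trans (DS-split χ pp 1≤n)
        (trans (DS-cong {n = n} {g′ = λ d → ind (¬? (p ∣? d)) * χ d + χ p * χ d} (λ d _ _ → cong (ind (¬? (p ∣? d)) * χ d +_) (χ-* p d)))
          (trans (DS-+ n (λ d → ind (¬? (p ∣? d)) * χ d) (λ d → χ p * χ d)) (cong (r′ p n +_) (DS-*ˡ n (χ p) χ))))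

      r′-* : ∀ {p n} → Prime p → 1 ℕ.≤ n → r′ p (p ℕ.* n) ≡ r′ p n
      r′-* {p} {n} pp 1≤n = trans (DS-split (λ d → ind (¬? (p ∣? d)) * χ d) pp 1≤n) (DS-cong {n = n} (λ d _ _ →
        trans (cong (λ z → ind (¬? (p ∣? d)) * (ind (¬? (p ∣? d)) * χ d) + z * χ (p ℕ.* d)) (nz p d))
          (trans (lem (ind (¬? (p ∣? d))) (χ d) (χ (p ℕ.* d))) (cong (_* χ d) (idem (¬? (p ∣? d)))))))
        where
        lem : ∀ i x y → i * (i * x) + 0ℚ * y ≡ i * i * x
        lem = solve-∀ ℚ-ring

      r′-∤ : ∀ {p n} → ¬ (p ∣ n) → r′ p n ≡ r n
      r′-∤ {p} {n} p∤n = DS-cong {n = n} (λ d _ d∣n → trans (cong (_* χ d) (ind-yes (¬? (p ∣? d)) (λ p∣d → p∤n (∣-trans p∣d d∣n)))) (ℚ.*-identityˡ (χ d)))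

      r-χ0 : ∀ {p n} → Prime p → 1 ℕ.≤ n → χ p ≡ 0ℚ → r (p ℕ.* n) ≡ r n
      r-χ0 {p} {n} pp 1≤n e = trans (r-split pp 1≤n) (trans (cong₂ (λ u v → u + v * r n) r′≡r e) (lem (r n)))
        where
        lem : ∀ x → x + 0ℚ * x ≡ x
        lem = solve-∀ ℚ-ring
        r′≡r : r′ p n ≡ r n
        r′≡r = DS-cong {n = n} (λ d _ _ → go d)
          where
          go : ∀ d → ind (¬? (p ∣? d)) * χ d ≡ χ d
          go d with p ∣? d
          ... | no _ = ℚ.*-identityˡ (χ d)
          ... | yes (divides q eq) = trans (ℚ.*-zeroˡ (χ d)) (sym (trans (cong χ eq) (trans (χ-* q p) (trans (cong (χ q *_) e) (ℚ.*-zeroʳ (χ q))))))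

      r-χ-1 : ∀ {p n} → Prime p → 1 ℕ.≤ n → χ p ≡ - 1ℚ → r (p ℕ.* (p ℕ.* n)) ≡ r n
      r-χ-1 {p} {n} pp 1≤n e = trans (r-split pp (ℕ.*-mono-≤ (prime≥1 pp) 1≤n))
        (trans (cong₂ (λ u v → u + χ p * v) (r′-* pp 1≤n) (r-split pp 1≤n)) (trans (cong (λ z → r′ p n + z * (r′ p n + z * r n)) e) (lem (r′ p n) (r n))))
        where
        lem : ∀ x y → x + (- 1ℚ) * (x + (- 1ℚ) * y) ≡ y
        lem = solve-∀ ℚ-ring

      -- Instead of multiplicativity of r, the induction carries along `r′`, the divisor sums prime
      -- to a given p. Then r (p q) is r q or r′ p q + r q for χ p = 0 or 1. For χ p = - 1 it is 0
      -- if p does not divide q, and r t if q = p t.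
      r≥0-all : ∀ n → 1 ℕ.≤ n → 0ℚ ≤ r n × (∀ p → Prime p → 0ℚ ≤ r′ p n)
      r≥0-all = ℕ.<-rec (λ n → 1 ℕ.≤ n → 0ℚ ≤ r n × (∀ p → Prime p → 0ℚ ≤ r′ p n)) go
        where
        go : ∀ n → (∀ {k} → k ℕ.< n → 1 ℕ.≤ k → 0ℚ ≤ r k × (∀ p → Prime p → 0ℚ ≤ r′ p k)) → 1 ℕ.≤ n → 0ℚ ≤ r n × (∀ p → Prime p → 0ℚ ≤ r′ p n)
        go n ih 1≤n = rn , r′n
          where
          rn : 0ℚ ≤ r n
          rn with n ℕ.≟ 1
          ... | yes refl = ≥0-by 0≤1 (trans (lem (χ 1)) χ-1)
            where
            lem : ∀ x → 0ℚ + 1ℚ * x ≡ x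
            lem = solve-∀ ℚ-ring
          ... | no n≢1 with find-lpf n (ℕ.≤∧≢⇒< 1≤n (λ e → n≢1 (sym e)))
          ... | p , l with divides-n l
          ... | divides q eq = subst (λ n → 0ℚ ≤ r n) (sym n≡) (cases (χ-value p))
            where
            n≡ : n ≡ p ℕ.* q
            n≡ = trans eq (ℕ.*-comm q p)
            pp = is-prime l
            1≤q : 1 ℕ.≤ q
            1≤q = 1≤factor {p} (subst (1 ℕ.≤_) n≡ 1≤n)
            q<n : q ℕ.< n
            q<n = subst (q ℕ.<_) (sym n≡) (n<p*n (prime≥2 pp) 1≤q)
            cases : χ p ≡ 0ℚ ⊎ χ p ≡ 1ℚ ⊎ χ p ≡ - 1ℚ → 0ℚ ≤ r (p ℕ.* q)
            cases (inj₁ e) = ≥0-by (proj₁ (ih q<n 1≤q)) (r-χ0 pp 1≤q e)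
            cases (inj₂ (inj₁ e)) = ≥0-by (proj₂ (ih q<n 1≤q) p pp ⊕ (0≤1 ⊗ proj₁ (ih q<n 1≤q))) (trans (r-split pp 1≤q) (cong (λ z → r′ p q + z * r q) e))
            cases (inj₂ (inj₂ e)) with p ∣? q
            ... | no p∤q = ≤-reflexive (sym (trans (r-split pp 1≤q) (trans (cong₂ (λ u v → u + v * r q) (r′-∤ p∤q) e) (lem (r q)))))
              where
              lem : ∀ x → x + (- 1ℚ) * x ≡ 0ℚ
              lem = solve-∀ ℚ-ring
            ... | yes (divides t eq′) = ≥0-by (proj₁ (ih t<n 1≤t)) (trans (cong (λ z → r (p ℕ.* z)) q≡) (r-χ-1 pp 1≤t e))
              where
              q≡ : q ≡ p ℕ.* t
              q≡ = trans eq′ (ℕ.*-comm t p)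
              1≤t : 1 ℕ.≤ t
              1≤t = 1≤factor {p} (subst (1 ℕ.≤_) q≡ 1≤q)
              t<n : t ℕ.< n
              t<n = ℕ.<-trans (subst (t ℕ.<_) (sym q≡) (n<p*n (prime≥2 pp) 1≤t)) q<n
          r′n : ∀ p → Prime p → 0ℚ ≤ r′ p n
          r′n p pp with p ∣? n
          ... | no p∤n = ≥0-by rn (r′-∤ p∤n)
          ... | yes (divides q eq) = subst (λ n → 0ℚ ≤ r′ p n) (sym n≡) (≥0-by (proj₂ (ih q<n 1≤q) p pp) (r′-* pp 1≤q))
            where
            n≡ : n ≡ p ℕ.* q
            n≡ = trans eq (ℕ.*-comm q p)
            1≤q : 1 ℕ.≤ q
            1≤q = 1≤factor {p} (subst (1 ℕ.≤_) n≡ 1≤n)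
            q<n : q ℕ.< n
            q<n = subst (q ℕ.<_) (sym n≡) (n<p*n (prime≥2 pp) 1≤q)

    r≥0 : ∀ n → 1 ℕ.≤ n → 0ℚ ≤ r n
    r≥0 n 1≤n = proj₁ (r≥0-all n 1≤n)

    -- Multiplying the argument by p² leaves r unchanged if χ p is 0 or - 1, and adds 2 r′ p (k²) ≥
    -- 0 if χ p = 1.
    r-square : ∀ k → 1 ℕ.≤ k → 1ℚ ≤ r (k ℕ.* k)
    r-square = LPF-induction (λ k → 1ℚ ≤ r (k ℕ.* k)) (≤-reflexive (sym (trans (lem (χ 1)) χ-1))) go
      where
      lem : ∀ x → 0ℚ + 1ℚ * x ≡ x
      lem = solve-∀ ℚ-ring
      go : ∀ p k → LPF p (p ℕ.* k) → 1 ℕ.≤ k → 1ℚ ≤ r (k ℕ.* k) → 1ℚ ≤ r (p ℕ.* k ℕ.* (p ℕ.* k))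
      go p k l 1≤k ih = subst (λ n → 1ℚ ≤ r n) (sym (lemℕ p k)) (cases (χ-value p))
        where
        lemℕ : ∀ p k → p ℕ.* k ℕ.* (p ℕ.* k) ≡ p ℕ.* (p ℕ.* (k ℕ.* k))
        lemℕ = solve-∀ℕ
        pp = is-prime l
        1≤k² : 1 ℕ.≤ k ℕ.* k
        1≤k² = ℕ.*-mono-≤ 1≤k 1≤k
        1≤pk² : 1 ℕ.≤ p ℕ.* (k ℕ.* k)
        1≤pk² = ℕ.*-mono-≤ (prime≥1 pp) 1≤k²
        cases : χ p ≡ 0ℚ ⊎ χ p ≡ 1ℚ ⊎ χ p ≡ - 1ℚ → 1ℚ ≤ r (p ℕ.* (p ℕ.* (k ℕ.* k)))
        cases (inj₁ e) = ≤-trans ih (≤-reflexive (sym (trans (r-χ0 pp 1≤pk² e) (r-χ0 pp 1≤k² e))))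
        cases (inj₂ (inj₂ e)) = ≤-trans ih (≤-reflexive (sym (r-χ-1 pp 1≤k² e)))
        cases (inj₂ (inj₁ e)) = ≤-trans ih (≤-by (proj₂ (r≥0-all (k ℕ.* k) 1≤k²) p pp ⊕ proj₂ (r≥0-all (k ℕ.* k) 1≤k²) p pp)
          (trans (cong (_- r (k ℕ.* k)) (trans (r-split pp 1≤pk²) (trans (cong₂ (λ u v → u + χ p * v) (r′-* pp 1≤k²) (r-split pp 1≤k²))
            (cong (λ z → r′ p (k ℕ.* k) + z * (r′ p (k ℕ.* k) + z * r (k ℕ.* k))) e)))) (lem′ (r′ p (k ℕ.* k)) (r (k ℕ.* k)))))
          where
          lem′ : ∀ x y → (x + 1ℚ * (x + 1ℚ * y)) - y ≡ x + x
          lem′ = solve-∀ ℚ-ring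

    S : ℕ → ℚ
    S n = ∑ n (λ k → χ k * rec k)

    private
      b≥0 : 0ℚ ≤ ι b
      b≥0 = ι≥0 b

      χ≤1 : ∀ n → ∣ χ n ∣ ≤ 1ℚ
      χ≤1 n with χ-value n
      ... | inj₁ e = abs-≡ (abs-nonneg ≤-refl 0≤1) e
      ... | inj₂ (inj₁ e) = abs-≡ (abs-nonneg 0≤1 ≤-refl) e
      ... | inj₂ (inj₂ e) = abs-≡ (abs-neg {1ℚ} (abs-nonneg 0≤1 ≤-refl)) e

    module _ (N : ℕ) (1≤N : 1 ℕ.≤ N) where

      -- With truncated subtraction this is the positive part of N - a e: the condition a e ≤ N need
      -- not be imposed on the summation, and the weight decreases in a, as partial summation
      -- requires.
      K : ℕ → ℕ → ℚ
      K a e = ι (N ℕ.∸ a ℕ.* e)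

      G : ℕ → ℚ
      G a = ∑ N (K a)

      private
        K≥0 : ∀ a e → 0ℚ ≤ K a e
        K≥0 a e = ι≥0 (N ℕ.∸ a ℕ.* e)

        G-quo : ∀ {a} → 1 ℕ.≤ a → G a ≡ ∑ (quo N a) (K a)
        G-quo {a} 1≤a = ∑-trunc (quo-≤ N a) (λ e q<e _ → cong ι (ℕ.m≤n⇒m∸n≡0
          (ℕ.≤-trans (ℕ.<⇒≤ (quo-upper N 1≤a)) (ℕ.*-monoʳ-≤ a q<e))))

        remainder : ℕ → ℚ
        remainder a = ι N - ι a * ι (quo N a)

        remainder≥0 : ∀ a → 0ℚ ≤ remainder a
        remainder≥0 a = diff (≤-trans (≤-reflexive (sym (ι-* a (quo N a)))) (ι-mono (quo-lower N a)))

        remainder≤ : ∀ a → 1 ℕ.≤ a → remainder a ≤ ι a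
        remainder≤ a 1≤a = ≤-by (diff (≤-trans (ι-mono (ℕ.<⇒≤ (quo-upper N 1≤a))) (≤-reflexive (ι-* a (suc (quo N a))))))
          (lem (ι N) (ι a) (ι (quo N a)))
          where
          lem : ∀ n a q → a - (n - a * q) ≡ a * (1ℚ + q) - n
          lem = solve-∀ ℚ-ring

        G-closed : ∀ a → 1 ℕ.≤ a → ι 2 * ι a * G a ≡ ι N * ι N - ι a * ι N + remainder a * (ι a - remainder a)
        G-closed a 1≤a = trans (cong (ι 2 * ι a *_) (trans (G-quo 1≤a)
            (trans (∑-cong q (λ e _ e≤q → trans (ι-∸ (ℕ.≤-trans (ℕ.*-monoʳ-≤ a e≤q) (quo-lower N a))) (cong (λ z → ι N - z) (ι-* a e))))
              (trans (∑-- q) (cong₂ _-_ (∑-const q (ι N)) (∑-*ˡ q (ι a)))))))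
          (trans (lem₁ (ι a) (ι q) (ι N) (∑ q ι)) (trans (cong (λ z → ι 2 * ι a * (ι q * ι N) - ι a * ι a * z) (∑-id q)) (lem₂ (ι a) (ι q) (ι N))))
          where
          q = quo N a
          lem₁ : ∀ a q n s → ι 2 * a * (q * n - a * s) ≡ ι 2 * a * (q * n) - a * a * (ι 2 * s)
          lem₁ = solve-∀ ℚ-ring
          lem₂ : ∀ a q n → ι 2 * a * (q * n) - a * a * (q * (1ℚ + q)) ≡ n * n - a * n + (n - a * q) * (a - (n - a * q))
          lem₂ = solve-∀ ℚ-ring

        G-≤ : ∀ a → 1 ℕ.≤ a → ι 2 * ι a * G a ≤ ι N * ι N
        G-≤ a 1≤a = ≤-trans (≤-reflexive (G-closed a 1≤a)) (≤-by ((ι≥0 a ⊗ (ι≥0 a ⊗ ι≥0 (quo N a))) ⊕ square≥0 (remainder a)) (lem (ι a) (ι N) (ι (quo N a))))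
          where
          lem : ∀ a n q → n * n - (n * n - a * n + (n - a * q) * (a - (n - a * q))) ≡ a * (a * q) + (n - a * q) * (n - a * q)
          lem = solve-∀ ℚ-ring

        error : ℕ → ℚ
        error a = remainder a * (ι a - remainder a) * rec a

        error-bound : ∀ a → 1 ℕ.≤ a → ∣ error a ∣ ≤ ι a
        error-bound a 1≤a = abs-nonneg ((remainder≥0 a ⊗ diff (remainder≤ a 1≤a)) ⊗ rec≥0 a)
          (≤-trans (≤-reflexive (ℚ.*-comm (remainder a * (ι a - remainder a)) (rec a))) (rec-≤ 1≤a
            (*-mono-≤₀ (remainder≥0 a) (ι≥0 a) (remainder≤ a 1≤a) (≤-by (remainder≥0 a) (lem (ι a) (remainder a))))))
          where
          lem : ∀ a s → a - (a - s) ≡ s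
          lem = solve-∀ ℚ-ring

        G-error : ∀ a → 1 ℕ.≤ a → ι 2 * G a ≡ ι N * ι N * rec a - ι N + error a
        G-error a 1≤a = trans (lem₀ (ι 2 * G a)) (trans (cong (ι 2 * G a *_) (sym (ι*rec 1≤a)))
          (trans (lem₁ (ι a) (G a) (rec a)) (trans (cong (_* rec a) (G-closed a 1≤a)) (trans (lem₂ (ι N) (ι a) (remainder a) (rec a))
            (cong (λ z → ι N * ι N * rec a - ι N * z + error a) (ι*rec 1≤a) ⟫ cong (λ z → ι N * ι N * rec a - z + error a) (ℚ.*-identityʳ (ι N)))))))
          where
          infixr 5 _⟫_
          _⟫_ : ∀ {a b c : ℚ} → a ≡ b → b ≡ c → a ≡ c
          _⟫_ = trans
          lem₀ : ∀ x → x ≡ x * 1ℚ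
          lem₀ = solve-∀ ℚ-ring
          lem₁ : ∀ a g r → ι 2 * g * (a * r) ≡ (ι 2 * a * g) * r
          lem₁ = solve-∀ ℚ-ring
          lem₂ : ∀ n a s r → (n * n - a * n + s * (a - s)) * r ≡ n * n * r - n * (a * r) + s * (a - s) * r
          lem₂ = solve-∀ ℚ-ring

      E : ℚ
      E = ∑ N (λ n → K 1 n * r n)

      private
        E-hyperbola : E ≡ ∑ N (λ a → χ a * G a)
        E-hyperbola = trans (hyperbola N (K 1) χ) (∑-cong N (λ a 1≤a _ → cong (χ a *_)
          (trans (∑-cong′ (quo N a) (λ e → cong (λ n → ι (N ℕ.∸ n)) (ℕ.*-identityˡ (a ℕ.* e)))) (sym (G-quo 1≤a)))))

        head-bound : ∀ A → ∣ ι 2 * ∑ A (λ a → χ a * G a) ∣ ≤ ι N * ι N * ∣ S A ∣ + ι N * ι b + ι A * ι A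
        head-bound A = abs-≡ (abs-+ (abs-- (abs-scale (ι≥0 N ⊗ ι≥0 N) (≤-refl {∣ S A ∣})) (abs-scale (ι≥0 N) (∑χ-bound A)))
            (∑-bound A {f = λ a → χ a * error a} (λ a 1≤a a≤A → ≤-trans (abs-* (χ≤1 a) (error-bound a 1≤a))
              (≤-trans (≤-reflexive (ℚ.*-identityˡ (ι a))) (ι-mono a≤A)))))
          (trans (sym (∑-*ˡ A (ι 2))) (trans (∑-cong A (λ a 1≤a _ → trans (lem₁ (χ a) (G a)) (trans (cong (χ a *_) (G-error a 1≤a)) (lem₂ (χ a) (ι N) (rec a) (error a)))))
            (trans (∑-+ A) (cong (_+ ∑ A (λ a → χ a * error a)) (trans (∑-- A) (cong₂ _-_ (∑-*ˡ A (ι N * ι N)) (∑-*ˡ A (ι N))))))))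
          where
          lem₁ : ∀ x g → ι 2 * (x * g) ≡ x * (ι 2 * g)
          lem₁ = solve-∀ ℚ-ring
          lem₂ : ∀ x n r e → x * (n * n * r - n + e) ≡ n * n * (x * r) - n * x + x * e
          lem₂ = solve-∀ ℚ-ring

        -- For each fixed e, partial summation over a > A leaves only the weight at the cut; summing
        -- these over e gives `G` again, which is of order N² / A.
        tail-bound : ∀ A → 1 ℕ.≤ A → A ℕ.≤ N → ∣ ∑ N (λ a → χ a * G a) - ∑ A (λ a → χ a * G a) ∣ ≤ (ι b + ι b) * G A
        tail-bound A 1≤A A≤N = ≤-trans
          (abs-≡ (∑-abs N (λ e _ _ → Abel.abel {χ} {λ a → K a e} ∑χ-bound (λ a _ → K≥0 a e)
              (λ a _ → ι-mono (ℕ.∸-monoʳ-≤ N (ℕ.*-monoˡ-≤ e (ℕ.n≤1+n a)))) A≤N))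
            (trans (cong₂ _-_ (swapped N) (swapped A)) (sym (∑-- N))))
          (≤-trans (∑-mono N (λ e _ _ → *-monoˡ-≤ (b≥0 ⊕ b≥0) (ι-mono (ℕ.∸-monoʳ-≤ N (ℕ.*-monoˡ-≤ e (ℕ.n≤1+n A))))))
            (≤-reflexive (∑-*ˡ N (ι b + ι b))))
          where
          swapped : ∀ A → ∑ A (λ a → χ a * G a) ≡ ∑ N (λ e → ∑ A (λ a → χ a * K a e))
          swapped A = trans (∑-cong′ A (λ a → sym (∑-*ˡ N (χ a)))) (∑-swap A N (λ a e → χ a * K a e))

      E-upper : ∀ A → 1 ℕ.≤ A → A ℕ.≤ N → ι 2 * E ≤ ι N * ι N * ∣ S A ∣ + ι N * ι b + ι A * ι A + ι 2 * ι b * (ι N * ι N * rec A)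
      E-upper A 1≤A A≤N = combine E (∑ A (λ a → χ a * G a)) (ι N * ι N * ∣ S A ∣ + ι N * ι b + ι A * ι A) (ι b) (G A) (ι N * ι N * rec A)
        (abs-upper (head-bound A)) (subst (λ z → z - ∑ A (λ a → χ a * G a) ≤ (ι b + ι b) * G A) (sym E-hyperbola) (abs-upper (tail-bound A 1≤A A≤N)))
        b≥0 (≤-trans (≤-rec {A} 1≤A (≤-trans (≤-reflexive (lem (ι A) (G A))) (G-≤ A 1≤A))) (≤-reflexive (ℚ.*-comm (rec A) (ι N * ι N))))
        where
        lem : ∀ a g → a * (ι 2 * g) ≡ ι 2 * a * g
        lem = solve-∀ ℚ-ring
        combine : ∀ e h u b g v → ι 2 * h ≤ u → e - h ≤ (b + b) * g → 0ℚ ≤ b → ι 2 * g ≤ v → ι 2 * e ≤ u + ι 2 * b * v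
        combine e h u b g v p q b≥0 w = ≤-by (diff p ⊕ ι≥0 2 ⊗ diff q ⊕ ι≥0 2 ⊗ b≥0 ⊗ diff w) (solve (e ∷ h ∷ u ∷ b ∷ g ∷ v ∷ []) ℚ-ring)

    E-lower : ∀ M (1≤N : 1 ℕ.≤ M ℕ.* M) → ∑ M (λ k → ι M * ι M - ι k * ι k) ≤ E (M ℕ.* M) 1≤N
    E-lower M 1≤N = ≤-trans (∑-mono M (λ k 1≤k k≤M → ≤-trans (≤-reflexive (trans (cong₂ _-_ (sym (ι-* M M)) (sym (ι-* k k)))
          (trans (sym (ι-∸ (ℕ.*-mono-≤ k≤M k≤M))) (cong (λ n → ι (M ℕ.* M ℕ.∸ n)) (sym (ℕ.*-identityˡ (k ℕ.* k)))))))
        (≤-trans (≤-reflexive (sym (ℚ.*-identityʳ _))) (*-monoˡ-≤ (ι≥0 (M ℕ.* M ℕ.∸ 1 ℕ.* (k ℕ.* k))) (r-square k 1≤k)))))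
      (∑-squares-≤ {λ n → ι (M ℕ.* M ℕ.∸ 1 ℕ.* n) * r n} M (λ n 1≤n → ι≥0 (M ℕ.* M ℕ.∸ 1 ℕ.* n) ⊗ r≥0 n 1≤n))

    d M A : ℕ
    d = scale-d b
    M = scale-M b
    A = scale-A b

    private
      1≤d : 1 ℕ.≤ d
      1≤d = ℕ.≤-trans 1≤b (ℕ.m≤m+n b (15 ℕ.* b))

      d≤M : d ℕ.≤ M
      d≤M = ℕ.≤-trans (ℕ.≤-trans (ℕ.≤-trans (ℕ.≤-reflexive (sym (ℕ.*-identityˡ d))) (ℕ.*-monoˡ-≤ d 1≤d)) (ℕ.m≤n+m (d ℕ.* d) b))
        (ℕ.m≤m+n (b ℕ.+ d ℕ.* d) (3 ℕ.* (b ℕ.+ d ℕ.* d)))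

      1≤M : 1 ℕ.≤ M
      1≤M = ℕ.≤-trans 1≤d d≤M

      4≤M : 4 ℕ.≤ M
      4≤M = ℕ.*-monoʳ-≤ 4 (ℕ.≤-trans 1≤b (ℕ.m≤m+n b (d ℕ.* d)))

      1≤N : 1 ℕ.≤ M ℕ.* M
      1≤N = ℕ.*-mono-≤ 1≤M 1≤M

    1≤A : 1 ℕ.≤ A
    1≤A = ℕ.*-mono-≤ 1≤d 1≤M

    S-lower : ∀ y → A ℕ.≤ y → 1ℚ ≤ ι 2 * ι M * ∣ S y ∣
    S-lower y A≤y = *-cancel-≤ {ι 2 * (ι M * ι M * ι M)} 1≤k
      (final (ι M) (ι d) (ι b) ∣ S A ∣ ∣ S y ∣ (rec A) (∑ M (λ k → ι k * ι k)) (E (M ℕ.* M) 1≤N) (ι≥0 M) M≡ (ι-* 16 b)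
        (trans (cong (_* rec A) (sym (ι-* d M))) (ι*rec 1≤A)) (∑-squares M) (ι-mono 4≤M) lower upper S-close)
      where
      1≤k : 1ℚ ≤ ι 2 * (ι M * ι M * ι M)
      1≤k = ≤-trans (1≤ι (ℕ.*-mono-≤ {1} {2} (s≤s z≤n) (ℕ.*-mono-≤ 1≤N 1≤M))) (≤-reflexive (trans (ι-* 2 (M ℕ.* M ℕ.* M)) (cong (ι 2 *_) (trans (ι-* (M ℕ.* M) M) (cong (_* ι M) (ι-* M M))))))
      M≡ : ι M ≡ ι 4 * (ι b + ι d * ι d)
      M≡ = trans (ι-* 4 (b ℕ.+ d ℕ.* d)) (cong (ι 4 *_) (trans (ι-+ b (d ℕ.* d)) (cong (ι b +_) (ι-* d d))))
      lower : ι M * (ι M * ι M) - ∑ M (λ k → ι k * ι k) ≤ E (M ℕ.* M) 1≤N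
      lower = ≤-trans (≤-reflexive (sym (trans (∑-- M) (cong (_- ∑ M (λ k → ι k * ι k)) (∑-const M (ι M * ι M)))))) (E-lower M 1≤N)
      upper : ι 2 * E (M ℕ.* M) 1≤N ≤ ι M * ι M * (ι M * ι M) * ∣ S A ∣ + ι M * ι M * ι b + ι d * ι M * (ι d * ι M) + ι 2 * ι b * (ι M * ι M * (ι M * ι M) * rec A)
      upper = subst₂ (λ n a → ι 2 * E (M ℕ.* M) 1≤N ≤ n * n * ∣ S A ∣ + n * ι b + a * a + ι 2 * ι b * (n * n * rec A)) (ι-* M M) (ι-* d M)
        (E-upper (M ℕ.* M) 1≤N A 1≤A (ℕ.*-monoˡ-≤ M d≤M))
      S-close : ∣ S A ∣ ≤ ∣ S y ∣ + (ι b + ι b) * rec A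
      S-close = ≤-trans (≤-reflexive (cong ∣_∣ (lem (S A) (S y)))) (abs-- (≤-refl {∣ S y ∣})
        (≤-trans (rec-tail {h = χ} ∑χ-bound A≤y) (*-monoˡ-≤ (b≥0 ⊕ b≥0) (rec-anti 1≤A (ℕ.n≤1+n A)))))
        where
        lem : ∀ a y → a ≡ y - (y - a)
        lem = solve-∀ ℚ-ring
      final : ∀ m d b sA sy ρ q e → 0ℚ ≤ m → m ≡ ι 4 * (b + d * d) → d ≡ ι 16 * b → d * m * ρ ≡ 1ℚ →
        ι 6 * q ≡ m * (1ℚ + m) * (1ℚ + ι 2 * m) → ι 4 ≤ m → m * (m * m) - q ≤ e →
        ι 2 * e ≤ m * m * (m * m) * sA + m * m * b + d * m * (d * m) + ι 2 * b * (m * m * (m * m) * ρ) →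
        sA ≤ sy + (b + b) * ρ → ι 2 * (m * m * m) * 1ℚ ≤ ι 2 * (m * m * m) * (ι 2 * m * sy)
      final m d b sA sy ρ q e m≥0 m≡ d≡ dmρ q≡ 4≤m lo up cl = ≤-trans
        (combine (m * m * b) (d * m * (d * m)) (m * m * m) (m * m * (m * m)) e sA sy b ρ ((m≥0 ⊗ m≥0) ⊗ (m≥0 ⊗ m≥0)) cube up cl (≤-reflexive eq₁) (≤-reflexive eq₂))
        (≤-reflexive (lem m sy))
        where
        lem : ∀ m s → ι 4 * (m * m * (m * m) * s) ≡ ι 2 * (m * m * m) * (ι 2 * m * s)
        lem = solve-∀ ℚ-ring
        eq₁ : ι 4 * (m * m * b + d * m * (d * m)) ≡ m * m * m
        eq₁ = trans (lem₁ m b d) (cong (m * m *_) (sym m≡))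
          where
          lem₁ : ∀ m b d → ι 4 * (m * m * b + d * m * (d * m)) ≡ m * m * (ι 4 * (b + d * d))
          lem₁ = solve-∀ ℚ-ring
        eq₂ : ι 16 * b * (m * m * (m * m) * ρ) ≡ m * m * m
        eq₂ = trans (cong (_* (m * m * (m * m) * ρ)) (sym d≡)) (trans (lem₁ m d ρ) (trans (cong (m * m * m *_) dmρ) (ℚ.*-identityʳ (m * m * m))))
          where
          lem₁ : ∀ m d ρ → d * (m * m * (m * m) * ρ) ≡ m * m * m * (d * m * ρ)
          lem₁ = solve-∀ ℚ-ring
        cube : m * m * m ≤ ι 2 * e
        cube = *-cancel-≤ {ι 3} (1≤ι {3} (s≤s z≤n)) (lem₁ m q e m≥0 (≤-reflexive q≡) 4≤m lo)
          where
          lem₁ : ∀ m q e → 0ℚ ≤ m → ι 6 * q ≤ m * (1ℚ + m) * (1ℚ + ι 2 * m) → ι 4 ≤ m → m * (m * m) - q ≤ e → ι 3 * (m * m * m) ≤ ι 3 * (ι 2 * e)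
          lem₁ m q e m≥0 h₁ h₂ h₃ = ≤-by (ι≥0 6 ⊗ diff h₃ ⊕ diff h₁ ⊕ m≥0 ⊗ (m≥0 ⊗ diff h₂ ⊕ diff h₂ ⊕ ι≥0 3)) (solve (m ∷ q ∷ e ∷ []) ℚ-ring)
        combine : ∀ u v t z e sA sy b ρ → 0ℚ ≤ z → t ≤ ι 2 * e → ι 2 * e ≤ z * sA + u + v + ι 2 * b * (z * ρ) → sA ≤ sy + (b + b) * ρ →
          ι 4 * (u + v) ≤ t → ι 16 * b * (z * ρ) ≤ t → ι 2 * t * 1ℚ ≤ ι 4 * (z * sy)
        combine u v t z e sA sy b ρ z≥0 h₁ h₂ h₃ h₄ h₅ = ≤-by (ι≥0 4 ⊗ diff h₁ ⊕ ι≥0 4 ⊗ diff h₂ ⊕ ι≥0 4 ⊗ z≥0 ⊗ diff h₃ ⊕ diff h₄ ⊕ diff h₅)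
          (solve (u ∷ v ∷ t ∷ z ∷ e ∷ sA ∷ sy ∷ b ∷ ρ ∷ []) ℚ-ring)

  -- From correlations to a character

  sgn : ℚ → ℚ
  sgn x with 0ℚ ≤? x
  ... | yes _ = 1ℚ
  ... | no  _ = - 1ℚ

  sgn-value : ∀ x → sgn x ≡ 1ℚ ⊎ sgn x ≡ - 1ℚ
  sgn-value x with 0ℚ ≤? x
  ... | yes _ = inj₁ refl
  ... | no  _ = inj₂ refl

  sgn² : ∀ x → sgn x * sgn x ≡ 1ℚ
  sgn² x with 0ℚ ≤? x
  ... | yes _ = refl
  ... | no  _ = refl

  private
    -1≢1 : ¬ (- 1ℚ ≡ 1ℚ)
    -1≢1 ()

    ι7≰0 : ∀ {z} → ι 7 ≤ ι 8 * z → ¬ (0ℚ ≤ - z)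
    ι7≰0 {z} h k = 1≰0 (≤-trans (1≤ι {7} (s≤s z≤n)) (≤-by (diff h ⊕ ι≥0 8 ⊗ k) (lem z)))
      where
      lem : ∀ z → 0ℚ - ι 7 ≡ (ι 8 * z - ι 7) + ι 8 * (- z)
      lem = solve-∀ ℚ-ring

    -≥0 : ∀ z → ¬ (0ℚ ≤ z) → 0ℚ ≤ - z
    -≥0 z n = ℚ.neg-antimono-≤ (ℚ.<⇒≤ (ℚ.≰⇒> n))

  sgn-≥0 : ∀ x → sgn x ≡ 1ℚ → 0ℚ ≤ x
  sgn-≥0 x e with 0ℚ ≤? x
  ... | yes p = p
  ... | no  _ = ⊥-elim (-1≢1 e)

  -- Only the positivity of the product matters here; the margin 7/8 is needed for the size of τ in
  -- `large-class`.
  sgn-* : ∀ x y t → ι 7 ≤ ι 8 * (x * y * t) → sgn x * sgn y ≡ sgn t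
  sgn-* x y t h with 0ℚ ≤? x | 0ℚ ≤? y | 0ℚ ≤? t
  ... | yes _ | yes _ | yes _ = refl
  ... | yes _ | no  _ | no  _ = refl
  ... | no  _ | yes _ | no  _ = refl
  ... | no  _ | no  _ | yes _ = refl
  ... | yes a | yes b | no c = ⊥-elim (ι7≰0 {x * y * t} h (≥0-by ((a ⊗ b) ⊗ -≥0 t c) (solve (x ∷ y ∷ t ∷ []) ℚ-ring)))
  ... | yes a | no b | yes c = ⊥-elim (ι7≰0 {x * y * t} h (≥0-by ((a ⊗ -≥0 y b) ⊗ c) (solve (x ∷ y ∷ t ∷ []) ℚ-ring)))
  ... | no a | yes b | yes c = ⊥-elim (ι7≰0 {x * y * t} h (≥0-by ((-≥0 x a ⊗ b) ⊗ c) (solve (x ∷ y ∷ t ∷ []) ℚ-ring)))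
  ... | no a | no b | no c = ⊥-elim (ι7≰0 {x * y * t} h (≥0-by ((-≥0 x a ⊗ -≥0 y b) ⊗ -≥0 t c) (solve (x ∷ y ∷ t ∷ []) ℚ-ring)))

  -- An average of numbers that are at most about 1 can only be about 1 if each
  -- of them is. This is applied first to σ h * τ α h, giving |σ h| ≈ 1, and then
  -- to σ g * σ h * τ g h.
  module Extremal (m : ℕ) (2≤m : 2 ℕ.≤ m) where

    open Residues m 2≤m

    extremal : ∀ {x c} → ClassFunction x → (∀ h → Coprime h m → x h ≤ c) →
      ∀ h → Coprime h m → c - x h ≤ φ * c - ∑ m (λ h → κ h * x h)
    extremal {x} {c} cx x≤c h ch with representative h
    ... | r , 1≤r , r≤m , h≈r , _ = ≤-trans
      (≤-reflexive (trans (sym (ℚ.*-identityˡ (c - x h))) (cong₂ (λ a b → a * (c - b)) (sym (κ-yes (≈-coprime h≈r ch))) (cx h≈r))))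
      (≤-trans (∑-term {f = λ h → κ h * (c - x h)} 1≤r r≤m (λ i _ _ → ≥0-by (≤-trans (≤-reflexive (sym (ℚ.*-zeroʳ (κ i)))) (κ-mono {i} (λ ci → diff (x≤c i ci)))) refl))
        (≤-reflexive (trans (∑-cong′ m (λ h → lem (κ h) c (x h))) (trans (∑-- m) (cong (_- ∑ m (λ h → κ h * x h)) (∑-*ʳ m c))))))
      where
      lem : ∀ k c x → k * (c - x) ≡ k * c - k * x
      lem = solve-∀ ℚ-ring

    module _ (σ : ℕ → ℚ) (τ : ℕ → ℕ → ℚ) (ε : ℚ) (ε≥0 : 0ℚ ≤ ε) (ε-small : ι 200 * (φ * φ) * ε ≤ 1ℚ)
      (σ-class : ClassFunction σ) (τ-class : ∀ g → ClassFunction (τ g))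
      (σ-bound : ∀ h → Coprime h m → ∣ σ h ∣ ≤ 1ℚ + ε)
      (τ-bound : ∀ g h → Coprime g m → Coprime h m → ∣ τ g h ∣ ≤ 1ℚ + ε)
      (average : ∀ g → Coprime g m → ∣ ∑ m (λ h → κ h * (σ h * τ g h)) - φ * σ g ∣ ≤ φ * ε)
      (α : ℕ) (cα : Coprime α m) (σα : 1ℚ - ε ≤ σ α) where

      private
        φε≥0 : 0ℚ ≤ φ * ε
        φε≥0 = φ≥0 ⊗ ε≥0

        200ε≤1 : ι 200 * ε ≤ 1ℚ
        200ε≤1 = ≤-trans (lem φ ε 1≤φ ε≥0) ε-small
          where
          lem : ∀ f e → 1ℚ ≤ f → 0ℚ ≤ e → ι 200 * e ≤ ι 200 * (f * f) * e
          lem f e h k = ≤-by (ι≥0 200 ⊗ k ⊗ (diff h ⊗ diff h ⊕ diff h ⊕ diff h)) (solve (f ∷ e ∷ []) ℚ-ring)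

        200φε≤1 : ι 200 * (φ * ε) ≤ 1ℚ
        200φε≤1 = ≤-trans (lem φ ε 1≤φ ε≥0) ε-small
          where
          lem : ∀ f e → 1ℚ ≤ f → 0ℚ ≤ e → ι 200 * (f * e) ≤ ι 200 * (f * f) * e
          lem f e h k = ≤-by (ι≥0 200 ⊗ k ⊗ (diff h ⊗ diff h ⊕ diff h)) (solve (f ∷ e ∷ []) ℚ-ring)

        ε≤1 : ε ≤ 1ℚ
        ε≤1 = ≤-trans (≤-by (ι≥0 199 ⊗ ε≥0) (lem ε)) 200ε≤1
          where
          lem : ∀ e → ι 200 * e - e ≡ ι 199 * e
          lem = solve-∀ ℚ-ring

        step₁ : ∀ h → Coprime h m → 1ℚ - ι 5 * (φ * ε) ≤ σ h * τ α h
        step₁ h ch = conclude φ ε (σ α) (σ h * τ α h) (∑ m (λ h → κ h * (σ h * τ α h)))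
          (extremal (λ p → cong₂ _*_ (σ-class p) (τ-class α p)) (λ h ch → ≤-trans (≤-abs _) (abs-* (σ-bound h ch) (τ-bound α h cα ch))) h ch)
          (abs-lower (average α cα)) σα φ≥0 ε≥0 ε≤1
          where
          conclude : ∀ f e s x t → (1ℚ + e) * (1ℚ + e) - x ≤ f * ((1ℚ + e) * (1ℚ + e)) - t → - (t - f * s) ≤ f * e → 1ℚ - e ≤ s → 0ℚ ≤ f → 0ℚ ≤ e → e ≤ 1ℚ →
            1ℚ - ι 5 * (f * e) ≤ x
          conclude f e s x t a b c f≥0 e≥0 e≤1 = ≤-by (diff a ⊕ diff b ⊕ f≥0 ⊗ diff c ⊕ ι≥0 2 ⊗ e≥0 ⊕ e≥0 ⊗ e≥0 ⊕ f≥0 ⊗ e≥0 ⊗ diff e≤1) (solve (f ∷ e ∷ s ∷ x ∷ t ∷ []) ℚ-ring)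

        σ²≥ : ∀ h → Coprime h m → 1ℚ - ι 15 * (φ * ε) ≤ σ h * σ h
        σ²≥ h ch = *-cancel-≤ {1ℚ + ι 5 * (φ * ε)} (≤-by (ι≥0 5 ⊗ φε≥0) (lem (ι 5 * (φ * ε))))
          (conclude (φ * ε) ε (σ h) (τ α h) (step₁ h ch)
            (abs-upper (τ-bound α h cα ch)) (abs-lower (τ-bound α h cα ch)) φε≥0 ε≥0 ε≤1 200φε≤1 (≤-trans (≤-reflexive (sym (ℚ.*-identityˡ ε))) (*-monoʳ-≤ ε≥0 1≤φ)))
          where
          lem : ∀ x → 1ℚ + x - 1ℚ ≡ x
          lem = solve-∀ ℚ-ring
          conclude : ∀ f e s t → 1ℚ - ι 5 * f ≤ s * t → t ≤ 1ℚ + e → - t ≤ 1ℚ + e → 0ℚ ≤ f → 0ℚ ≤ e → e ≤ 1ℚ → ι 200 * f ≤ 1ℚ → e ≤ f →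
            (1ℚ + ι 5 * f) * (1ℚ - ι 15 * f) ≤ (1ℚ + ι 5 * f) * (s * s)
          conclude f e s t a b c f≥0 e≥0 e≤1 f-small e≤f = ≤-trans (≤-trans mid₀ mid₁) mid₂
            where
            η≥0 : 0ℚ ≤ 1ℚ - ι 5 * f
            η≥0 = ≥0-by (diff f-small ⊕ ι≥0 195 ⊗ f≥0) (solve (f ∷ []) ℚ-ring)
            mid₀ : (1ℚ + ι 5 * f) * (1ℚ - ι 15 * f) ≤ (1ℚ - ι 5 * f) * (1ℚ - ι 5 * f)
            mid₀ = ≤-by (ι≥0 100 ⊗ square≥0 f) (solve (f ∷ []) ℚ-ring)
            mid₁ : (1ℚ - ι 5 * f) * (1ℚ - ι 5 * f) ≤ (s * t) * (s * t)
            mid₁ = *-mono-≤₀ η≥0 (≤-trans η≥0 a) a a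
            mid₂ : (s * t) * (s * t) ≤ (1ℚ + ι 5 * f) * (s * s)
            mid₂ = ≤-by (square≥0 s ⊗ (diff b ⊗ diff c ⊕ e≥0 ⊗ diff e≤1 ⊕ ι≥0 3 ⊗ diff e≤f ⊕ ι≥0 2 ⊗ f≥0)) (solve (f ∷ e ∷ s ∷ t ∷ []) ℚ-ring)

      -- The average against g is close to φ (σ g)², and (σ g)² is within 15 φ ε of 1 from below.
      -- Altogether the product loses at most 10 φ ε + 15 φ² ε ≤ 25 φ² ε, which `ε-small` makes at
      -- most 1/8.
      near-one : ∀ g h → Coprime g m → Coprime h m → ι 7 ≤ ι 8 * (σ g * σ h * τ g h)
      near-one g h cg ch = conclude φ ε (σ g) (σ g * σ h * τ g h) (∑ m (λ h → κ h * (σ h * τ g h)))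
        (subst (λ z → (1ℚ + ε) * (1ℚ + ε) * (1ℚ + ε) - σ g * σ h * τ g h ≤ φ * ((1ℚ + ε) * (1ℚ + ε) * (1ℚ + ε)) - z)
          (trans (∑-cong′ m (λ h → lem (κ h) (σ g) (σ h) (τ g h))) (∑-*ˡ m (σ g)))
          (extremal (λ p → cong₂ (λ a b → σ g * a * b) (σ-class p) (τ-class g p))
            (λ h ch → ≤-trans (≤-abs _) (abs-* (abs-* (σ-bound g cg) (σ-bound h ch)) (τ-bound g h cg ch))) h ch))
        (≤-trans (≤-reflexive (lem′ (σ g) (∑ m (λ h → κ h * (σ h * τ g h))) φ))
          (≤-trans (-≤-abs (σ g * (∑ m (λ h → κ h * (σ h * τ g h)) - φ * σ g))) (abs-* (σ-bound g cg) (average g cg))))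
        (σ²≥ g cg) 1≤φ ε≥0 ε≤1 ε-small
        where
        lem : ∀ k a b c → k * (a * b * c) ≡ a * (k * (b * c))
        lem = solve-∀ ℚ-ring
        lem′ : ∀ s t f → f * (s * s) - s * t ≡ - (s * (t - f * s))
        lem′ = solve-∀ ℚ-ring
        conclude : ∀ f e s x t → (1ℚ + e) * (1ℚ + e) * (1ℚ + e) - x ≤ f * ((1ℚ + e) * (1ℚ + e) * (1ℚ + e)) - s * t →
          f * (s * s) - s * t ≤ (1ℚ + e) * (f * e) → 1ℚ - ι 15 * (f * e) ≤ s * s → 1ℚ ≤ f → 0ℚ ≤ e → e ≤ 1ℚ → ι 200 * (f * f) * e ≤ 1ℚ → ι 7 ≤ ι 8 * x
        conclude f e s x t a b c f≥1 e≥0 e≤1 small = ≤-trans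
          (≤-by (diff small) (lem₀ (f * f) e))
          (*-monoˡ-≤ (ι≥0 8) (≤-trans weaken main))
          where
          f≥0 : 0ℚ ≤ f
          f≥0 = ≤-trans 0≤1 f≥1
          fe≥0 : 0ℚ ≤ f * e
          fe≥0 = f≥0 ⊗ e≥0
          weaken : 1ℚ - ι 25 * (f * f) * e ≤ 1ℚ - ι 10 * (f * e) - ι 15 * (f * (f * e))
          weaken = ≤-by (ι≥0 10 ⊗ fe≥0 ⊗ diff f≥1) (solve (f ∷ e ∷ []) ℚ-ring)
          lem₀ : ∀ f e → ι 8 * (1ℚ - ι 25 * f * e) - ι 7 ≡ 1ℚ - ι 200 * f * e
          lem₀ = solve-∀ ℚ-ring
          main : 1ℚ - ι 10 * (f * e) - ι 15 * (f * (f * e)) ≤ x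
          main = ≤-by (diff a ⊕ diff b ⊕ f≥0 ⊗ diff c ⊕ (ι≥0 3 ⊗ e≥0 ⊕ ι≥0 3 ⊗ e≥0 ⊗ e≥0 ⊕ e≥0 ⊗ e≥0 ⊗ e≥0) ⊕ f≥0 ⊗ e≥0 ⊗ (ι≥0 5 ⊗ diff e≤1 ⊕ (0≤1 ⊕ e≥0) ⊗ diff e≤1 ⊕ e≥0)) (solve (f ∷ e ∷ s ∷ x ∷ t ∷ []) ℚ-ring)

  opaque
    inverse-of : ∀ w → 1ℚ ≤ w → ∃[ i ] (0ℚ ≤ i × i * w ≡ 1ℚ)
    inverse-of w 1≤w = 1/w , ℚ.<⇒≤ (ℚ.positive⁻¹ 1/w {{ℚ.1/pos⇒pos w {{positive 0<w}}}}) , ℚ.*-inverseˡ w {{>-nonZero 0<w}}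
      where
      0<w : 0ℚ < w
      0<w = ℚ.<-≤-trans 0<1 1≤w
      1/w : ℚ
      1/w = (1/ w) {{>-nonZero 0<w}}

  inverse-small : ∀ {i w k n} → 1 ℕ.≤ n → 0ℚ ≤ i → i * w ≡ 1ℚ → k * ι n ≤ w → k * i ≤ rec n
  inverse-small {i} {w} {k} {n} 1≤n i≥0 iw h = ≤-trans (≤-rec {n} {k * i} {1ℚ} 1≤n (≤-trans (≤-reflexive (lem (ι n) k i))
    (≤-trans (*-monoˡ-≤ i≥0 h) (≤-reflexive iw)))) (≤-reflexive (ℚ.*-identityʳ (rec n)))
    where
    lem : ∀ n k i → n * (k * i) ≡ i * (k * n)
    lem = solve-∀ ℚ-ring

  n<2^n : ∀ n → n ℕ.< 2 ℕ.^ n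
  n<2^n zero    = s≤s z≤n
  n<2^n (suc n) = ℕ.≤-trans (ℕ.≤-trans (ℕ.≤-reflexive (ℕ.+-comm 1 (suc n))) (ℕ.+-mono-≤ (n<2^n n) (ℕ.m^n>0 2 n)))
    (ℕ.≤-reflexive (cong (2 ℕ.^ n ℕ.+_) (sym (ℕ.+-identityʳ (2 ℕ.^ n)))))

  n≤4^n : ∀ n → n ℕ.≤ 2 ℕ.^ (2 ℕ.* n)
  n≤4^n n = ℕ.≤-trans (ℕ.m≤m+n n (n ℕ.+ 0)) (ℕ.<⇒≤ (n<2^n (2 ℕ.* n)))

  -- The convolution identity on the residue classes

  module Correlations (m : ℕ) (2≤m : 2 ℕ.≤ m)
    (X : ℕ) (h : ℕ → ℚ) (h≥0 : ∀ n → 1 ℕ.≤ n → 0ℚ ≤ h n) (h-2≤1 : h 2 ≤ 1ℚ)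
    (ℓ-suc : ∀ n → 1 ℕ.≤ n → n ℕ.< X → ∣ Mangoldt.ℓ h (suc n) - Mangoldt.ℓ h n ∣ ≤ rec n + rec n) where

    open Mangoldt h
    open Residues m 2≤m
    open OscillatingΛ X h h≥0 h-2≤1 ℓ-suc
    open Weighted κ κ≥0
    open PrimesInClasses m 2≤m X h h≥0 h-2≤1 ℓ-suc

    u : ℕ → ℕ → ℚ
    u x g = ∑ x (λ a → ω a * δ g a)

    -- For a unit a this is the weight of the class g / a (see `t-dilate`), written without choosing
    -- an inverse. Hence `conv` below is the convolution of the two measures at g.
    t : ℕ → ℕ → ℕ → ℚ
    t y g a = ∑ y (λ n → ω n * δ g (a ℕ.* n))

    conv : ℕ → ℕ → ℕ → ℚ
    conv y x g = ∑ x (λ a → ω a * t y g a)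

    κω : ∀ a → κ a * ω a ≡ ω a
    κω a with coprime? a m
    ... | yes _ = ℚ.*-identityˡ _
    ... | no  _ = lem (Λ a * rec a)
      where
      lem : ∀ x → 0ℚ * (0ℚ * x) ≡ 0ℚ * x
      lem = solve-∀ ℚ-ring

    u≥0 : ∀ x g → 0ℚ ≤ u x g
    u≥0 x g = ∑-≥0 x (λ a 1≤a _ → ω≥0 a 1≤a ⊗ δ≥0 g a)

    t≥0 : ∀ y g a → 0ℚ ≤ t y g a
    t≥0 y g a = ∑-≥0 y (λ n 1≤n _ → ω≥0 n 1≤n ⊗ δ≥0 g (a ℕ.* n))

    conv≥0 : ∀ y x g → 0ℚ ≤ conv y x g
    conv≥0 y x g = ∑-≥0 x (λ a 1≤a _ → ω≥0 a 1≤a ⊗ t≥0 y g a)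

    u-class : ∀ x → ClassFunction (u x)
    u-class x p = ∑-cong′ x (λ a → cong (ω a *_) (δ-≈ {n = a} {n′ = a} p refl))

    t-class : ∀ y g → ClassFunction (t y g)
    t-class y g {a} {b} p = ∑-cong′ y (λ n → cong (ω n *_) (δ-≈ {g} {a ℕ.* n} {g} {b ℕ.* n} refl (*-≈ {a} {b} {n} {n} p refl)))

    t-dilate : ∀ y {d d′} → d′ ℕ.* d ≈ 1 → ∀ g → t y g d ≡ u y (d′ ℕ.* g)
    t-dilate y {d} {d′} inv g = ∑-cong′ y (λ n → cong (ω n *_) (δ-dilate {d} {d′} inv g n))

    t-cancel : ∀ y a b → Coprime b m → t y (a ℕ.* b) b ≡ t y a 1
    t-cancel y a b cb = ∑-cong′ y (λ n → cong (ω n *_) (δ-cong {a ℕ.* b} {b ℕ.* n} {a} {1 ℕ.* n} (cancel n) (multiply n)))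
      where
      multiply : ∀ n → 1 ℕ.* n ≈ a → b ℕ.* n ≈ a ℕ.* b
      multiply n p = trans (*-≈ {b} {b} {n} {a} refl (trans (cong (ℕ._% m) (sym (ℕ.*-identityˡ n))) p)) (cong (ℕ._% m) (ℕ.*-comm b a))
      cancel : ∀ n → b ℕ.* n ≈ a ℕ.* b → 1 ℕ.* n ≈ a
      cancel n p with inverse cb
      ... | b′ , inv = trans (sym (reduce n)) (trans (*-≈ {b′} {b′} {b ℕ.* n} {b ℕ.* a} refl (trans p (cong (ℕ._% m) (ℕ.*-comm a b))))
        (trans (reduce a) (cong (ℕ._% m) (ℕ.*-identityˡ a))))
        where
        reduce : ∀ n → b′ ℕ.* (b ℕ.* n) ≈ 1 ℕ.* n
        reduce n = trans (cong (ℕ._% m) (sym (ℕ.*-assoc b′ b n))) (*-≈ {b′ ℕ.* b} {1} {n} {n} inv refl)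

    ∑-ω-class : ∀ {F} x → ClassFunction F → ∑ x (λ a → ω a * F a) ≡ ∑ m (λ g → κ g * (u x g * F g))
    ∑-ω-class {F} x cF = trans (∑-cong′ x (λ a → trans (cong (_* F a) (sym (κω a))) (trans (lem₁ (κ a) (ω a) (F a))
        (trans (cong (ω a *_) (sym (∑-δ {λ g → κ g * F g} (λ p → cong₂ _*_ (κ-≈ p) (cF p)) a))) (sym (∑-*ˡ m (ω a)))))))
      (trans (∑-swap x m (λ a g → ω a * (δ g a * (κ g * F g))))
        (∑-cong′ m (λ g → trans (∑-cong′ x (λ a → lem₂ (ω a) (δ g a) (κ g) (F g))) (trans (∑-*ˡ x (κ g * F g)) (lem₃ (κ g) (F g) (u x g))))))
      where
      lem₁ : ∀ k w f → (k * w) * f ≡ w * (k * f)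
      lem₁ = solve-∀ ℚ-ring
      lem₂ : ∀ w d k f → w * (d * (k * f)) ≡ (k * f) * (w * d)
      lem₂ = solve-∀ ℚ-ring
      lem₃ : ∀ k f u → k * f * u ≡ k * (u * f)
      lem₃ = solve-∀ ℚ-ring

    ∑-κu : ∀ x → ∑ m (λ g → κ g * u x g) ≡ W x
    ∑-κu x = trans (∑-cong′ m (λ g → cong (κ g *_) (sym (ℚ.*-identityʳ (u x g)))))
      (trans (sym (∑-ω-class {λ _ → 1ℚ} x (λ _ → refl))) (∑-cong′ x (λ a → ℚ.*-identityʳ (ω a))))

    ∑-κt : ∀ y a → ∑ m (λ g → κ g * t y g a) ≡ κ a * W y
    ∑-κt y a = trans (∑-cong′ m (λ g → sym (∑-*ˡ y (κ g))))
      (trans (∑-swap m y (λ g n → κ g * (ω n * δ g (a ℕ.* n))))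
        (trans (∑-cong′ y (λ n → trans (∑-cong′ m (λ g → lem₁ (κ g) (ω n) (δ g (a ℕ.* n)))) (trans (∑-*ˡ m (ω n))
          (trans (cong (ω n *_) (trans (∑-κδ (a ℕ.* n)) (κ-* a n))) (trans (lem₂ (ω n) (κ a) (κ n)) (cong (κ a *_) (κω n)))))))
          (∑-*ˡ y (κ a))))
      where
      lem₁ : ∀ k w d → k * (w * d) ≡ w * (k * d)
      lem₁ = solve-∀ ℚ-ring
      lem₂ : ∀ w k k′ → w * (k * k′) ≡ k * (k′ * w)
      lem₂ = solve-∀ ℚ-ring

    -- Here the sum runs over the second class argument; multiplication by a unit n permutes the
    -- classes h, so exactly one unit h satisfies h n ≡ g.
    ∑-κt′ : ∀ y g → Coprime g m → ∑ m (λ h → κ h * t y g h) ≡ W y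
    ∑-κt′ y g cg = trans (∑-cong′ m (λ h → sym (∑-*ˡ y (κ h))))
      (trans (∑-swap m y (λ h n → κ h * (ω n * δ g (h ℕ.* n))))
        (∑-cong′ y (λ n → trans (∑-cong′ m (λ h → lem₁ (κ h) (ω n) (δ g (h ℕ.* n)))) (trans (∑-*ˡ m (ω n)) (inner n)))))
      where
      lem₁ : ∀ k w d → k * (w * d) ≡ w * (k * d)
      lem₁ = solve-∀ ℚ-ring
      inner : ∀ n → ω n * ∑ m (λ h → κ h * δ g (h ℕ.* n)) ≡ ω n
      inner n with coprime? n m
      ... | no  _ = lem (Λ n * rec n) _
        where
        lem : ∀ x y → 0ℚ * x * y ≡ 0ℚ * x
        lem = solve-∀ ℚ-ring
      ... | yes cn = trans (cong (1ℚ * (Λ n * rec n) *_) (trans (∑-cong′ m (λ h → cong (λ k → κ h * δ g k) (ℕ.*-comm h n)))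
        (trans (∑-dilate {δ g} (λ p → δ-≈ {g} {_} {g} refl p) cn) (trans (∑-cong′ m (λ h → cong (κ h *_) (δ-sym g h))) (trans (∑-κδ g) (κ-yes cg))))))
        (ℚ.*-identityʳ _)

    E : ℕ → ℕ → ℚ
    E y x = ι 8 * W x + ι 256 * ι y

    module _ {y x : ℕ} (1≤y : 1 ℕ.≤ y) (y≤x : y ℕ.≤ x) (x<X : x ℕ.< X) where

      P : ℕ → ℚ
      P g = ℓ y * u x g + conv y x g

      pair : ∀ {g g′} → Coprime g m → Coprime g′ m → ∣ P g - P g′ ∣ ≤ E y x
      pair {g} {g′} cg cg′ = ≤-trans
        (abs-≡ (two-scales {λ n → δ g n - δ g′ n} {ι 2} (δ-oscillates cg cg′) κ-f 1≤y y≤x x<X)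
          (trans (lem (ℓ y) (u x g) (u x g′) (conv y x g) (conv y x g′))
            (cong₂ (λ a b → ℓ y * a + b)
              (trans (sym (∑-- x)) (∑-cong′ x (λ a → sym (lem₂ (ω a) (δ g a) (δ g′ a)))))
              (trans (sym (∑-- x)) (∑-cong′ x (λ a → trans (sym (lem₂ (ω a) (t y g a) (t y g′ a)))
                (cong (ω a *_) (trans (sym (∑-- y)) (∑-cong′ y (λ n → sym (lem₂ (ω n) (δ g (a ℕ.* n)) (δ g′ (a ℕ.* n)))))))))))))
        (≤-reflexive (lem₃ (W x) (ι y)))
        where
        κ-f : ∀ a e → κ a * (δ g (a ℕ.* e) - δ g′ (a ℕ.* e)) ≡ δ g (a ℕ.* e) - δ g′ (a ℕ.* e)
        κ-f a e = trans (lem₂ (κ a) (δ g (a ℕ.* e)) (δ g′ (a ℕ.* e))) (cong₂ _-_ (κ-δ cg a e) (κ-δ cg′ a e))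
          where
          lem₂ : ∀ k a b → k * (a - b) ≡ k * a - k * b
          lem₂ = solve-∀ ℚ-ring
        lem : ∀ l u v c d → (l * u + c) - (l * v + d) ≡ l * (u - v) + (c - d)
        lem = solve-∀ ℚ-ring
        lem₂ : ∀ k a b → k * (a - b) ≡ k * a - k * b
        lem₂ = solve-∀ ℚ-ring
        lem₃ : ∀ w y → ι 4 * ι 2 * w + ι 128 * ι 2 * y ≡ ι 8 * w + ι 256 * y
        lem₃ = solve-∀ ℚ-ring

      average-P : ∑ m (λ g → κ g * P g) ≡ W x * (ℓ y + W y)
      average-P = trans (∑-cong′ m (λ g → lem (κ g) (ℓ y) (u x g) (conv y x g))) (trans (∑-+ m)
        (trans (cong₂ _+_ (trans (∑-*ˡ m (ℓ y)) (cong (ℓ y *_) (∑-κu x))) convs) (lem′ (ℓ y) (W x) (W y))))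
        where
        lem : ∀ k l u c → k * (l * u + c) ≡ l * (k * u) + k * c
        lem = solve-∀ ℚ-ring
        lem′ : ∀ l w v → l * w + w * v ≡ w * (l + v)
        lem′ = solve-∀ ℚ-ring
        lem₁ : ∀ k w d → k * (w * d) ≡ w * (k * d)
        lem₁ = solve-∀ ℚ-ring
        lem₂ : ∀ w k v → w * (k * v) ≡ k * w * v
        lem₂ = solve-∀ ℚ-ring
        convs : ∑ m (λ g → κ g * conv y x g) ≡ W x * W y
        convs = trans (∑-cong′ m (λ g → sym (∑-*ˡ x (κ g)))) (trans (∑-swap m x (λ g a → κ g * (ω a * t y g a)))
          (trans (∑-cong′ x (λ a → trans (∑-cong′ m (λ g → lem₁ (κ g) (ω a) (t y g a))) (trans (∑-*ˡ m (ω a))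
            (trans (cong (ω a *_) (∑-κt y a)) (trans (lem₂ (ω a) (κ a) (W y)) (cong (_* W y) (κω a)))))))
            (∑-*ʳ x (W y))))

      -- By `pair` the values of `P` on any two unit classes nearly agree, so each is close to their
      -- average, and the average is known from the total masses alone.
      P≈ : ∀ {g} → Coprime g m → ∣ φ * P g - W x * (ℓ y + W y) ∣ ≤ φ * E y x
      P≈ {g} cg = ≤-trans (abs-≡ (∑-abs {λ g′ → κ g′ * (P g - P g′)} {λ g′ → κ g′ * E y x} m (λ g′ _ _ → κ-abs {g′} (λ cg′ → pair cg cg′)))
          (sym (trans (∑-cong′ m (λ g′ → lem (κ g′) (P g) (P g′))) (trans (∑-- m) (cong₂ _-_ (∑-*ʳ m (P g)) average-P)))))
        (≤-reflexive (∑-*ʳ m (E y x)))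
        where
        lem : ∀ k a b → k * (a - b) ≡ k * a - k * b
        lem = solve-∀ ℚ-ring

      module _ {iy ix θ : ℚ} (iy≥0 : 0ℚ ≤ iy) (ix≥0 : 0ℚ ≤ ix) (iyℓ : iy * ℓ y ≡ 1ℚ) (ixW : ix * W x ≡ 1ℚ)
        (iy≤θ : iy ≤ θ) (iy≤1 : iy ≤ 1ℚ) (yix≤θ : ι y * ix ≤ θ) where

        private
          c̃ : ℚ
          c̃ = ι 64 * (ι m * ι m)

          -- Divided by ℓ y W x, the error `E y x` becomes 8 / ℓ y + 256 y / (ℓ y W x). Both
          -- quotients are at most θ times their coefficients, and 264 = 8 + 256.
          E-scaled : φ * (iy * ix * E y x) ≤ ι 264 * (φ * θ)
          E-scaled = ≤-trans (≤-reflexive (trans (lem₁ φ iy ix (W x) (ι y)) (cong (λ z → φ * (ι 8 * (iy * z) + ι 256 * (iy * (ι y * ix)))) ixW)))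
            (conclude φ iy θ (ι y * ix) φ≥0 iy≤θ iy≤1 yix≤θ (ι≥0 y ⊗ ix≥0))
            where
            lem₁ : ∀ f i j w y → f * (i * j * (ι 8 * w + ι 256 * y)) ≡ f * (ι 8 * (i * (j * w)) + ι 256 * (i * (y * j)))
            lem₁ = solve-∀ ℚ-ring
            conclude : ∀ f i θ v → 0ℚ ≤ f → i ≤ θ → i ≤ 1ℚ → v ≤ θ → 0ℚ ≤ v → f * (ι 8 * (i * 1ℚ) + ι 256 * (i * v)) ≤ ι 264 * (f * θ)
            conclude f i θ v f≥0 a b c d = ≤-by (f≥0 ⊗ (ι≥0 8 ⊗ diff a ⊕ ι≥0 256 ⊗ d ⊗ diff b ⊕ ι≥0 256 ⊗ diff c)) (solve (f ∷ i ∷ θ ∷ v ∷ []) ℚ-ring)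

        -- Discarding the nonnegative convolution from `P` leaves φ ℓ y u ≤ W x (ℓ y + W y) up to
        -- the error; after division the two summands give 1 each because W y is close to ℓ y.
        u-upper : ∀ {g} → Coprime g m → φ * (ix * u x g) ≤ ι 2 + θ * c̃ + ι 264 * (φ * θ)
        u-upper {g} cg = conclude (φ * P g) (W x) (ℓ y) (W y) (φ * E y x) (iy * ix) (φ * (ix * u x g)) c̃ iy θ (ι 264 * (φ * θ))
          (abs-upper (P≈ cg)) (iy≥0 ⊗ ix≥0)
          (≤-trans (≤-reflexive (trans (sym (ℚ.*-identityˡ (φ * (ix * u x g)))) (trans (cong (_* (φ * (ix * u x g))) (sym iyℓ)) (lem₁ iy (ℓ y) φ ix (u x g)))))
            (*-monoˡ-≤ (iy≥0 ⊗ ix≥0) (*-monoˡ-≤ φ≥0 (≤-by (conv≥0 y x g) (lem₂ (ℓ y * u x g) (conv y x g))))))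
          (trans (lem₃ iy ix (W x) (ℓ y)) (cong₂ _*_ ixW iyℓ))
          (trans (lem₄ iy ix (W x) (W y)) (trans (cong (_* (iy * W y)) ixW) (ℚ.*-identityˡ (iy * W y))))
          (≤-trans (*-monoˡ-≤ iy≥0 (abs-upper (mertens y 1≤y (ℕ.≤-<-trans y≤x x<X)))) (*-monoʳ-≤ (ι≥0 64 ⊗ (ι≥0 m ⊗ ι≥0 m)) iy≤θ))
          iyℓ (≤-trans (≤-reflexive (lem₅ iy ix φ (E y x))) E-scaled)
          where
          lem₁ : ∀ i l f j u → (i * l) * (f * (j * u)) ≡ i * j * (f * (l * u))
          lem₁ = solve-∀ ℚ-ring
          lem₂ : ∀ a b → (a + b) - a ≡ b
          lem₂ = solve-∀ ℚ-ring
          lem₃ : ∀ i j w l → i * j * (w * l) ≡ (j * w) * (i * l)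
          lem₃ = solve-∀ ℚ-ring
          lem₄ : ∀ i j w l → i * j * (w * l) ≡ (j * w) * (i * l)
          lem₄ = solve-∀ ℚ-ring
          lem₅ : ∀ i j f e → i * j * (f * e) ≡ f * (i * j * e)
          lem₅ = solve-∀ ℚ-ring
          conclude : ∀ fP w l v fE ij out c i θ b → fP - w * (l + v) ≤ fE → 0ℚ ≤ ij → out ≤ ij * fP → ij * (w * l) ≡ 1ℚ * 1ℚ → ij * (w * v) ≡ i * v →
            i * (v - l) ≤ θ * c → i * l ≡ 1ℚ → ij * fE ≤ b → out ≤ ι 2 + θ * c + b
          conclude fP w l v fE ij out c i θ b h₁ h₂ h₃ h₄ h₅ h₆ h₇ h₈ =
            ≤-by (h₂ ⊗ diff h₁ ⊕ diff h₃ ⊕ diff (≤-reflexive h₄) ⊕ diff (≤-reflexive h₅) ⊕ diff h₆ ⊕ diff (≤-reflexive h₇) ⊕ diff h₈)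
              (solve (fP ∷ w ∷ l ∷ v ∷ fE ∷ ij ∷ out ∷ c ∷ i ∷ θ ∷ b ∷ []) ℚ-ring)

        σ : ℕ → ℚ
        σ g = 1ℚ - φ * (ix * u x g)

        τ : ℕ → ℕ → ℚ
        τ g h = 1ℚ - φ * (iy * t y g h)

        -- The affine substitution 1 - φ u turns the inhomogeneous identity for u and v into a
        -- homogeneous one: convolving with τ reproduces φ σ. The difference is exactly φ iy ix
        -- times the quantity bounded in `P≈`.
        στ-average : ∀ g → Coprime g m → ∣ ∑ m (λ h → κ h * (σ h * τ g h)) - φ * σ g ∣ ≤ φ * (ι 264 * (φ * θ))
        στ-average g cg = ≤-trans
          (abs-≡ (abs-scale (φ≥0 ⊗ (iy≥0 ⊗ ix≥0)) (P≈ cg))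
            (trans (cong (_- φ * σ g) expand) (finish φ (W x) (W y) (ℓ y) iy ix (u x g) (conv y x g) ixW iyℓ)))
          (≤-trans (≤-reflexive (lem₀ φ (iy * ix) (E y x))) (*-monoˡ-≤ φ≥0 E-scaled))
          where
          lem₀ : ∀ f i e → f * i * (f * e) ≡ f * (f * (i * e))
          lem₀ = solve-∀ ℚ-ring
          conv-class : ∑ m (λ h → κ h * (u x h * t y g h)) ≡ conv y x g
          conv-class = sym (∑-ω-class {t y g} x (t-class y g))
          pointwise : ∀ k f i j u t → k * ((1ℚ - f * (j * u)) * (1ℚ - f * (i * t))) ≡ (k - f * j * (k * u)) + (f * j * (f * i) * (k * (u * t)) - f * i * (k * t))
          pointwise = solve-∀ ℚ-ring
          expand : ∑ m (λ h → κ h * (σ h * τ g h)) ≡ (φ - φ * ix * W x) + (φ * ix * (φ * iy) * conv y x g - φ * iy * W y)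
          expand = trans (∑-cong′ m (λ h → pointwise (κ h) φ iy ix (u x h) (t y g h))) (trans (∑-+ m) (cong₂ _+_
            (trans (∑-- m) (cong (λ z → φ - z) (trans (∑-*ˡ m (φ * ix)) (cong (φ * ix *_) (∑-κu x)))))
            (trans (∑-- m) (cong₂ _-_ (trans (∑-*ˡ m (φ * ix * (φ * iy))) (cong (φ * ix * (φ * iy) *_) conv-class))
              (trans (∑-*ˡ m (φ * iy)) (cong (φ * iy *_) (∑-κt′ y g cg)))))))
          finish : ∀ f w v l i j u c → j * w ≡ 1ℚ → i * l ≡ 1ℚ →
            ((f - f * j * w) + (f * j * (f * i) * c - f * i * v)) - f * (1ℚ - f * (j * u)) ≡ (f * (i * j)) * (f * (l * u + c) - w * (l + v))
          finish f w v l i j u c jw il = trans (left f w v i j u c) (trans (cong (λ a → - (f * a) + f * f * (i * j) * c - f * i * v + f * f * j * u) jw)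
            (trans (middle f v i j u c) (trans (sym (cong₂ (λ a b → f * f * j * u * b + f * f * (i * j) * c - f * a * b - f * i * v * a) jw il)) (sym (right f w v l i j u c)))))
            where
            left : ∀ f w v i j u c → ((f - f * j * w) + (f * j * (f * i) * c - f * i * v)) - f * (1ℚ - f * (j * u)) ≡ - (f * (j * w)) + f * f * (i * j) * c - f * i * v + f * f * j * u
            left = solve-∀ ℚ-ring
            middle : ∀ f v i j u c → - (f * 1ℚ) + f * f * (i * j) * c - f * i * v + f * f * j * u ≡ f * f * j * u * 1ℚ + f * f * (i * j) * c - f * 1ℚ * 1ℚ - f * i * v * 1ℚ
            middle = solve-∀ ℚ-ring
            right : ∀ f w v l i j u c → (f * (i * j)) * (f * (l * u + c) - w * (l + v)) ≡ f * f * j * u * (i * l) + f * f * (i * j) * c - f * (j * w) * (i * l) - f * i * v * (j * w)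
            right = solve-∀ ℚ-ring

  -- 1 / tolerance m and 1 / precision m play the role of ε and θ.
  tolerance precision : ℕ → ℕ
  tolerance m = 200 ℕ.* (m ℕ.* m)
  precision m = 800 ℕ.* (m ℕ.* m) ℕ.* tolerance m

  private
    ±1-* : ∀ {a b} → a ≡ 1ℚ ⊎ a ≡ - 1ℚ → b ≡ 1ℚ ⊎ b ≡ - 1ℚ → a * b ≡ 1ℚ ⊎ a * b ≡ - 1ℚ
    ±1-* (inj₁ p) (inj₁ q) = inj₁ (cong₂ _*_ p q)
    ±1-* (inj₁ p) (inj₂ q) = inj₂ (cong₂ _*_ p q)
    ±1-* (inj₂ p) (inj₁ q) = inj₂ (cong₂ _*_ p q)
    ±1-* (inj₂ p) (inj₂ q) = inj₁ (cong₂ _*_ p q)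

    ±1-abs : ∀ {a} → a ≡ 1ℚ ⊎ a ≡ - 1ℚ → ∣ a ∣ ≤ 1ℚ
    ±1-abs (inj₁ p) = abs-≡ (abs-nonneg 0≤1 ≤-refl) p
    ±1-abs (inj₂ p) = abs-≡ (abs-neg {1ℚ} (abs-nonneg 0≤1 ≤-refl)) p

    0or±1 : ∀ {a b} → a ≡ 0ℚ ⊎ a ≡ 1ℚ → b ≡ 1ℚ ⊎ b ≡ - 1ℚ → a * b ≡ 0ℚ ⊎ a * b ≡ 1ℚ ⊎ a * b ≡ - 1ℚ
    0or±1 {b = b} (inj₁ p) _ = inj₁ (trans (cong (_* b) p) (ℚ.*-zeroˡ b))
    0or±1 (inj₂ p) (inj₁ q) = inj₂ (inj₁ (cong₂ _*_ p q))
    0or±1 (inj₂ p) (inj₂ q) = inj₂ (inj₂ (cong₂ _*_ p q))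

    *-cancelʳ-≡ : ∀ {a b c} → ¬ (c ≡ 0ℚ) → a * c ≡ b * c → a ≡ b
    *-cancelʳ-≡ {a} {b} {c} c≢0 e = trans (sym (cancel a)) (trans (cong (_* 1/c) e) (cancel b))
      where
      1/c : ℚ
      1/c = (1/ c) {{≢-nonZero c≢0}}
      cancel : ∀ a → (a * c) * 1/c ≡ a
      cancel a = trans (ℚ.*-assoc a c 1/c) (trans (cong (a *_) (ℚ.*-inverseʳ c {{≢-nonZero c≢0}})) (ℚ.*-identityʳ a))

  -- A class with finitely many primes yields an impossible real character

  module Contradiction (m : ℕ) (2≤m : 2 ℕ.≤ m)
    (X : ℕ) (h : ℕ → ℚ) (h≥0 : ∀ n → 1 ℕ.≤ n → 0ℚ ≤ h n) (h-2≤1 : h 2 ≤ 1ℚ)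
    (ℓ-suc : ∀ n → 1 ℕ.≤ n → n ℕ.< X → ∣ Mangoldt.ℓ h (suc n) - Mangoldt.ℓ h n ∣ ≤ rec n + rec n) where

    open Mangoldt h
    open Residues m 2≤m
    open OscillatingΛ X h h≥0 h-2≤1 ℓ-suc
    open Weighted κ κ≥0
    open PrimesInClasses m 2≤m X h h≥0 h-2≤1 ℓ-suc
    open Correlations m 2≤m X h h≥0 h-2≤1 ℓ-suc hiding (σ; τ)

    c̃ : ℚ
    c̃ = ι 64 * (ι m * ι m)

    -- The scales (y, x) give the averaging identity and the bound for σ. The scales (z, y) bound
    -- `u y` and thereby τ. All further steps, from the character to its series, take place at y.
    contradiction : ∀ {α N x y z} → Coprime α m → (∀ p → Prime p → p ≈ α → p ℕ.< N) →
      1 ℕ.≤ z → z ℕ.≤ y → y ℕ.≤ x → x ℕ.< X →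
      ι (precision m) ≤ ℓ z → ι z * ι (precision m) ≤ W y → ι (precision m) ≤ ℓ y → ι 4 * c̃ ≤ ℓ y →
      ι 512 * (ι m * ι (scale-M m)) + 1ℚ ≤ ℓ y → scale-A m ℕ.≤ y →
      ι y * ι (precision m) ≤ W x → (ι 2 * ι N + ι 4) * ι (precision m) ≤ W x → ⊥
    contradiction {α} {N} {x} {y} {z} cα few 1≤z z≤y y≤x x<X ℓz Wy ℓy 4c̃≤ℓ big A≤y Wx Wx′ = finale
      where
      T = tolerance m
      Q = precision m
      ε θ c p : ℚ
      ε = rec T
      θ = rec Q
      c = θ * c̃
      p = ι 264 * (φ * θ)

      1≤y : 1 ℕ.≤ y
      1≤y = ℕ.≤-trans 1≤z z≤y
      1≤mm : 1 ℕ.≤ m ℕ.* m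
      1≤mm = ℕ.*-mono-≤ 1≤m 1≤m
      1≤T : 1 ℕ.≤ T
      1≤T = ℕ.*-mono-≤ {1} {200} (s≤s z≤n) 1≤mm
      1≤Q : 1 ℕ.≤ Q
      1≤Q = ℕ.*-mono-≤ {1} {800 ℕ.* (m ℕ.* m)} (ℕ.*-mono-≤ {1} {800} (s≤s z≤n) 1≤mm) 1≤T
      1≤ιQ : 1ℚ ≤ ι Q
      1≤ιQ = 1≤ι 1≤Q
      ε≥0 : 0ℚ ≤ ε
      ε≥0 = rec≥0 T
      θ≥0 : 0ℚ ≤ θ
      θ≥0 = rec≥0 Q
      c̃≥0 : 0ℚ ≤ c̃
      c̃≥0 = ι≥0 64 ⊗ (ι≥0 m ⊗ ι≥0 m)
      c≥0 : 0ℚ ≤ c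
      c≥0 = θ≥0 ⊗ c̃≥0
      p≥0 : 0ℚ ≤ p
      p≥0 = ι≥0 264 ⊗ (φ≥0 ⊗ θ≥0)

      εT : ι 200 * (ι m * ι m) * ε ≡ 1ℚ
      εT = trans (cong (_* ε) (sym (trans (ι-* 200 (m ℕ.* m)) (cong (ι 200 *_) (ι-* m m))))) (ι*rec 1≤T)

      θQ : ι 800 * (ι m * ι m) * θ ≡ ε
      θQ = trans (lem (ι 800 * (ι m * ι m)) (rec (800 ℕ.* (m ℕ.* m))) (rec T) (rec-* {800 ℕ.* (m ℕ.* m)} {T} (ℕ.*-mono-≤ {1} {800} (s≤s z≤n) 1≤mm) 1≤T))
        (trans (cong (_* ε) (trans (cong (_* rec (800 ℕ.* (m ℕ.* m))) (sym (trans (ι-* 800 (m ℕ.* m)) (cong (ι 800 *_) (ι-* m m)))))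
          (ι*rec (ℕ.*-mono-≤ {1} {800} (s≤s z≤n) 1≤mm)))) (ℚ.*-identityˡ ε))
        where
        lem : ∀ a b e {t} → t ≡ b * e → a * t ≡ (a * b) * e
        lem a b e refl = sym (ℚ.*-assoc a b e)

      -- Here c is the relative error of Mertens' estimate and p that of the convolution identity.
      -- The bound for τ needs (2 + c + p) (1 + c) ≤ 2 + 4 c + 2 p, and 4 · 64 m² + 2 · 264 φ ≤ 784
      -- m² explains the 800 in `precision`.
      4c+2p≤ε : ι 4 * c + ι 2 * p ≤ ε
      4c+2p≤ε = subst (ι 4 * c + ι 2 * p ≤_) θQ (lem (ι m) φ θ φ≤m (1≤ι 1≤m) θ≥0)
        where
        lem : ∀ m f t → f ≤ m → 1ℚ ≤ m → 0ℚ ≤ t → ι 4 * (t * (ι 64 * (m * m))) + ι 2 * (ι 264 * (f * t)) ≤ ι 800 * (m * m) * t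
        lem m f t a b t≥0 = ≤-by (t≥0 ⊗ (ι≥0 528 ⊗ diff a ⊕ ι≥0 528 ⊗ (≤-trans 0≤1 b ⊗ diff b) ⊕ ι≥0 16 ⊗ square≥0 m)) (solve (m ∷ f ∷ t ∷ []) ℚ-ring)

      200ε≤1 : ι 200 * ε ≤ 1ℚ
      200ε≤1 = subst (ι 200 * ε ≤_) εT (lem (ι m) ε (1≤ι 1≤m) ε≥0)
        where
        lem : ∀ m e → 1ℚ ≤ m → 0ℚ ≤ e → ι 200 * e ≤ ι 200 * (m * m) * e
        lem m e a e≥0 = ≤-by (ι≥0 200 ⊗ e≥0 ⊗ (diff a ⊗ diff a ⊕ diff a ⊕ diff a)) (solve (m ∷ e ∷ []) ℚ-ring)

      ε-small : ι 200 * (φ * φ) * ε ≤ 1ℚ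
      ε-small = subst (ι 200 * (φ * φ) * ε ≤_) εT (*-monoʳ-≤ ε≥0 (*-monoˡ-≤ (ι≥0 200) (*-mono-≤₀ φ≥0 (ι≥0 m) φ≤m φ≤m)))

      c≤1 : c ≤ 1ℚ
      c≤1 = lem c p ε 4c+2p≤ε 200ε≤1 c≥0 p≥0 ε≥0
        where
        lem : ∀ c p e → ι 4 * c + ι 2 * p ≤ e → ι 200 * e ≤ 1ℚ → 0ℚ ≤ c → 0ℚ ≤ p → 0ℚ ≤ e → c ≤ 1ℚ
        lem c p e a b c≥0 p≥0 e≥0 = ≤-by (diff a ⊕ diff b ⊕ ι≥0 3 ⊗ c≥0 ⊕ ι≥0 2 ⊗ p≥0 ⊕ ι≥0 199 ⊗ e≥0) (solve (c ∷ p ∷ e ∷ []) ℚ-ring)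

      p≤ε : p ≤ ε
      p≤ε = lem c p ε 4c+2p≤ε c≥0 p≥0
        where
        lem : ∀ c p e → ι 4 * c + ι 2 * p ≤ e → 0ℚ ≤ c → 0ℚ ≤ p → p ≤ e
        lem c p e a c≥0 p≥0 = ≤-by (diff a ⊕ ι≥0 4 ⊗ c≥0 ⊕ p≥0) (solve (c ∷ p ∷ e ∷ []) ℚ-ring)

      1≤Wy : 1ℚ ≤ W y
      1≤Wy = ≤-trans (≤-trans 1≤ιQ (≤-trans (≤-reflexive (sym (ℚ.*-identityˡ (ι Q)))) (*-monoʳ-≤ (ι≥0 Q) (1≤ι 1≤z)))) Wy
      1≤Wx : 1ℚ ≤ W x
      1≤Wx = ≤-trans (≤-trans 1≤ιQ (≤-trans (≤-reflexive (sym (ℚ.*-identityˡ (ι Q)))) (*-monoʳ-≤ (ι≥0 Q) (1≤ι 1≤y)))) Wx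
      1≤ℓz : 1ℚ ≤ ℓ z
      1≤ℓz = ≤-trans 1≤ιQ ℓz
      1≤ℓy : 1ℚ ≤ ℓ y
      1≤ℓy = ≤-trans 1≤ιQ ℓy

      inverse≤ : ∀ {i w} → 0ℚ ≤ i → i * w ≡ 1ℚ → ι Q ≤ w → i ≤ θ
      inverse≤ {i} {w} i≥0 iw Q≤w = subst (_≤ θ) (ℚ.*-identityˡ i) (inverse-small {i} {w} {1ℚ} 1≤Q i≥0 iw (subst (_≤ w) (sym (ℚ.*-identityˡ (ι Q))) Q≤w))

      θ≤1 : θ ≤ 1ℚ
      θ≤1 = rec≤1 1≤Q

      iz iy iv ix : ℚ
      iz = proj₁ (inverse-of (ℓ z) 1≤ℓz)
      iy = proj₁ (inverse-of (ℓ y) 1≤ℓy)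
      iv = proj₁ (inverse-of (W y) 1≤Wy)
      ix = proj₁ (inverse-of (W x) 1≤Wx)
      iz≥0 = proj₁ (proj₂ (inverse-of (ℓ z) 1≤ℓz))
      iy≥0 = proj₁ (proj₂ (inverse-of (ℓ y) 1≤ℓy))
      iv≥0 = proj₁ (proj₂ (inverse-of (W y) 1≤Wy))
      ix≥0 = proj₁ (proj₂ (inverse-of (W x) 1≤Wx))
      izℓ : iz * ℓ z ≡ 1ℚ
      izℓ = proj₂ (proj₂ (inverse-of (ℓ z) 1≤ℓz))
      iyℓ : iy * ℓ y ≡ 1ℚ
      iyℓ = proj₂ (proj₂ (inverse-of (ℓ y) 1≤ℓy))
      ivW : iv * W y ≡ 1ℚ
      ivW = proj₂ (proj₂ (inverse-of (W y) 1≤Wy))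
      ixW : ix * W x ≡ 1ℚ
      ixW = proj₂ (proj₂ (inverse-of (W x) 1≤Wx))
      iz≤θ = inverse≤ iz≥0 izℓ ℓz
      iy≤θ = inverse≤ iy≥0 iyℓ ℓy
      ziv≤θ : ι z * iv ≤ θ
      ziv≤θ = inverse-small {iv} {W y} {ι z} 1≤Q iv≥0 ivW Wy
      yix≤θ : ι y * ix ≤ θ
      yix≤θ = inverse-small {ix} {W x} {ι y} 1≤Q ix≥0 ixW Wx
      K₀ = ι 2 * ι N + ι 4
      K₀ix≤θ : K₀ * ix ≤ θ
      K₀ix≤θ = inverse-small {ix} {W x} {K₀} 1≤Q ix≥0 ixW Wx′

      σ : ℕ → ℚ
      σ g = 1ℚ - φ * (ix * u x g)
      τ : ℕ → ℕ → ℚ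
      τ g h = 1ℚ - φ * (iy * t y g h)

      u-upper-y : ∀ {g} → Coprime g m → φ * (iv * u y g) ≤ ι 2 + c + p
      u-upper-y = u-upper 1≤z z≤y (ℕ.≤-<-trans y≤x x<X) iz≥0 iv≥0 izℓ ivW iz≤θ (≤-trans iz≤θ θ≤1) ziv≤θ

      u-upper-x : ∀ {g} → Coprime g m → φ * (ix * u x g) ≤ ι 2 + c + p
      u-upper-x = u-upper 1≤y y≤x x<X iy≥0 ix≥0 iyℓ ixW iy≤θ (≤-trans iy≤θ θ≤1) yix≤θ

      close-to-1 : ∀ {a} → 0ℚ ≤ a → a ≤ ι 2 + ε → ∣ 1ℚ - a ∣ ≤ 1ℚ + ε
      close-to-1 {a} a≥0 a≤ = abs-intro (≤-by (a≥0 ⊕ ε≥0) (lem₁ a ε)) (≤-by (diff a≤) (lem₂ a ε))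
        where
        lem₁ : ∀ a e → (1ℚ + e) - (1ℚ - a) ≡ a + e
        lem₁ = solve-∀ ℚ-ring
        lem₂ : ∀ a e → (1ℚ + e) - (- (1ℚ - a)) ≡ (ι 2 + e) - a
        lem₂ = solve-∀ ℚ-ring

      σ-bound : ∀ h → Coprime h m → ∣ σ h ∣ ≤ 1ℚ + ε
      σ-bound h ch = close-to-1 (φ≥0 ⊗ (ix≥0 ⊗ u≥0 x h)) (≤-trans (u-upper-x ch) (lem c p ε 4c+2p≤ε c≥0 p≥0))
        where
        lem : ∀ c p e → ι 4 * c + ι 2 * p ≤ e → 0ℚ ≤ c → 0ℚ ≤ p → ι 2 + c + p ≤ ι 2 + e
        lem c p e a c≥0 p≥0 = ≤-by (diff a ⊕ ι≥0 3 ⊗ c≥0 ⊕ p≥0) (solve (c ∷ p ∷ e ∷ []) ℚ-ring)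

      iyW≤ : iy * W y ≤ 1ℚ + c
      iyW≤ = ≤-by (diff (*-monoˡ-≤ iy≥0 (abs-upper (mertens y 1≤y (ℕ.≤-<-trans y≤x x<X)))) ⊕ c̃≥0 ⊗ diff iy≤θ ⊕ diff (≤-reflexive iyℓ)) (lem iy (W y) (ℓ y) c̃ θ)
        where
        lem : ∀ i w l c t → (1ℚ + t * c) - i * w ≡ (i * c - i * (w - l)) + (c * (t - i) + (1ℚ - i * l))
        lem = solve-∀ ℚ-ring

      τ-bound : ∀ g h → Coprime g m → Coprime h m → ∣ τ g h ∣ ≤ 1ℚ + ε
      τ-bound g h cg ch = close-to-1 (φ≥0 ⊗ (iy≥0 ⊗ t≥0 y g h))
        (≤-trans (≤-reflexive (trans (cong (λ z → φ * (iy * z)) (t-dilate y {h} {h′} inv g)) (trans (sym (ℚ.*-identityˡ _)) (trans (cong (_* (φ * (iy * u y (h′ ℕ.* g)))) (sym ivW)) (lem₁ iv (W y) φ iy (u y (h′ ℕ.* g)))))))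
          (≤-trans (*-mono-≤₀ (φ≥0 ⊗ (iv≥0 ⊗ u≥0 y (h′ ℕ.* g))) (0≤1 ⊕ c≥0)
            (u-upper-y (coprime-* {h′} {g} (coprime-*ˡ {h′} {h} (≈-coprime {1} {h′ ℕ.* h} (sym inv) coprime-1)) cg)) iyW≤)
            (lem₂ c p ε 4c+2p≤ε c≥0 p≥0 c≤1)))
        where
        h′ = proj₁ (inverse ch)
        inv : h′ ℕ.* h ≈ 1
        inv = proj₂ (inverse ch)
        lem₁ : ∀ v w f i u → (v * w) * (f * (i * u)) ≡ (f * (v * u)) * (i * w)
        lem₁ = solve-∀ ℚ-ring
        lem₂ : ∀ c p e → ι 4 * c + ι 2 * p ≤ e → 0ℚ ≤ c → 0ℚ ≤ p → c ≤ 1ℚ → (ι 2 + c + p) * (1ℚ + c) ≤ ι 2 + e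
        lem₂ c p e a c≥0 p≥0 c≤1 = ≤-by (diff a ⊕ (c≥0 ⊕ p≥0) ⊗ diff c≤1) (solve (c ∷ p ∷ e ∷ []) ℚ-ring)

      average : ∀ g → Coprime g m → ∣ ∑ m (λ h → κ h * (σ h * τ g h)) - φ * σ g ∣ ≤ φ * ε
      average g cg = ≤-trans (στ-average 1≤y y≤x x<X iy≥0 ix≥0 iyℓ ixW iy≤θ (≤-trans iy≤θ θ≤1) yix≤θ g cg) (*-monoˡ-≤ φ≥0 p≤ε)

      σα : 1ℚ - ε ≤ σ α
      σα = lem φ ε θ (ix * u x α) (≤-trans (≤-trans (*-monoˡ-≤ ix≥0 (class-bounded {α} {N} x<X few)) (≤-reflexive (ℚ.*-comm ix K₀))) K₀ix≤θ) p≤ε φ≥0 θ≥0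
        where
        lem : ∀ f e t u → u ≤ t → ι 264 * (f * t) ≤ e → 0ℚ ≤ f → 0ℚ ≤ t → 1ℚ - e ≤ 1ℚ - f * u
        lem f e t u a b f≥0 t≥0 = ≤-by (f≥0 ⊗ diff a ⊕ diff b ⊕ ι≥0 263 ⊗ f≥0 ⊗ t≥0) (solve (f ∷ e ∷ t ∷ u ∷ []) ℚ-ring)

      σ-cl : ClassFunction σ
      σ-cl q = cong (λ z → 1ℚ - φ * (ix * z)) (u-class x q)
      τ-cl : ∀ g → ClassFunction (τ g)
      τ-cl g {a} {b} q = cong (λ z → 1ℚ - φ * (iy * z)) (t-class y g {a} {b} q)

      near-one : ∀ g h → Coprime g m → Coprime h m → ι 7 ≤ ι 8 * (σ g * σ h * τ g h)
      near-one = Extremal.near-one m 2≤m σ τ ε ε≥0 ε-small σ-cl τ-cl σ-bound τ-bound average α cα σα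

      e : ℕ → ℚ
      e g = sgn (σ g)

      -- Since e g e h depends only on g / h, the sign function is a character up to a global sign;
      -- the factor e 1 normalises it to 1 at the class of 1.
      F : ℕ → ℚ
      F g = e g * e 1

      χ : ℕ → ℚ
      χ g = κ g * F g

      F-class : ClassFunction F
      F-class q = cong (λ z → sgn z * e 1) (σ-cl q)

      e-τ : ∀ {g h} → Coprime g m → Coprime h m → e g * e h ≡ sgn (τ g h)
      e-τ {g} {h} cg ch = sgn-* (σ g) (σ h) (τ g h) (near-one g h cg ch)

      τ-cancel : ∀ a b → Coprime b m → τ (a ℕ.* b) b ≡ τ a 1
      τ-cancel a b cb = cong (λ z → 1ℚ - φ * (iy * z)) (t-cancel y a b cb)

      -- e (a b) e b = sgn (τ (a b) b) = sgn (τ a 1) = e a e 1.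
      F-* : ∀ a b → Coprime a m → Coprime b m → F (a ℕ.* b) ≡ F a * F b
      F-* a b ca cb = finish (e (a ℕ.* b)) (e a) (e b) (e 1) (trans (e-τ (coprime-* ca cb) cb) (trans (cong sgn (τ-cancel a b cb)) (sym (e-τ ca coprime-1))))
        (sgn² (σ b)) (sgn² (σ 1))
        where
        finish : ∀ ab a b o → ab * b ≡ a * o → b * b ≡ 1ℚ → o * o ≡ 1ℚ → ab * o ≡ (a * o) * (b * o)
        finish ab a b o h₁ h₂ h₃ = trans (lem₁ ab o) (trans (cong (λ z → ab * o * z) (sym h₂)) (trans (lem₂ ab o b) (trans (cong (_* (b * o)) h₁) refl)))
          where
          lem₁ : ∀ ab o → ab * o ≡ ab * o * 1ℚ
          lem₁ = solve-∀ ℚ-ring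
          lem₂ : ∀ ab o b → ab * o * (b * b) ≡ (ab * b) * (b * o)
          lem₂ = solve-∀ ℚ-ring

      F-value : ∀ g → F g ≡ 1ℚ ⊎ F g ≡ - 1ℚ
      F-value g = ±1-* (sgn-value (σ g)) (sgn-value (σ 1))

      ∣F∣≤1 : ∀ g → ∣ F g ∣ ≤ 1ℚ
      ∣F∣≤1 g = ±1-abs (F-value g)

      t-1 : ∀ g → t y g 1 ≡ u y g
      t-1 g = ∑-cong′ y (λ n → cong (λ k → ω n * δ g k) (ℕ.*-identityˡ n))

      -- If F g = - 1 the left side vanishes. If F g = 1 then τ g 1 is nonnegative, and `near-one`
      -- with |σ| ≤ 1 + ε pushes it up to 3/4, so that φ u y g is at most ℓ y / 4.
      large-class : ∀ g → Coprime g m → ι 2 * (φ * (u y g * (1ℚ + F g))) ≤ ℓ y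
      large-class g cg = case-of (F-value g)
        where
        case-of : F g ≡ 1ℚ ⊎ F g ≡ - 1ℚ → ι 2 * (φ * (u y g * (1ℚ + F g))) ≤ ℓ y
        case-of (inj₂ F≡-1) = ≤-trans (≤-reflexive (trans (cong (λ z → ι 2 * (φ * (u y g * (1ℚ + z)))) F≡-1) (lem φ (u y g)))) (≤-trans 0≤1 1≤ℓy)
         where
         lem : ∀ f u → ι 2 * (f * (u * (1ℚ + - 1ℚ))) ≡ 0ℚ
         lem = solve-∀ ℚ-ring
        case-of (inj₁ F≡1) = ≤-trans (≤-reflexive (trans (cong (λ z → ι 2 * (φ * (u y g * (1ℚ + z)))) F≡1) (sym (lem φ (u y g)))))
         (conclude φ iy (u y g) (ℓ y) iyℓ (≤-trans 0≤1 1≤ℓy) (subst (λ z → ι 3 ≤ ι 4 * (1ℚ - φ * (iy * z))) (t-1 g) 3≤4τ))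
         where
         lem : ∀ f u → ι 4 * (f * u) ≡ ι 2 * (f * (u * (1ℚ + 1ℚ)))
         lem = solve-∀ ℚ-ring
         τ≥0 : 0ℚ ≤ τ g 1
         τ≥0 = sgn-≥0 (τ g 1) (trans (sym (e-τ cg coprime-1)) F≡1)
         3≤4τ : ι 3 ≤ ι 4 * τ g 1
         3≤4τ = *-cancel-≤ {ι 2} (1≤ι {2} (s≤s z≤n)) (lem₁ (σ g * σ 1) (τ g 1) ε (near-one g 1 cg coprime-1)
           (abs-upper (abs-* (σ-bound g cg) (σ-bound 1 coprime-1))) τ≥0 (abs-upper (τ-bound g 1 cg coprime-1)) ε≥0 200ε≤1)
           where
           lem₁ : ∀ s t e → ι 7 ≤ ι 8 * (s * t) → s ≤ (1ℚ + e) * (1ℚ + e) → 0ℚ ≤ t → t ≤ 1ℚ + e → 0ℚ ≤ e → ι 200 * e ≤ 1ℚ → ι 2 * ι 3 ≤ ι 2 * (ι 4 * t)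
           lem₁ s t e a b t≥0 d e≥0 f = ≤-trans step₁ (≤-by (ι≥0 24 ⊗ e≥0 ⊗ diff d ⊕ ι≥0 8 ⊗ t≥0 ⊗ (e≥0 ⊗ diff e≤1) ⊕ diff f ⊕ ι≥0 24 ⊗ e≥0 ⊗ diff e≤1 ⊕ ι≥0 152 ⊗ e≥0) (solve (t ∷ e ∷ []) ℚ-ring))
             where
             e≤1 : e ≤ 1ℚ
             e≤1 = ≤-by (diff f ⊕ ι≥0 199 ⊗ e≥0) (solve (e ∷ []) ℚ-ring)
             step₁ : ι 2 * ι 3 ≤ ι 8 * ((1ℚ + e) * (1ℚ + e) * t) - 1ℚ
             step₁ = ≤-by (diff a ⊕ ι≥0 8 ⊗ t≥0 ⊗ diff b) (solve (s ∷ t ∷ e ∷ []) ℚ-ring)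
         conclude : ∀ f i u l → i * l ≡ 1ℚ → 0ℚ ≤ l → ι 3 ≤ ι 4 * (1ℚ - f * (i * u)) → ι 4 * (f * u) ≤ l
         conclude f i u l il l≥0 a = ≤-trans (≤-reflexive (trans (lem₁ f u) (trans (cong (λ z → ι 4 * (f * u) * z) (sym il)) (lem₂ f u i l)))) (≤-by (l≥0 ⊗ diff a) (solve (f ∷ i ∷ u ∷ l ∷ []) ℚ-ring))
           where
           lem₁ : ∀ f u → ι 4 * (f * u) ≡ ι 4 * (f * u) * 1ℚ
           lem₁ = solve-∀ ℚ-ring
           lem₂ : ∀ f u i l → ι 4 * (f * u) * (i * l) ≡ l * (ι 4 * (f * (i * u)))
           lem₂ = solve-∀ ℚ-ring

      Z : ℚ
      Z = ∑ y (λ n → ω n * F n)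

      Z-class : Z ≡ ∑ m (λ g → κ g * (u y g * F g))
      Z-class = ∑-ω-class y F-class

      -- Summing `large-class` over the unit classes gives 2 (W y + Z) ≤ ℓ y, while W y is at least
      -- ℓ y - c̃ and c̃ at most ℓ y / 4.
      4Z≤ : ι 4 * Z ≤ - ℓ y
      4Z≤ = conclude Z (W y) (ℓ y) c̃ (*-cancel-≤ {φ} 1≤φ total) (abs-lower (mertens y 1≤y (ℕ.≤-<-trans y≤x x<X))) 4c̃≤ℓ
        where
        total : φ * (ι 2 * (W y + Z)) ≤ φ * ℓ y
        total = ≤-trans (≤-reflexive (sym (trans (∑-cong′ m (λ g → lem (κ g) φ (u y g) (F g))) (trans (∑-*ˡ m (ι 2 * φ)) (trans (cong (ι 2 * φ *_) (trans (∑-+ m) (cong₂ _+_ (∑-κu y) (sym Z-class)))) (lem′ φ (W y + Z)))))))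
          (≤-trans (∑-mono m (λ g _ _ → κ-mono {g} (large-class g))) (≤-reflexive (∑-*ʳ m (ℓ y))))
          where
          lem : ∀ k f u F → k * (ι 2 * (f * (u * (1ℚ + F)))) ≡ (ι 2 * f) * (k * u + k * (u * F))
          lem = solve-∀ ℚ-ring
          lem′ : ∀ f w → ι 2 * f * w ≡ f * (ι 2 * w)
          lem′ = solve-∀ ℚ-ring
        conclude : ∀ z w l c → ι 2 * (w + z) ≤ l → - (w - l) ≤ c → ι 4 * c ≤ l → ι 4 * z ≤ - l
        conclude z w l c h₁ h₂ h₃ = ≤-by (ι≥0 2 ⊗ diff h₁ ⊕ ι≥0 4 ⊗ diff h₂ ⊕ diff h₃) (solve (z ∷ w ∷ l ∷ c ∷ []) ℚ-ring)

      s : ℚ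
      s = ∑ m (λ g → κ g * F g)

      -- Orthogonality in disguise: multiplying the classes by a unit k shows F k s = s, and summing
      -- over k gives the equation.
      s²≡φs : s * s ≡ φ * s
      s²≡φs = trans (sym (∑-*ʳ m s)) (trans (∑-cong′ m (λ k → trans (ℚ.*-assoc (κ k) (F k) s) (κ-cong {k} (fixed k)))) (∑-*ʳ m s))
        where
        fixed : ∀ k → Coprime k m → F k * s ≡ s
        fixed k ck = trans (sym (∑-*ˡ m (F k))) (trans (∑-cong′ m (λ h → trans (lem (F k) (κ h) (F h)) (κ-cong {h} (λ ch → sym (F-* k h ck ch))))) (∑-dilate F-class ck))
          where
          lem : ∀ a b c → a * (b * c) ≡ b * (a * c)
          lem = solve-∀ ℚ-ring

      u≤W : ∀ g → u y g ≤ W y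
      u≤W g = ∑-mono y (λ n 1≤n _ → ≤-trans (*-monoˡ-≤ (ω≥0 n 1≤n) (ind≤1 (n ℕ.% m ℕ.≟ g ℕ.% m))) (≤-reflexive (ℚ.*-identityʳ (ω n))))

      F≤1 : ∀ g → F g ≤ 1ℚ
      F≤1 g = abs-upper (∣F∣≤1 g)

      -- Otherwise s = φ, the case of the principal character. Then nothing is lost between Z and W
      -- y, so Z ≥ W y ≥ 0, against `4Z≤`.
      s≡0 : s ≡ 0ℚ
      s≡0 = case-of (s ℚ.≟ 0ℚ)
        where
        case-of : Dec (s ≡ 0ℚ) → s ≡ 0ℚ
        case-of (yes s≡0) = s≡0
        case-of (no s≢0) = ⊥-elim (1≰0 (conclude Z (W y) (ℓ y) 4Z≤ W≤Z (≤-trans 0≤1 1≤Wy) 1≤ℓy))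
         where
         s≡φ : s ≡ φ
         s≡φ = *-cancelʳ-≡ s≢0 s²≡φs
         W-Z : W y - Z ≤ W y * (φ - s)
         W-Z = subst₂ _≤_ (trans (∑-- m) (cong₂ _-_ (∑-κu y) (sym Z-class))) (trans (∑-*ˡ m (W y)) (cong (W y *_) (∑-- m)))
           (∑-mono m (λ g _ _ → ≤-trans (≤-reflexive (lem₁ (κ g) (u y g) (F g))) (≤-trans (*-monoˡ-≤ (κ≥0 g) (*-monoʳ-≤ (diff (F≤1 g)) (u≤W g))) (≤-reflexive (lem₂ (κ g) (W y) (F g))))))
           where
           lem₁ : ∀ k u F → k * u - k * (u * F) ≡ k * (u * (1ℚ - F))
           lem₁ = solve-∀ ℚ-ring
           lem₂ : ∀ k w F → k * (w * (1ℚ - F)) ≡ w * (k - k * F)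
           lem₂ = solve-∀ ℚ-ring
         W≤Z : W y - Z ≤ 0ℚ
         W≤Z = ≤-trans W-Z (≤-reflexive (trans (cong (W y *_) (≡⇒diff0 (sym s≡φ))) (ℚ.*-zeroʳ (W y))))
         conclude : ∀ z w l → ι 4 * z ≤ - l → w - z ≤ 0ℚ → 0ℚ ≤ w → 1ℚ ≤ l → 1ℚ ≤ 0ℚ
         conclude z w l a b w≥0 d = ≤-by (diff a ⊕ ι≥0 4 ⊗ diff b ⊕ ι≥0 4 ⊗ w≥0 ⊕ diff d) (solve (z ∷ w ∷ l ∷ []) ℚ-ring)

      ∑χ-bound : ∀ n → ∣ ∑ n χ ∣ ≤ ι m
      ∑χ-bound n = ≤-trans (abs-≡ (∑-class F-class ∣F∣≤1 n)
        (sym (trans (cong (λ z → ∑ n χ - ι n * rec m * z) s≡0) (lem (∑ n χ) (ι n * rec m)))))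
        (≤-reflexive (ℚ.*-identityʳ (ι m)))
        where
        lem : ∀ a b → a - b * 0ℚ ≡ a
        lem = solve-∀ ℚ-ring

      χ-* : ∀ a b → χ (a ℕ.* b) ≡ χ a * χ b
      χ-* a b = trans (cong (_* F (a ℕ.* b)) (κ-* a b)) (trans (ℚ.*-assoc (κ a) (κ b) (F (a ℕ.* b)))
        (trans (κ-cong {a} (λ ca → κ-cong {b} (λ cb → F-* a b ca cb))) (lem (κ a) (κ b) (F a) (F b))))
        where
        lem : ∀ k l f g → k * (l * (f * g)) ≡ (k * f) * (l * g)
        lem = solve-∀ ℚ-ring

      χ-1 : χ 1 ≡ 1ℚ
      χ-1 = trans (cong₂ _*_ κ-1 (sgn² (σ 1))) refl

      χ-value : ∀ n → χ n ≡ 0ℚ ⊎ χ n ≡ 1ℚ ⊎ χ n ≡ - 1ℚ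
      χ-value n = 0or±1 (κ-value n) (F-value n)

      open RealCharacter χ χ-1 χ-* χ-value m 1≤m ∑χ-bound using (S; S-lower)

      χ-oscillates : Oscillates χ (ι m)
      χ-oscillates d n = ≤-trans (abs-≡ (abs-* ∣χ∣≤1 (∑χ-bound n)) (trans (∑-cong′ n (χ-* d)) (∑-*ˡ n (χ d)))) (≤-reflexive (ℚ.*-identityˡ (ι m)))
        where
        ∣χ∣≤1 : ∣ χ d ∣ ≤ 1ℚ
        ∣χ∣≤1 = ≤-trans (abs-* (abs-nonneg (κ≥0 d) (ind≤1 (coprime? d m))) (∣F∣≤1 d)) (≤-reflexive (ℚ.*-identityˡ 1ℚ))

      -- For a completely multiplicative function the series at d is χ d S y, so the sum in
      -- Shapiro's first identity factors as Z S y.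
      ZS : ∣ Z * S y ∣ ≤ ι 64 * ι m
      ZS = abs-≡ (Sums.∑-Λ-L χ (ι m) χ-oscillates {y} {y} 1≤y ℕ.≤-refl (ℕ.≤-<-trans y≤x x<X))
        (trans (sym (∑-*ʳ y (S y))) (∑-cong′ y (λ d → trans (lem (κ d) (Λ d) (rec d) (F d) (S y))
          (cong (λ z → Λ d * (rec d * z)) (sym (trans (∑-cong′ y (λ e → trans (cong (_* rec e) (χ-* d e)) (ℚ.*-assoc (χ d) (χ e) (rec e)))) (∑-*ˡ y (χ d))))))))
        where
        lem : ∀ k l r f s → k * (l * r) * f * s ≡ l * (r * (k * f * s))
        lem = solve-∀ ℚ-ring

      finale : ⊥
      -- With M = scale-M m: ℓ y ≤ 2 M |S y| ℓ y ≤ 8 M |Z S y| ≤ 512 m M, whereas ℓ y was chosen to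
      -- exceed this by 1.
      finale = 1≰0 (conclude (ℓ y) ∣ Z ∣ ∣ S y ∣ (ι m) (ι (scale-M m))
        (≤-trans (≤-by (diff 4Z≤ ⊕ ι≥0 4 ⊗ diff (-≤-abs Z)) (lem (ℓ y) Z ∣ Z ∣)) ≤-refl)
        (≤-trans (≤-reflexive (sym (ℚ.∣p*q∣≡∣p∣*∣q∣ Z (S y)))) ZS) (S-lower y A≤y) big (ℚ.0≤∣p∣ (S y)) (≤-trans 0≤1 1≤ℓy) (ι≥0 (scale-M m)))
        where
        lem : ∀ l z a → ι 4 * a - l ≡ (- l - ι 4 * z) + ι 4 * (a - - z)
        lem = solve-∀ ℚ-ring
        conclude : ∀ l z s m M → l ≤ ι 4 * z → z * s ≤ ι 64 * m → 1ℚ ≤ ι 2 * M * s → ι 512 * (m * M) + 1ℚ ≤ l → 0ℚ ≤ s → 0ℚ ≤ l → 0ℚ ≤ M → 1ℚ ≤ 0ℚ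
        conclude l z s m M h₁ h₂ h₃ h₄ s≥0 l≥0 M≥0 = ≤-by (diff h₄ ⊕ l≥0 ⊗ diff h₃ ⊕ ι≥0 2 ⊗ M≥0 ⊗ s≥0 ⊗ diff h₁ ⊕ ι≥0 8 ⊗ M≥0 ⊗ diff h₂) (solve (l ∷ z ∷ s ∷ m ∷ M ∷ []) ℚ-ring)

  -- Dirichlet's theorem

  -- The scales z, y, x are powers of 2, where ℓ is explicit; each is huge compared
  -- with the previous one.
  dirichlet : ∀ m (2≤m : 2 ℕ.≤ m) α N → Coprime α m →
    (∀ p → Prime p → Residues._≈_ m 2≤m p α → p ℕ.< N) → ⊥
  dirichlet m 2≤m α N cα few = core (2 ℕ.^ (2 ℕ.* bz)) (2 ℕ.^ (2 ℕ.* by)) (2 ℕ.^ (2 ℕ.* bx)) bz by bx refl refl refl refl refl refl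
    where
    open Residues m 2≤m using (1≤m)
    Q C bz : ℕ
    Q = precision m
    C = 64 ℕ.* (m ℕ.* m)
    bz = Q
    1≤Q : 1 ℕ.≤ Q
    1≤Q = ℕ.*-mono-≤ {1} {800 ℕ.* (m ℕ.* m)} (ℕ.*-mono-≤ {1} {800} (s≤s z≤n) 1≤mm) (ℕ.*-mono-≤ {1} {200} (s≤s z≤n) 1≤mm)
      where
      1≤mm : 1 ℕ.≤ m ℕ.* m
      1≤mm = ℕ.*-mono-≤ 1≤m 1≤m
    big : ℕ
    big = 512 ℕ.* (m ℕ.* scale-M m) ℕ.+ 1

    -- Each summand answers one of the lower bounds required by `contradiction`; C is the error in
    -- Mertens' estimate and converts a bound for ℓ into one for W.
    by bx : ℕ
    by = (2 ℕ.^ (2 ℕ.* bz)) ℕ.* Q ℕ.+ Q ℕ.+ C ℕ.+ 4 ℕ.* C ℕ.+ big ℕ.+ scale-A m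
    bx = (2 ℕ.^ (2 ℕ.* by)) ℕ.* Q ℕ.+ (2 ℕ.* N ℕ.+ 4) ℕ.* Q ℕ.+ C

    core : ∀ z y x bz by bx → z ≡ 2 ℕ.^ (2 ℕ.* bz) → y ≡ 2 ℕ.^ (2 ℕ.* by) → x ≡ 2 ℕ.^ (2 ℕ.* bx) →
      bz ≡ Q → by ≡ z ℕ.* Q ℕ.+ Q ℕ.+ C ℕ.+ 4 ℕ.* C ℕ.+ big ℕ.+ scale-A m → bx ≡ y ℕ.* Q ℕ.+ (2 ℕ.* N ℕ.+ 4) ℕ.* Q ℕ.+ C → ⊥
    core z y x bz by bx z≡ y≡ x≡ bz≡ by≡ bx≡ = contradiction {α} {N} {x} {y} {z} cα few
        1≤z z≤y y≤x ℕ.≤-refl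
        (≤-trans (ι-mono (ℕ.≤-reflexive (sym bz≡))) (large bz z≡))
        (≤-trans (≤-reflexive (sym (ι-* z Q))) (W-large y (z ℕ.* Q) {by} 1≤y (s≤s y≤x) (large by y≡) (parts (z ℕ.* Q ℕ.+ C) (ℕ.≤-trans (ℕ.+-monoˡ-≤ C (ℕ.m≤m+n (z ℕ.* Q) Q)) le₃))))
        (≤-trans (parts Q (ℕ.≤-trans (ℕ.m≤n+m Q (z ℕ.* Q)) (ℕ.≤-trans (ℕ.m≤m+n (z ℕ.* Q ℕ.+ Q) C) le₃))) (large by y≡))
        (≤-trans (≤-reflexive (trans (cong (ι 4 *_) (sym ιC)) (sym (ι-* 4 C)))) (≤-trans (parts (4 ℕ.* C) (ℕ.≤-trans (ℕ.m≤n+m (4 ℕ.* C) (z ℕ.* Q ℕ.+ Q ℕ.+ C)) le₂)) (large by y≡)))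
        (≤-trans (≤-reflexive (sym (trans (ι-+ (512 ℕ.* (m ℕ.* scale-M m)) 1) (cong (_+ 1ℚ) (trans (ι-* 512 (m ℕ.* scale-M m)) (cong (ι 512 *_) (ι-* m (scale-M m))))))))
          (≤-trans (parts big (ℕ.≤-trans (ℕ.m≤n+m big (z ℕ.* Q ℕ.+ Q ℕ.+ C ℕ.+ 4 ℕ.* C)) le₁)) (large by y≡)))
        (ℕ.≤-trans (ℕ.m≤n+m (scale-A m) _) (ℕ.≤-trans (ℕ.≤-reflexive (sym by≡)) by≤y))
        (≤-trans (≤-reflexive (sym (ι-* y Q))) (W-large x (y ℕ.* Q) {bx} 1≤x ℕ.≤-refl (large bx x≡)
          (ι-mono (ℕ.≤-trans (ℕ.+-monoˡ-≤ C (ℕ.m≤m+n (y ℕ.* Q) ((2 ℕ.* N ℕ.+ 4) ℕ.* Q))) (ℕ.≤-reflexive (sym bx≡))))))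
        (≤-trans (≤-reflexive (sym (trans (ι-* (2 ℕ.* N ℕ.+ 4) Q) (cong (_* ι Q) (trans (ι-+ (2 ℕ.* N) 4) (cong (_+ ι 4) (ι-* 2 N)))))))
          (W-large x ((2 ℕ.* N ℕ.+ 4) ℕ.* Q) {bx} 1≤x ℕ.≤-refl (large bx x≡)
          (ι-mono (ℕ.≤-trans (ℕ.+-monoˡ-≤ C (ℕ.m≤n+m ((2 ℕ.* N ℕ.+ 4) ℕ.* Q) (y ℕ.* Q))) (ℕ.≤-reflexive (sym bx≡))))))
      where
      open Logarithm (suc x) (s≤s z≤n)
      open Mangoldt h
      open Contradiction m 2≤m (suc x) h h≥0 h-2≤1 ℓ-suc
      open PrimesInClasses m 2≤m (suc x) h h≥0 h-2≤1 ℓ-suc using (W; mertens)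

      1≤z : 1 ℕ.≤ z
      1≤z = ℕ.≤-trans (ℕ.m^n>0 2 (2 ℕ.* bz)) (ℕ.≤-reflexive (sym z≡))
      1≤y : 1 ℕ.≤ y
      1≤y = ℕ.≤-trans (ℕ.m^n>0 2 (2 ℕ.* by)) (ℕ.≤-reflexive (sym y≡))
      1≤x : 1 ℕ.≤ x
      1≤x = ℕ.≤-trans (ℕ.m^n>0 2 (2 ℕ.* bx)) (ℕ.≤-reflexive (sym x≡))
      by≤y : by ℕ.≤ y
      by≤y = ℕ.≤-trans (n≤4^n by) (ℕ.≤-reflexive (sym y≡))
      bx≤x : bx ℕ.≤ x
      bx≤x = ℕ.≤-trans (n≤4^n bx) (ℕ.≤-reflexive (sym x≡))
      le₁ : z ℕ.* Q ℕ.+ Q ℕ.+ C ℕ.+ 4 ℕ.* C ℕ.+ big ℕ.≤ by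
      le₁ = ℕ.≤-trans (ℕ.m≤m+n _ (scale-A m)) (ℕ.≤-reflexive (sym by≡))
      le₂ : z ℕ.* Q ℕ.+ Q ℕ.+ C ℕ.+ 4 ℕ.* C ℕ.≤ by
      le₂ = ℕ.≤-trans (ℕ.m≤m+n _ big) le₁
      le₃ : z ℕ.* Q ℕ.+ Q ℕ.+ C ℕ.≤ by
      le₃ = ℕ.≤-trans (ℕ.m≤m+n _ (4 ℕ.* C)) le₂
      n≤n*Q : ∀ n → n ℕ.≤ n ℕ.* Q
      n≤n*Q n = ℕ.≤-trans (ℕ.≤-reflexive (sym (ℕ.*-identityʳ n))) (ℕ.*-monoʳ-≤ n 1≤Q)
      z≤y : z ℕ.≤ y
      z≤y = ℕ.≤-trans (n≤n*Q z) (ℕ.≤-trans (ℕ.m≤m+n (z ℕ.* Q) Q) (ℕ.≤-trans (ℕ.m≤m+n _ C) (ℕ.≤-trans le₃ by≤y)))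
      y≤x : y ℕ.≤ x
      y≤x = ℕ.≤-trans (n≤n*Q y) (ℕ.≤-trans (ℕ.m≤m+n _ ((2 ℕ.* N ℕ.+ 4) ℕ.* Q)) (ℕ.≤-trans (ℕ.m≤m+n _ C) (ℕ.≤-trans (ℕ.≤-reflexive (sym bx≡)) bx≤x)))
      parts : ∀ n → n ℕ.≤ by → ι n ≤ ι by
      parts n = ι-mono
      ιC : ι C ≡ c̃
      ιC = trans (ι-* 64 (m ℕ.* m)) (cong (ι 64 *_) (ι-* m m))

      ℓ-2^ : ∀ k → ℓ (2 ℕ.^ k) ≡ ι k * h 2
      ℓ-2^ zero    = trans ℓ-1 (sym (ℚ.*-zeroˡ (h 2)))
      ℓ-2^ (suc k) = trans (ℓ-* (LPF-2 (2 ℕ.^ k)) (ℕ.m^n>0 2 k)) (trans (cong (h 2 +_) (ℓ-2^ k)) (lem (h 2) (ι k)))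
        where
        lem : ∀ a k → a + k * a ≡ (1ℚ + k) * a
        lem = solve-∀ ℚ-ring

      -- The exponent is doubled because `h 2` is only known to be at least 1/2.
      large : ∀ b {w} → w ≡ 2 ℕ.^ (2 ℕ.* b) → ι b ≤ ℓ w
      large b refl = ≤-trans (≤-by (ι≥0 b ⊗ diff 1≤h-2+h-2) (lem (ι b) (h 2)))
        (≤-reflexive (sym (trans (ℓ-2^ (2 ℕ.* b)) (cong (_* h 2) (ι-* 2 b)))))
        where
        lem : ∀ b a → ι 2 * b * a - b ≡ b * (a + a - 1ℚ)
        lem = solve-∀ ℚ-ring

      W-large : ∀ w k {b} → 1 ℕ.≤ w → w ℕ.< suc x → ι b ≤ ℓ w → ι (k ℕ.+ C) ≤ ι b → ι k ≤ W w
      W-large w k {b} 1≤w w<X lb kb = lem (W w) (ℓ w) (ι k) (ι C) c̃ (≤-trans (≤-reflexive (sym (ι-+ k C))) (≤-trans kb lb)) (≤-reflexive (sym ιC)) (abs-lower (mertens w 1≤w w<X))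
        where
        lem : ∀ w l k c c′ → k + c ≤ l → c′ ≤ c → - (w - l) ≤ c′ → k ≤ w
        lem w l k c c′ a d e = ≤-by (diff a ⊕ diff d ⊕ diff e) (solve (w ∷ l ∷ k ∷ c ∷ c′ ∷ []) ℚ-ring)

open DirichletTheorem using (prime≥1; ∤-cancel; ∣⇒≤′; find-lpf; is-prime; divides-n; n<2^n; dirichlet)
open import Data.Nat using (ℕ; zero; suc; _+_; _*_; _∸_; _^_; _≤_; _<_; z≤n; s≤s; _≟_; NonZero; _%_; _/_)
open import Data.Nat.Properties
open import Data.Nat.DivMod
open import Data.Nat.Divisibility
open import Data.Nat.GCD using (gcd; gcd[m,n]∣m; gcd[m,n]∣n)
open import Data.Nat.Coprimality using (Coprime; gcd≡1⇒coprime)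
open import Data.Nat.Primality using (Prime; prime?; prime[2]; euclidsLemma; prime⇒irreducible; prime⇒nonZero; ¬prime[1])
open import Data.Nat.Tactic.RingSolver using (solve-∀)
open import Data.Product using (_×_; _,_; proj₁; proj₂; ∃-syntax)
open import Data.Sum using (_⊎_; inj₁; inj₂)
open import Data.Empty using (⊥; ⊥-elim)
open import Function.Bundles using (_⇔_; mk⇔)
open import Relation.Nullary using (¬_; Dec; yes; no; ¬?; _×-dec_; contradiction)
open import Relation.Binary.PropositionalEquality using (_≡_; _≢_; refl; sym; trans; cong; cong₂; subst)

-- Parity and prime divisors

odd⇒%2≡1 : ∀ {n} → Odd n → n % 2 ≡ 1
odd⇒%2≡1 {n} odd with n % 2 in eq | m%n<n n 2
... | zero        | _ = ⊥-elim (odd (m%n≡0⇒n∣m n 2 eq))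
... | suc zero    | _ = refl
... | suc (suc _) | s≤s (s≤s ())

odd+odd : ∀ {a b} → Odd a → Odd b → 2 ∣ a + b
odd+odd {a} {b} oa ob = m%n≡0⇒n∣m (a + b) 2 (trans (%-distribˡ-+ a b 2) (cong₂ (λ x y → (x + y) % 2) (odd⇒%2≡1 oa) (odd⇒%2≡1 ob)))

prime∣prime : ∀ {p q} → Prime p → Prime q → p ∣ q → p ≡ q
prime∣prime pp pq p∣q with prime⇒irreducible pq p∣q
... | inj₁ refl = ⊥-elim (¬prime[1] pp)
... | inj₂ e    = e

prime∣2^ : ∀ {p} k → Prime p → p ∣ 2 ^ k → p ≡ 2
prime∣2^ zero    pp p∣1 = ⊥-elim (¬prime[1] (subst Prime (∣1⇒≡1 p∣1) pp))
prime∣2^ (suc k) pp p∣ with euclidsLemma 2 (2 ^ k) pp p∣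
... | inj₁ p∣2 = prime∣prime pp prime[2] p∣2
... | inj₂ p∣2^k = prime∣2^ k pp p∣2^k

2∣2^ : ∀ {k} → 1 ≤ k → 2 ∣ 2 ^ k
2∣2^ {suc k} _ = m∣m*n (2 ^ k)

-- Squarefree numbers and the odd radical

NoPrimeSquare : ℕ → Set
NoPrimeSquare n = ∀ r → Prime r → ¬ (r * r ∣ n)

squareFree : ∀ {n} → 1 ≤ n → NoPrimeSquare n → SquareFree n
squareFree 1≤n nps zero          d²∣n = contradiction (0∣⇒≡0 d²∣n) (λ { refl → 1+n≰n 1≤n })
squareFree 1≤n nps (suc zero)    d²∣n = refl
squareFree 1≤n nps d@(suc (suc _)) d²∣n with find-lpf d (s≤s (s≤s z≤n))
... | p , l = ⊥-elim (nps p (is-prime l) (∣-trans (*-pres-∣ (divides-n l) (divides-n l)) d²∣n))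

noPrimeSquare-* : ∀ {q n} → Prime q → ¬ (q ∣ n) → NoPrimeSquare n → NoPrimeSquare (q * n)
noPrimeSquare-* {q} pq q∤n nps r pr r²∣ with q ∣? (r * r)
... | no q∤r² = nps r pr (∤-cancel pq q∤r² r²∣)
... | yes q∣r² with prime∣prime pq pr (case (euclidsLemma r r pq q∣r²))
  where
  case : q ∣ r ⊎ q ∣ r → q ∣ r
  case (inj₁ d) = d
  case (inj₂ d) = d
... | refl = q∤n (*-cancelˡ-∣ q {{prime⇒nonZero pq}} r²∣)

module OddRadical (m : ℕ) where

  OddPrimeFactor : ℕ → Set
  OddPrimeFactor q = Prime q × q ≢ 2 × q ∣ m

  oddPrimeFactor? : ∀ q → Dec (OddPrimeFactor q)
  oddPrimeFactor? q = prime? q ×-dec (¬? (q ≟ 2) ×-dec (q ∣? m))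

  radical : ℕ → ℕ
  radical zero    = 1
  radical (suc N) with oddPrimeFactor? (suc N)
  ... | yes _ = suc N * radical N
  ... | no  _ = radical N

  radical-factor : ∀ N {r} → Prime r → r ∣ radical N → r ≤ N × r ≢ 2 × r ∣ m
  radical-factor zero    pr r∣1 = ⊥-elim (¬prime[1] (subst Prime (∣1⇒≡1 r∣1) pr))
  radical-factor (suc N) pr r∣ with oddPrimeFactor? (suc N)
  ... | no _ = let r≤N , r = radical-factor N pr r∣ in m≤n⇒m≤1+n r≤N , r
  ... | yes (pN , N≢2 , N∣m) with euclidsLemma (suc N) (radical N) pr r∣
  ... | inj₂ r∣′ = let r≤N , r = radical-factor N pr r∣′ in m≤n⇒m≤1+n r≤N , r
  ... | inj₁ r∣N with prime∣prime pr pN r∣N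
  ... | refl = ≤-refl , N≢2 , N∣m

  ∣radical : ∀ N {q} → OddPrimeFactor q → q ≤ N → q ∣ radical N
  ∣radical zero    (pq , _) q≤0 = ⊥-elim (1+n≰n (≤-trans (prime≥1 pq) q≤0))
  ∣radical (suc N) {q} f q≤N with oddPrimeFactor? (suc N) | m≤n⇒m<n∨m≡n q≤N
  ... | yes _ | inj₁ (s≤s q≤N′) = ∣n⇒∣m*n (suc N) (∣radical N f q≤N′)
  ... | yes _ | inj₂ refl      = m∣m*n (radical N)
  ... | no  _ | inj₁ (s≤s q≤N′) = ∣radical N f q≤N′
  ... | no ¬f | inj₂ refl      = ⊥-elim (¬f f)

  radical-noPrimeSquare : ∀ N → NoPrimeSquare (radical N)
  radical-noPrimeSquare zero r pr r²∣1 = ¬prime[1] (subst Prime (∣1⇒≡1 (∣-trans (m∣m*n r) r²∣1)) pr)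
  radical-noPrimeSquare (suc N) with oddPrimeFactor? (suc N)
  ... | no  _ = radical-noPrimeSquare N
  ... | yes (pN , _) = noPrimeSquare-* pN (λ N∣ → 1+n≰n (proj₁ (radical-factor N pN N∣))) (radical-noPrimeSquare N)

  1≤radical : ∀ N → 1 ≤ radical N
  1≤radical zero    = ≤-refl
  1≤radical (suc N) with oddPrimeFactor? (suc N)
  ... | yes _ = *-mono-≤ {1} {suc N} (s≤s z≤n) (1≤radical N)
  ... | no  _ = 1≤radical N

-- Progressions in U and the primes covering them

≡%⇒+* : ∀ {a b} m .{{_ : NonZero m}} → a % m ≡ b % m → b ≤ a → ∃[ h ] a ≡ m * h + b
≡%⇒+* {a} {b} m e b≤a = a / m ∸ b / m ,
  trans (m≡m%n+[m/n]*n a m) (trans (cong₂ (λ x y → x + y * m) e (sym (m∸n+n≡m (/-monoˡ-≤ m b≤a))))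
    (trans (lem (b % m) (a / m ∸ b / m) (b / m) m) (cong (m * (a / m ∸ b / m) +_) (sym (m≡m%n+[m/n]*n b m)))))
  where
  lem : ∀ r d q m → r + (d + q) * m ≡ m * d + (r + q * m)
  lem = solve-∀

common-prime-factor : ∀ {a m} → 1 ≤ m → ¬ Coprime a m → ∃[ q ] (Prime q × q ∣ a × q ∣ m)
common-prime-factor {a} {m} 1≤m ¬c = factor (gcd a m) (gcd[m,n]∣m a m) (gcd[m,n]∣n a m) (λ e → ¬c (gcd≡1⇒coprime e))
  where
  factor : ∀ g → g ∣ a → g ∣ m → g ≢ 1 → ∃[ q ] (Prime q × q ∣ a × q ∣ m)
  factor zero g∣a g∣m _ = ⊥-elim (1+n≰n (≤-trans 1≤m (≤-reflexive (0∣⇒≡0 g∣m))))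
  factor (suc zero) _ _ g≢1 = ⊥-elim (g≢1 refl)
  factor g@(suc (suc _)) g∣a g∣m _ with find-lpf g (s≤s (s≤s z≤n))
  ... | q , l = q , is-prime l , ∣-trans (divides-n l) g∣a , ∣-trans (divides-n l) g∣m

-- An arithmetic progression in U through n. By Dirichlet's theorem n - 2^k
-- is never prime to m, so whenever m′ is divisible by the odd primes in m, a
-- representation m′h + n = p + 2^k forces p to be one of these primes.
module Progression {m b h₀ : ℕ} (I : IndexI m b) where

  n : ℕ
  n = m * h₀ + b

  1≤m : 1 ≤ m
  1≤m = proj₁ I

  inU : ∀ h → InU (m * h + b)
  inU = proj₂ (proj₂ I)

  1≤n : 1 ≤ n
  1≤n = proj₁ (inU h₀)

  n-odd : Odd n
  n-odd = proj₁ (proj₂ (inU h₀))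

  n≢p+2^k : ∀ p k → Prime p → 1 ≤ k → n ≢ p + 2 ^ k
  n≢p+2^k = proj₂ (proj₂ (inU h₀))

  -- The terms b and m + b are both odd.
  2∣m : 2 ∣ m
  2∣m with 2 ∣? m
  ... | yes 2∣m = 2∣m
  ... | no  2∤m = ⊥-elim (proj₁ (proj₂ (inU 1)) (subst (λ x → 2 ∣ x + b) (sym (*-identityʳ m))
    (odd+odd 2∤m (subst (λ x → Odd (x + b)) (*-zeroʳ m) (proj₁ (proj₂ (inU 0)))))))

  2≤m : 2 ≤ m
  2≤m = ∣⇒≤′ 1≤m 2∣m

  instance
    m≢0 : NonZero m
    m≢0 = Data.Nat.>-nonZero 1≤m

  open OddRadical m public

  s : ℕ
  s = radical m

  factor-∣s : ∀ {q} → OddPrimeFactor q → q ∣ s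
  factor-∣s f = ∣radical m f (∣⇒≤′ 1≤m (proj₂ (proj₂ f)))

  -- Congruent to n - 2^k modulo m, without truncated subtraction.
  shift : ℕ → ℕ
  shift k = n + (m ∸ 1) * 2 ^ k

  shift+2^k : ∀ k → shift k + 2 ^ k ≡ n + m * 2 ^ k
  shift+2^k k = trans (lem n (m ∸ 1) (2 ^ k)) (cong (λ z → n + z * 2 ^ k) (m+[n∸m]≡n 1≤m))
    where
    lem : ∀ n c t → n + c * t + t ≡ n + (1 + c) * t
    lem = solve-∀

  -- A prime p ≥ n in the class of `shift k` would make p + 2^k a term of the progression at or
  -- beyond n, hence an element of U with a forbidden representation. So the primes of that class
  -- would be bounded by n.
  shift-not-coprime : ∀ k → 1 ≤ k → ¬ Coprime (shift k) m
  shift-not-coprime k 1≤k c = dirichlet m 2≤m (shift k) n c (λ p pp p≈ → ≰⇒> (λ n≤p → no-prime p pp n≤p p≈))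
    where
    no-prime : ∀ p → Prime p → n ≤ p → ¬ (p % m ≡ shift k % m)
    no-prime p pp n≤p p≈ with ≡%⇒+* {p + 2 ^ k} {n} m
      (trans (%-distribˡ-+ p (2 ^ k) m) (trans (cong (λ z → (z + 2 ^ k % m) % m) p≈) (trans (sym (%-distribˡ-+ (shift k) (2 ^ k) m))
        (trans (cong (_% m) (shift+2^k k)) (%-remove-+ʳ n (m∣m*n (2 ^ k)))))))
      (≤-trans n≤p (m≤m+n p (2 ^ k)))
    ... | h , e = proj₂ (proj₂ (inU (h + h₀))) p k pp 1≤k (sym (trans e (lem m h h₀ b)))
      where
      lem : ∀ m h h₀ b → m * h + (m * h₀ + b) ≡ m * (h + h₀) + b
      lem = solve-∀

  common-prime : ∀ k → 1 ≤ k → ∃[ q ] (OddPrimeFactor q × q ∣ shift k)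
  common-prime k 1≤k = finish (common-prime-factor 1≤m (shift-not-coprime k 1≤k))
    where
    finish : ∃[ q ] (Prime q × q ∣ shift k × q ∣ m) → ∃[ q ] (OddPrimeFactor q × q ∣ shift k)
    finish (q , pq , q∣shift , q∣m) = q , (pq , q≢2 , q∣m) , q∣shift
      where
      -- For k ≥ 1 the number `shift k` has the parity of n.
      q≢2 : q ≢ 2
      q≢2 q≡2 = n-odd (∣m+n∣m⇒∣n (subst (2 ∣_) (+-comm n _) (subst (_∣ shift k) q≡2 q∣shift)) (∣n⇒∣m*n (m ∸ 1) (2∣2^ 1≤k)))

  -- The odd prime q attached to the exponent k divides m and m′, and modulo m the number p is m′ h
  -- + `shift k`. Hence q divides p, so p = q.
  represented-prime : ∀ {m′ h p k} → (∀ {q} → OddPrimeFactor q → q ∣ m′) → Prime p → 1 ≤ k →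
    m′ * h + n ≡ p + 2 ^ k → OddPrimeFactor p
  represented-prime {m′} {h} {p} {k} ∣m′ pp 1≤k e = subst OddPrimeFactor (prime∣prime (proj₁ f) pp q∣p) f
    where
    q : ℕ
    q = proj₁ (common-prime k 1≤k)
    f : OddPrimeFactor q
    f = proj₁ (proj₂ (common-prime k 1≤k))
    q∣shift : q ∣ shift k
    q∣shift = proj₂ (proj₂ (common-prime k 1≤k))
    eq : m′ * h + shift k ≡ m * 2 ^ k + p
    eq = +-cancelʳ-≡ (2 ^ k) _ _ (trans (+-assoc (m′ * h) (shift k) (2 ^ k)) (trans (cong (m′ * h +_) (shift+2^k k))
      (trans (sym (+-assoc (m′ * h) n (m * 2 ^ k))) (trans (cong (_+ m * 2 ^ k) e) (lem p (2 ^ k) (m * 2 ^ k))))))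
      where
      lem : ∀ p t v → p + t + v ≡ v + p + t
      lem = solve-∀
    q∣p : q ∣ p
    q∣p = ∣m+n∣m⇒∣n (subst (q ∣_) eq (∣m∣n⇒∣m+n (∣m⇒∣m*n h (∣m′ f)) q∣shift)) (∣m⇒∣m*n (2 ^ k) (proj₂ (proj₂ f)))

  indexI : ∀ {m′} → 1 ≤ m′ → 2 ∣ m′ → (∀ {q} → OddPrimeFactor q → q ∣ m′) →
    (∀ h q k → OddPrimeFactor q → 1 ≤ k → m′ * h + n ≢ q + 2 ^ k) → IndexI m′ n
  indexI {m′} 1≤m′ 2∣m′ ∣m′ none = 1≤m′ , 1≤n , λ h →
    ≤-trans 1≤n (m≤n+m n (m′ * h)) ,
    (λ 2∣ → n-odd (∣m+n∣m⇒∣n 2∣ (∣m⇒∣m*n h 2∣m′))) ,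
    (λ p k pp 1≤k e → none h p k (represented-prime ∣m′ pp 1≤k e) 1≤k e)

  inAP : ∀ m′ → InAP m′ n n
  inAP m′ = 0 , sym (cong (_+ n) (*-zeroʳ m′))

  factor≤m : ∀ {q} → OddPrimeFactor q → q ≤ m
  factor≤m f = ∣⇒≤′ 1≤m (proj₂ (proj₂ f))

  s-odd : Odd s
  s-odd 2∣s = proj₁ (proj₂ (radical-factor m prime[2] 2∣s)) refl

  s-squareFree : SquareFree s
  s-squareFree = squareFree (1≤radical m) (radical-noPrimeSquare m)

  -- Half of 2^a is then 2^(n + m), which exceeds n and every prime factor of m.
  a : ℕ
  a = suc (n + m)

  q<2^a : ∀ {q} → q ≤ n + m → q < 2 ^ a
  q<2^a {q} q≤ = ≤-trans (s≤s (m≤n⇒m≤1+n q≤)) (n<2^n a)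

  indexJ : IndexJ (2 ^ a * s) n
  indexJ = indexI 1≤m′ (∣m⇒∣m*n s (2∣2^ {a} (s≤s z≤n))) (λ f → ∣n⇒∣m*n (2 ^ a) (factor-∣s f)) none ,
    a , s , refl , s-odd , s-squareFree
    where
    1≤m′ : 1 ≤ 2 ^ a * s
    1≤m′ = *-mono-≤ (m^n>0 2 a) (1≤radical m)
    instance
      2^a≢0 : NonZero (2 ^ a)
      2^a≢0 = Data.Nat.>-nonZero (m^n>0 2 a)
    none : ∀ h q k → OddPrimeFactor q → 1 ≤ k → 2 ^ a * s * h + n ≢ q + 2 ^ k
    none h q k f 1≤k e with a ≤? k
    -- Modulo 2^a the equation reads n ≡ q, so n = q as both are below 2^a. What remains is m′ h =
    -- 2^k, which the odd prime q would divide.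
    ... | yes a≤k = proj₁ (proj₂ f) (prime∣2^ k (proj₁ f) (subst (q ∣_) m′h≡2^k (∣m⇒∣m*n h (∣n⇒∣m*n (2 ^ a) (factor-∣s f)))))
      where
      2^a∣2^k : 2 ^ a ∣ 2 ^ k
      2^a∣2^k = divides (2 ^ (k ∸ a)) (trans (cong (2 ^_) (sym (m∸n+n≡m a≤k))) (^-distribˡ-+-* 2 (k ∸ a) a))
      n≡q : n ≡ q
      n≡q = trans (sym (m<n⇒m%n≡m (q<2^a (m≤m+n n m)))) (trans (sym (%-remove-+ˡ n (∣m⇒∣m*n h (m∣m*n s))))
        (trans (cong (_% 2 ^ a) e) (trans (%-remove-+ʳ q 2^a∣2^k) (m<n⇒m%n≡m (q<2^a (≤-trans (factor≤m f) (m≤n+m m n)))))))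
      m′h≡2^k : 2 ^ a * s * h ≡ 2 ^ k
      m′h≡2^k = +-cancelʳ-≡ n _ _ (trans e (trans (+-comm q (2 ^ k)) (cong (2 ^ k +_) (sym n≡q))))
    none zero    q k f 1≤k e | no a≰k = n≢p+2^k q k (proj₁ f) 1≤k (trans (cong (_+ n) (sym (*-zeroʳ (2 ^ a * s)))) e)
    -- For k < a size decides: q and 2^k are at most half of 2^a, with q strictly below it, while a
    -- positive h makes the left side at least 2^a.
    none (suc h) q k f 1≤k e | no a≰k = <⇒≱ small (≤-trans large (≤-reflexive e))
      where
      large : 2 ^ a ≤ 2 ^ a * s * suc h + n
      large = ≤-trans (≤-trans (≤-reflexive (sym (*-identityʳ (2 ^ a)))) (≤-trans (*-monoʳ-≤ (2 ^ a) (1≤radical m))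
        (≤-trans (≤-reflexive (sym (*-identityʳ (2 ^ a * s)))) (*-monoʳ-≤ (2 ^ a * s) (s≤s z≤n))))) (m≤m+n _ n)
      small : q + 2 ^ k < 2 ^ a
      small = ≤-trans (+-mono-≤ (≤-trans (s≤s (≤-trans (factor≤m f) (m≤n+m m n))) (n<2^n (n + m)))
        (^-monoʳ-≤ 2 (≤-pred (≰⇒> a≰k)))) (≤-reflexive (cong (2 ^ (n + m) +_) (sym (+-identityʳ (2 ^ (n + m))))))

  module _ (r₀ : ℕ) (n+m<r₀ : n + m < r₀) (mersenne : MersenneExponent (suc r₀)) where

    M : ℕ
    M = 2 ^ suc r₀ ∸ 1

    private
      1+M : suc M ≡ 2 ^ suc r₀
      1+M = m+[n∸m]≡n (m^n>0 2 (suc r₀))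

      r₀<M : r₀ < M
      r₀<M = ≤-pred (≤-trans (n<2^n (suc r₀)) (≤-reflexive (sym 1+M)))

      small<M : ∀ {q} → q ≤ n + m → q < M
      small<M q≤ = <-trans (≤-<-trans q≤ n+m<r₀) r₀<M

      instance
        M≢0 : NonZero M
        M≢0 = Data.Nat.>-nonZero (≤-trans (s≤s z≤n) r₀<M)

      -- A new prime factor is harmless for squarefreeness only if it is absent from s; here M
      -- exceeds m.
      M∤s : ¬ (M ∣ s)
      M∤s M∣s = <⇒≱ (small<M (m≤n+m m n)) (proj₁ (radical-factor m mersenne M∣s))

      2∤Ms : ¬ (2 ∣ M * s)
      2∤Ms 2∣ with euclidsLemma M s prime[2] 2∣
      ... | inj₂ 2∣s = s-odd 2∣s
      ... | inj₁ 2∣M = <⇒≱ (small<M (≤-trans 2≤m (m≤n+m m n))) (≤-reflexive (sym (prime∣prime prime[2] mersenne 2∣M)))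

      2^-mod : ∀ j t → ∃[ c ] 2 ^ (t * suc r₀ + j) ≡ 2 ^ j + M * c
      2^-mod j zero    = 0 , sym (trans (cong (2 ^ j +_) (*-zeroʳ M)) (+-identityʳ (2 ^ j)))
      2^-mod j (suc t) with 2^-mod j t
      ... | c , e = 2 ^ j + M * c + c , trans (trans (cong (2 ^_) (+-assoc (suc r₀) (t * suc r₀) j)) (^-distribˡ-+-* 2 (suc r₀) (t * suc r₀ + j)))
        (trans (cong₂ _*_ (sym 1+M) e) (lem M (2 ^ j) c))
        where
        lem : ∀ M x c → suc M * (x + M * c) ≡ x + M * (x + M * c + c)
        lem = solve-∀

    indexK : IndexK (2 * (M * s)) n
    indexK = indexI 1≤m′ (m∣m*n (M * s)) (λ f → ∣n⇒∣m*n 2 (∣n⇒∣m*n M (factor-∣s f))) none ,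
      squareFree 1≤m′ (noPrimeSquare-* prime[2] 2∤Ms (noPrimeSquare-* mersenne M∤s (radical-noPrimeSquare m)))
      where
      1≤m′ : 1 ≤ 2 * (M * s)
      1≤m′ = *-mono-≤ {1} {2} (s≤s z≤n) (*-mono-≤ (≤-trans (s≤s z≤n) r₀<M) (1≤radical m))
      none : ∀ h q k → OddPrimeFactor q → 1 ≤ k → 2 * (M * s) * h + n ≢ q + 2 ^ k
      none h q k f 1≤k e with 2^-mod (k % suc r₀) (k / suc r₀)
      ... | c , 2^k≡ = impossible (k % suc r₀) (m%n<n k (suc r₀)) refl
        where
        impossible : ∀ j → j < suc r₀ → j ≡ k % suc r₀ → ⊥
        impossible j j<r j≡ = conclude j n≡q+2^j
          where
          -- As q + 2 ≤ r₀ + 1 ≤ 2^r₀ and j ≤ r₀, the sum q + 2 + 2^j is at most 2^(r₀ + 1) = M + 1.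
          -- Thus both sides of the congruence modulo M are reduced and must be equal.
          q+2^j<M : q + 2 ^ j < M
          q+2^j<M = ≤-pred (≤-trans (≤-trans (≤-reflexive (sym (+-suc (suc q) (2 ^ j))))
            (≤-trans (≤-reflexive (lem q (2 ^ j))) (+-mono-≤ (≤-trans (s≤s (≤-trans (s≤s (≤-trans (factor≤m f) (m≤n+m m n))) n+m<r₀)) (n<2^n r₀)) (^-monoʳ-≤ 2 (≤-pred j<r)))))
            (≤-reflexive (trans (cong (2 ^ r₀ +_) (sym (+-identityʳ (2 ^ r₀)))) (sym 1+M))))
            where
            lem : ∀ q t → suc q + suc t ≡ suc (suc q) + t
            lem = solve-∀
          n≡q+2^j : n ≡ q + 2 ^ j
          n≡q+2^j = trans (sym (m<n⇒m%n≡m (small<M (m≤m+n n m)))) (trans (sym (%-remove-+ˡ n (∣m⇒∣m*n h (∣n⇒∣m*n 2 (m∣m*n s)))))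
            (trans (cong (_% M) (trans e (cong (q +_) (trans (cong (2 ^_) (trans (m≡m%n+[m/n]*n k (suc r₀)) (+-comm (k % suc r₀) _))) (trans 2^k≡ (cong (λ j → 2 ^ j + M * c) (sym j≡)))))))
              (trans (cong (_% M) (sym (+-assoc q (2 ^ j) (M * c)))) (trans (%-remove-+ʳ (q + 2 ^ j) (m∣m*n c)) (m<n⇒m%n≡m q+2^j<M)))))
          conclude : ∀ j → n ≡ q + 2 ^ j → ⊥
          conclude (suc j) n≡ = n≢p+2^k q (suc j) (proj₁ f) (s≤s z≤n) n≡
          -- Reducing the exponent can produce 2^0, which membership in U does not exclude; but q +
          -- 1 is even and n is odd.
          conclude zero n≡ = n-odd (subst (2 ∣_) (sym n≡) (odd+odd {q} {1} (λ 2∣q → proj₁ (proj₂ f) (sym (prime∣prime prime[2] (proj₁ f) 2∣q))) (λ 2∣1 → ¬prime[1] (subst Prime (∣1⇒≡1 2∣1) prime[2]))))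

theorem5 : (∀ (n : ℕ) → InUnion IndexI n ⇔ InUnion IndexJ n)
    × (InfinitelyManyMersennePrimes → ∀ (n : ℕ) → InUnion IndexI n ⇔ InUnion IndexK n)
theorem5 = (λ n → mk⇔ toJ (weaken proj₁)) , (λ mersenne n → mk⇔ (toK mersenne) (weaken proj₁))
  where
  weaken : ∀ {P : ℕ → ℕ → Set} {n} → (∀ {m b} → P m b → IndexI m b) → InUnion P n → InUnion IndexI n
  weaken P⇒I (m , b , P , ap) = m , b , P⇒I P , ap
  toJ : ∀ {n} → InUnion IndexI n → InUnion IndexJ n
  toJ (m , b , I , h₀ , refl) = 2 ^ a * s , n , indexJ , inAP (2 ^ a * s)
    where open Progression {m} {b} {h₀} I
  toK : InfinitelyManyMersennePrimes → ∀ {n} → InUnion IndexI n → InUnion IndexK n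
  -- One `suc` is spent on writing the exponent as r₀ + 1, the other on the strict inequality n + m
  -- < r₀.
  toK mersenne (m , b , I , h₀ , refl) with mersenne (suc (suc (m * h₀ + b + m)))
  ... | suc r₀ , s≤s N≤r₀ , prime-M = 2 * (M r₀ N≤r₀ prime-M * s) , n , indexK r₀ N≤r₀ prime-M , inAP (2 * (M r₀ N≤r₀ prime-M * s))
    where open Progression {m} {b} {h₀} I
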